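{- Let $(V,E,F)$ be a tree interpolation problem with partitions $P$, where each $F(p)$ is a conjunction of input clauses, and let a resolution proof of the unsatisfiability of $\bigwedge_{p\in P}F(p)$ be given whose leaves are input clauses, instantiation lemmas and theory lemmas. Let an arbitrary colouring of the literals of the proof be fixed, each literal being assigned to exactly one partition (only proxy literals have a prescribed colour). Label every clause of the proof by a family $(I_A)$, where $A=\mathit{st}(v)$ ranges over $v\in V$ and $A^c=P\setminus A$, computed separately for each node $v$, inductively as follows. Input clauses and instantiation lemmas. If $C$ is an input clause from partition $p$, or an instantiation lemma $C\equiv\lnot(\forall\bar x.\,\phi(\bar x))\lor\phi(\bar t)$ with $p=\mathit{colour}(\forall\bar x.\,\phi(\bar x))$, then $I_A\equiv\lnot\bigl((\lnot C)\downharpoonright^{ - }A^c\bigr)$ if $p\in A$ and $I_A\equiv(\lnot C)\downharpoonright^{ - }A$ if $p\notin A$. Theory lemmas. (a) Transitivity, $\lnot C\equiv t_1=t_2\land\dots\land t_{n-1}=t_n\land t_1\neq t_n$. Write $v_i$ for $v_{t_i}$ and let $i_1<\dots<i_m$ be the boundary indices: an index $i$ with $1<i<n$ is one iff exactly one of $\mathit{colour}(t_{i-1}=t_i)$, $\mathit{colour}(t_i=t_{i+1})$ is in $A$; $1$ is one iff exactly one of $\mathit{colour}(t_1=t_n)$, $\mathit{colour}(t_1=t_2)$ is in $A$; $n$ is one iff exactly one of $\mathit{colour}(t_{n-1}=t_n)$, $\mathit{colour}(t_1=t_n)$ is in $A$. If $m=0$, then $I_A\equiv\bot$ if all these colours are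 in $A$, and $I_A\equiv\top$ if they are all in $A^c$. If $m>0$, then $I_A\equiv v_{i_1}=v_{i_2}\land v_{i_3}=v_{i_4}\land\dots\land v_{i_{m-1}}=v_{i_m}$ if $\mathit{colour}(t_1=t_n)\notin A$, and $I_A\equiv v_{i_2}=v_{i_3}\land\dots\land v_{i_{m-2}}=v_{i_{m-1}}\land v_{i_m}\neq v_{i_1}$ if $\mathit{colour}(t_1=t_n)\in A$. (b) Congruence, $C\equiv f(t_1,\dots,t_n)=f(s_1,\dots,s_n)\lor t_1\neq s_1\lor\dots\lor t_n\neq s_n$ with $f$ uninterpreted: first choose an arbitrary $p_f\in\mathit{partitions}(f)$ (once for the lemma) and set $I_A\equiv\lnot\bigl((\lnot C)\downharpoonright^{ - }A^c\bigr)$ if $p_f\in A$ and $I_A\equiv(\lnot C)\downharpoonright^{ - }A$ otherwise. (c) Trichotomy, $C\equiv t_1=t_2\lor t_1>t_2\lor t_1<t_2$: $I_A$ is either of $(\lnot C)\downharpoonright^{ - }A$ and $\lnot\bigl((\lnot C)\downharpoonright^{ - }A^c\bigr)$ (one can always choose the one whose projection contains at most one literal). (d) Farkas, $C\equiv\lnot\ell_1\lor\dots\lor\lnot\ell_n$, where the flattened version of $\ell_i$ is $s_i\le b_i$ ($s_i$ of the form $c_1\cdot v_1+\dots+c_n\cdot v_n$, $b_i$ a rational constant) and $k_i>0$ are the Farkas coefficients, i.e. constants with $\sum_i k_i\cdot s_i=0$ and $\sum_i k_i\cdot b_i<0$: $I_A\equiv\bot$ if all $\mathit{colour}(\ell_i)\in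 A$, and otherwise $I_A\equiv\bigl(\sum_{i:\,\mathit{colour}(\ell_i)\in A}k_i\cdot s_i\bigr)\le\bigl(\sum_{i:\,\mathit{colour}(\ell_i)\in A}k_i\cdot b_i\bigr)$, with variables whose coefficients sum to zero removed. (e) Any other theory lemma $C$: $(I_A)$ is a partial tree interpolant for $C$ supplied by the theory. Resolution steps. If the clause $C_1\lor C_2$ is the resolvent of $C_1\lor\ell$ labelled $(I^1_A)$ and $C_2\lor\lnot\ell$ labelled $(I^2_A)$, start with $I_A:=I^1_A\lor I^2_A$ if $\mathit{colour}(\ell)\in A$ and $I_A:=I^1_A\land I^2_A$ if $\mathit{colour}(\ell)\notin A$. Call a variable unsupported if it is supported by a premise but no longer supported by $C_1\lor C_2$. As long as $\mathit{FreeVars}(I_A)$ contains an unsupported variable, choose an unsupported $v_t\in\mathit{FreeVars}(I_A)$ that does not occur in the right-hand side of an equality in $\mathit{FlatEQ}(t')$ for any $v_{t'}\in\mathit{FreeVars}(I_A)$ (such an outermost unsupported variable always exists) and, with $t=f(t_1,\dots,t_n)$, replace $I_A$ by $\exists x.\,I_A\{v_t\mapsto x\}$ if $\mathit{partitions}(f)\subseteq A$, by $\forall x.\,I_A\{v_t\mapsto x\}$ if $\mathit{partitions}(f)\cap A=\emptyset$, and by $I_A\{v_t\mapsto f(v_{t_1},\dots,v_{t_n})\}$ otherwise ($x$ a new variable). Repeat this for all unsupported variables in $\mathit{FreeVars}(I_A)$. Then this algorithm computes valid tree interpolants: the labelling $v\mapsto I_{\mathit{st}(v)}$ obtained for the empty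 clause at the root of the proof is a tree interpolant for $(V,E,F)$.
   Context: Logic. We work in first-order logic modulo a theory $\mathcal T$, which may be a combination of theories such as equality with uninterpreted functions, linear rational arithmetic (predicates $\le,<$, rational constants, addition, multiplication by rational constants), and further theories, each of which produces its own theory lemmas and supplies partial tree interpolants for them. "Implies", "unsatisfiable" and $\equiv$ (equivalence) are modulo $\mathcal T$; free variables are treated as universally quantified in validity statements. Constants are $0$-ary functions and uninterpreted predicates are Boolean-valued functions. Arithmetic conversions are applied implicitly; e.g. $x\le y$, $y\ge x$ and $1\cdot x+(-1)\cdot y\le 0$ are the same literal and $x>y$ is its negation. $\mathit{symb}(G)$ is the set of uninterpreted function symbols occurring in a formula $G$, and $\mathit{FreeVars}(G)$ is the set of its free variables. $G\{x\mapsto t\}$ is substitution of $t$ for $x$. Clauses are disjunctions of literals; $\lnot C$ is regarded as a conjunction of literals. Tree interpolation. A tree interpolation problem $(V,E,F)$ is a labelled binary tree with nodes $V$ and edges $E\subseteq V\times V$ directed towards the root; every non-leaf node has exactly two incoming edges (two children). The partitions $P\subseteq V$ are the leaves. $F$ assigns a formula $F(p)$ to each $p\in P$ such that $\bigwedge_{p\in P}F(p)$ is unsatisfiable. For $v\in V$, $\mathit{st}(v)\subseteq P$ is the set of leaves in the subtree of $v$. A tree interpolant is a labelling $I$ of all nodes by formulas such that: (i) $I(v_r)\equiv\bot$ for the root $v_r$; (ii) for each leaf $p$, $F(p)$ implies $I(p)$; (iii) for each inner node $v$, the conjunction of the labels of its two children implies $I(v)$; (iv) for each $v$, $\mathit{symb}(I(v))\subseteq\bigl(\bigcup_{p\in\mathit{st}(v)}\mathit{symb}(F(p))\bigr)\cap\bigl(\bigcup_{p\in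 P\setminus\mathit{st}(v)}\mathit{symb}(F(p))\bigr)$. One writes $I_A$ for $I(v)$ when $A=\mathit{st}(v)$. Input and proofs. The input formulas are in CNF. Literals are either ordinary (equalities, linear inequalities, or their negations) or proxy literals (Boolean proxy atoms created during the CNF conversion, or quantified clauses $\forall\bar x.\,\ell_1(\bar x)\lor\dots\lor\ell_n(\bar x)$ treated as a single literal, and negations of these). Each input clause occurs in exactly one partition. Preprocessing is done locally for each input formula, so each proxy literal is created from one partition. A resolution proof is a DAG of clauses whose leaves are input clauses, theory lemmas (clauses valid in $\mathcal T$), or instantiation lemmas $\lnot(\forall\bar x.\,\phi(\bar x))\lor\phi(\bar t)$ (with $\phi$ a disjunction of literals), whose inner nodes are resolvents $C_1\lor C_2$ of $C_1\lor\ell$ and $C_2\lor\lnot\ell$ ($\ell$ is the pivot), and whose unique root is the empty clause $\bot$. Partitions of symbols. The partitions of a function symbol $f$ are the partitions where it occurs: $\mathit{partitions}(f)=\{p\in P\mid f\in\mathit{symb}(F(p))\}$. Flattening. For every term $t$ occurring in the proof there is a fresh variable $v_t$, and $\mathit{FlatEQ}(t)=\{v_{f(t_1,\dots,t_n)}=f(v_{t_1},\dots,v_{t_n})\mid f(t_1,\dots,t_n)\text{ is a subterm of }t\}$. For $\ell\equiv t_1=t_2$: $\mathit{flatten}(\ell)\equiv v_{t_1}=v_{t_2}$ and $\mathit{FlatEQ}(\ell)=\mathit{FlatEQ}(t_1)\cup\mathit{FlatEQ}(t_2)$. For $\ell\equiv c_1\cdot t_1+\dots+c_n\cdot t_n\le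 c$: $\mathit{flatten}(\ell)\equiv c_1\cdot v_{t_1}+\dots+c_n\cdot v_{t_n}\le c$ and $\mathit{FlatEQ}(\ell)=\bigcup_i\mathit{FlatEQ}(t_i)$. For proxy literals $\mathit{flatten}(\ell)\equiv\ell$ and $\mathit{FlatEQ}(\ell)=\emptyset$. For negations, $\mathit{flatten}(\lnot\ell)\equiv\lnot\mathit{flatten}(\ell)$ and $\mathit{FlatEQ}(\lnot\ell)=\mathit{FlatEQ}(\ell)$. Colouring and projection. Each literal $\ell$ has a colour $\mathit{colour}(\ell)\in P$, with $\mathit{colour}(\lnot\ell)=\mathit{colour}(\ell)$; a proxy literal is coloured with the input partition from which it was created; other colours are arbitrary. The projection kernel $\ell\downharpoonright^{ - }p$ is $\mathit{flatten}(\ell)$ if $p=\mathit{colour}(\ell)$ and $\top$ otherwise. $\mathit{FlatEQ}(\ell)\downharpoonright p$ is the conjunction of those equalities $v_{f(t_1,\dots,t_n)}=f(v_{t_1},\dots,v_{t_n})$ in $\mathit{FlatEQ}(\ell)$ with $p\in\mathit{partitions}(f)$. The projection is $\ell\downharpoonright p\equiv(\ell\downharpoonright^{ - }p)\land(\mathit{FlatEQ}(\ell)\downharpoonright p)$. For $A\subseteq P$, $\ell\downharpoonright A$ and $\ell\downharpoonright^{ - }A$ are the conjunctions over $p\in A$; both operations extend to conjunctions of literals conjunct-wise (the empty conjunction is $\top$). Partial tree interpolants. A variable $v_t$ is supported by a clause $C$ if $t$ is a subterm of a non-proxy literal of $C$. A partial tree interpolant for $C$ is a tree interpolant for the problem $(V,E,F')$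 with $F'(p):=F(p)\land((\lnot C)\downharpoonright p)$, where for the symbol condition the labels may contain, besides the symbols occurring in $F$ both inside and outside of the subtree, exactly the variables supported by $C$, and all variables supported by $C$ may occur in all labels.
   Formalization: The order of eliminating unsupported variables is fixed once per resolution step for all tree nodes; every uninterpreted symbol of the proof must occur in some partition; interpreted functions count as in every partition. Without these the claim is false. -}

module Defs where

open import Data.Bool using (Bool; true; false; T; not; if_then_else_; _xor_)
open import Data.Empty using (⊥)
open import Data.List using (List; []; _∷_; _++_; map; concatMap; foldr; filter; filterᵇ; all)
open import Data.List.Membership.Propositional using (_∈_; _∉_)
open import Data.List.Membership.Propositional.Properties using (∈-++⁺ˡ)
open import Data.List.Properties using (≡-dec)
open import Data.List.Relation.Binary.Permutation.Propositional using (_↭_)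
open import Data.List.Relation.Unary.All using (All; []; _∷_; lookup)
open import Data.List.Relation.Unary.Any using (here; there)
open import Data.Product using (∃-syntax; _×_; _,_)
open import Data.Rational using (ℚ; 0ℚ; 1ℚ; _+_; _*_; -_; _≤_; _<_)
import Data.Rational.Properties as ℚ
open import Data.Sum using (_⊎_)
open import Data.Unit using (⊤; tt)
open import Function using (_∘_; id)
open import Relation.Binary using (DecidableEquality)
open import Relation.Binary.PropositionalEquality using (_≡_; refl)
open import Relation.Nullary using (¬_; Dec; yes; no; does; ¬?)

data Sort (U : Set) : Set where
  bool rat : Sort U
  usr      : U → Sort U

-- Uninterpreted predicates are functions into the sort bool, and the atom
-- p(t) is the equality p(t) = true.
data Builtin {U : Set} : List (Sort U) → Sort U → Set where
  truth  : Bool → Builtin [] bool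
  const  : ℚ → Builtin [] rat
  add    : Builtin (rat ∷ rat ∷ []) rat
  scale  : ℚ → Builtin (rat ∷ []) rat

record Signature : Set₁ where
  field
    USort : Set
    UFun  : List (Sort USort) → Sort USort → Set   -- uninterpreted
    TFun  : List (Sort USort) → Sort USort → Set   -- interpreted by further theories
    PAtom : Set                                    -- Boolean proxy atoms
    _≟ˢ_  : DecidableEquality USort
    _≟ᵘ_  : ∀ {as s} → DecidableEquality (UFun as s)
    _≟ᵗ_  : ∀ {as s} → DecidableEquality (TFun as s)
    _≟ᵖ_  : DecidableEquality PAtom

module Logic (Sg : Signature) where
  open Signature Sg

  Srt : Set
  Srt = Sort USort

  Ctx : Set
  Ctx = List Srt

  data Op (as : List Srt) (s : Srt) : Set where
    un : UFun as s → Op as s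
    th : TFun as s → Op as s
    bi : Builtin as s → Op as s

  data Tm (V : Srt → Set) : Srt → Set where
    var : ∀ {s} → V s → Tm V s
    app : ∀ {as s} → Op as s → All (Tm V) as → Tm V s

  module _ {V W : Srt → Set} (σ : ∀ {s} → V s → Tm W s) where
    bind  : ∀ {s} → Tm V s → Tm W s
    binds : ∀ {as} → All (Tm V) as → All (Tm W) as
    bind (var x)    = σ x
    bind (app f ts) = app f (binds ts)
    binds []       = []
    binds (t ∷ ts) = bind t ∷ binds ts

  Term : Ctx → Srt → Set
  Term Γ = Tm (_∈ Γ)

  Ground : Srt → Set
  Ground = Term []

  -- (s , t) stands for the auxiliary variable v_t.
  Var : Set
  Var = ∃[ s ] Ground s

  Lin : (Srt → Set) → Set
  Lin V = List (ℚ × Tm V rat)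

  mapLin : ∀ {V W} → (Tm V rat → Tm W rat) → Lin V → Lin W
  mapLin h = map (λ (c , t) → c , h t)

  -- A proxy is created during preprocessing, so a quantified clause that is a
  -- literal of another quantified clause does not depend on its variables.
  data Atom (Γ : Ctx) : Set
  data Literal (Γ : Ctx) : Set
  data Proxy : Set

  data Atom Γ where
    eq    : ∀ {s} → Term Γ s → Term Γ s → Atom Γ
    le    : Lin (_∈ Γ) → ℚ → Atom Γ
    proxy : Proxy → Atom Γ

  data Literal Γ where
    pos neg : Atom Γ → Literal Γ

  data Proxy where
    patom : PAtom → Proxy
    all∀  : (Δ : Ctx) → List (Literal Δ) → Proxy

  Clause : Set
  Clause = List (Literal [])

  atom : ∀ {Γ} → Literal Γ → Atom Γ
  atom (pos a) = a
  atom (neg a) = a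

  flip : ∀ {Γ} → Literal Γ → Literal Γ
  flip (pos a) = neg a
  flip (neg a) = pos a

  -- The result stands for the conjunction ¬ C.
  negate : Clause → List (Literal [])
  negate = map flip

  _≤ᵃ_ : Ground rat → Ground rat → Atom []
  t ≤ᵃ u = le ((1ℚ , t) ∷ (- 1ℚ , u) ∷ []) 0ℚ

  instAtom : ∀ {Δ} → All Ground Δ → Atom Δ → Atom []
  instAtom σ (eq t u)  = eq (bind (lookup σ) t) (bind (lookup σ) u)
  instAtom σ (le l c)  = le (mapLin (bind (lookup σ)) l) c
  instAtom σ (proxy q) = proxy q

  inst : ∀ {Δ} → All Ground Δ → Literal Δ → Literal []
  inst σ (pos a) = pos (instAtom σ a)
  inst σ (neg a) = neg (instAtom σ a)

  -- Inequalities that differ only by the order of the summands and a positive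
  -- factor are the same literal.
  data _≋ᵃ_ : Atom [] → Atom [] → Set where
    refl  : ∀ {a} → a ≋ᵃ a
    arith : ∀ {l l′ c} k → 0ℚ < k → l′ ↭ map (λ (d , t) → k * d , t) l →
            le l c ≋ᵃ le l′ (k * c)

  data _≋_ : Literal [] → Literal [] → Set where
    pos : ∀ {a b} → a ≋ᵃ b → pos a ≋ pos b
    neg : ∀ {a b} → a ≋ᵃ b → neg a ≋ neg b

  _⊑_ : Clause → Clause → Set
  C ⊑ D = ∀ {ℓ} → ℓ ∈ C → ∃[ ℓ′ ] ℓ′ ∈ D × ℓ ≋ ℓ′

  -- equality of clauses as sets of literals
  _≈_ : Clause → Clause → Set
  C ≈ D = C ⊑ D × D ⊑ C

  -- Formulas have de Bruijn indices as bound variables and the v_t as free ones.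
  data FVar (Γ : Ctx) (s : Srt) : Set where
    bnd  : s ∈ Γ → FVar Γ s
    free : Ground s → FVar Γ s

  FTm : Ctx → Srt → Set
  FTm Γ = Tm (FVar Γ)

  infix  7 ¬ᶠ_
  infixr 6 _∧ᶠ_
  infixr 5 _∨ᶠ_

  data Form (Γ : Ctx) : Set where
    ⊤ᶠ ⊥ᶠ     : Form Γ
    prop      : PAtom → Form Γ
    eq        : ∀ {s} → FTm Γ s → FTm Γ s → Form Γ
    le        : Lin (FVar Γ) → ℚ → Form Γ
    ¬ᶠ_       : Form Γ → Form Γ
    _∧ᶠ_ _∨ᶠ_ : Form Γ → Form Γ → Form Γ
    ∀ᶠ ∃ᶠ     : ∀ s → Form (s ∷ Γ) → Form Γ

  ⋀ ⋁ : ∀ {Γ} → List (Form Γ) → Form Γ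
  ⋀ = foldr _∧ᶠ_ ⊤ᶠ
  ⋁ = foldr _∨ᶠ_ ⊥ᶠ

  ∀* : ∀ {Γ} Δ → Form (Δ ++ Γ) → Form Γ
  ∀* []      A = A
  ∀* (s ∷ Δ) A = ∀* Δ (∀ᶠ s A)

  atomForm   : ∀ {Δ Γ} → (∀ {s} → s ∈ Δ → FVar Γ s) → Atom Δ → Form Γ
  litForm    : ∀ {Δ Γ} → (∀ {s} → s ∈ Δ → FVar Γ s) → Literal Δ → Form Γ
  clauseForm : ∀ {Δ Γ} → (∀ {s} → s ∈ Δ → FVar Γ s) → List (Literal Δ) → Form Γ
  proxyForm  : ∀ {Γ} → Proxy → Form Γ
  atomForm ι (eq t u)    = eq (bind (var ∘ ι) t) (bind (var ∘ ι) u)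
  atomForm ι (le l c)    = le (mapLin (bind (var ∘ ι)) l) c
  atomForm ι (proxy q)   = proxyForm q
  litForm ι (pos a)      = atomForm ι a
  litForm ι (neg a)      = ¬ᶠ atomForm ι a
  clauseForm ι []        = ⊥ᶠ
  clauseForm ι (ℓ ∷ C)   = litForm ι ℓ ∨ᶠ clauseForm ι C
  proxyForm (patom b)    = prop b
  proxyForm (all∀ Δ φ)   = ∀* Δ (clauseForm (bnd ∘ ∈-++⁺ˡ) φ)

  groundClause : Clause → Form []
  groundClause = clauseForm bnd

  weaken : ∀ {Γ s₀ s} → FVar Γ s → FTm (s₀ ∷ Γ) s
  weaken (bnd i)  = var (bnd (there i))
  weaken (free t) = var (free t)

  lift : ∀ {Γ Γ′ s₀} → (∀ {s} → FVar Γ s → FTm Γ′ s) →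
         ∀ {s} → FVar (s₀ ∷ Γ) s → FTm (s₀ ∷ Γ′) s
  lift σ (bnd (here e))  = var (bnd (here e))
  lift σ (bnd (there i)) = bind weaken (σ (bnd i))
  lift σ (free t)        = bind weaken (σ (free t))

  subst : ∀ {Γ Γ′} → (∀ {s} → FVar Γ s → FTm Γ′ s) → Form Γ → Form Γ′
  subst σ ⊤ᶠ       = ⊤ᶠ
  subst σ ⊥ᶠ       = ⊥ᶠ
  subst σ (prop b) = prop b
  subst σ (eq t u) = eq (bind σ t) (bind σ u)
  subst σ (le l c) = le (mapLin (bind σ) l) c
  subst σ (¬ᶠ A)   = ¬ᶠ subst σ A
  subst σ (A ∧ᶠ B) = subst σ A ∧ᶠ subst σ B
  subst σ (A ∨ᶠ B) = subst σ A ∨ᶠ subst σ B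
  subst σ (∀ᶠ s A) = ∀ᶠ s (subst (lift σ) A)
  subst σ (∃ᶠ s A) = ∃ᶠ s (subst (lift σ) A)

  _≟srt_ : DecidableEquality Srt
  bool  ≟srt bool  = yes refl
  bool  ≟srt rat   = no λ ()
  bool  ≟srt usr _ = no λ ()
  rat   ≟srt bool  = no λ ()
  rat   ≟srt rat   = yes refl
  rat   ≟srt usr _ = no λ ()
  usr _ ≟srt bool  = no λ ()
  usr _ ≟srt rat   = no λ ()
  usr a ≟srt usr b with a ≟ˢ b
  ... | yes refl = yes refl
  ... | no  a≢b  = no λ { refl → a≢b refl }

  _≟bi_ : ∀ {as s} → DecidableEquality (Builtin {USort} as s)
  truth a ≟bi truth b with Data.Bool._≟_ a b
  ... | yes refl = yes refl
  ... | no  a≢b  = no λ { refl → a≢b refl }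
  const a ≟bi const b with a ℚ.≟ b
  ... | yes refl = yes refl
  ... | no  a≢b  = no λ { refl → a≢b refl }
  add     ≟bi add     = yes refl
  scale a ≟bi scale b with a ℚ.≟ b
  ... | yes refl = yes refl
  ... | no  a≢b  = no λ { refl → a≢b refl }

  _≟op_ : ∀ {as s} → DecidableEquality (Op as s)
  un f ≟op un g with f ≟ᵘ g
  ... | yes refl = yes refl
  ... | no  f≢g  = no λ { refl → f≢g refl }
  un _ ≟op th _ = no λ ()
  un _ ≟op bi _ = no λ ()
  th _ ≟op un _ = no λ ()
  th f ≟op th g with f ≟ᵗ g
  ... | yes refl = yes refl
  ... | no  f≢g  = no λ { refl → f≢g refl }
  th _ ≟op bi _ = no λ ()
  bi _ ≟op un _ = no λ ()
  bi _ ≟op th _ = no λ ()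
  bi f ≟op bi g with f ≟bi g
  ... | yes refl = yes refl
  ... | no  f≢g  = no λ { refl → f≢g refl }

  _≟tm_  : ∀ {s} → DecidableEquality (Ground s)
  _≟tms_ : ∀ {as} → DecidableEquality (All Ground as)
  app {as} f ts ≟tm app {bs} g us with ≡-dec _≟srt_ as bs
  ... | no  as≢bs = no λ { refl → as≢bs refl }
  ... | yes refl with f ≟op g
  ...   | no  f≢g  = no λ { refl → f≢g refl }
  ...   | yes refl with ts ≟tms us
  ...     | no  ts≢us = no λ { refl → ts≢us refl }
  ...     | yes refl  = yes refl
  []       ≟tms []       = yes refl
  (t ∷ ts) ≟tms (u ∷ us) with t ≟tm u | ts ≟tms us
  ... | yes refl | yes refl  = yes refl
  ... | no  t≢u  | _         = no λ { refl → t≢u refl }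
  ... | yes _    | no  ts≢us = no λ { refl → ts≢us refl }

  data Sym : Set where
    fun   : ∀ {as s} → UFun as s → Sym
    patom : PAtom → Sym

  _≟sym_ : DecidableEquality Sym
  fun {as} {s} f ≟sym fun {bs} {r} g with ≡-dec _≟srt_ as bs | s ≟srt r
  ... | no  as≢bs | _        = no λ { refl → as≢bs refl }
  ... | yes _     | no  s≢r  = no λ { refl → s≢r refl }
  ... | yes refl  | yes refl with f ≟ᵘ g
  ...   | yes refl = yes refl
  ...   | no  f≢g  = no λ { refl → f≢g refl }
  fun _   ≟sym patom _ = no λ ()
  patom _ ≟sym fun _   = no λ ()
  patom a ≟sym patom b with a ≟ᵖ b
  ... | yes refl = yes refl
  ... | no  a≢b  = no λ { refl → a≢b refl }

  symbOp : ∀ {as s} → Op as s → List Sym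
  symbOp (un f) = fun f ∷ []
  symbOp (th _) = []
  symbOp (bi _) = []

  symbTm  : ∀ {V s} → Tm V s → List Sym
  symbTms : ∀ {V as} → All (Tm V) as → List Sym
  symbTm (var _)    = []
  symbTm (app f ts) = symbOp f ++ symbTms ts
  symbTms []       = []
  symbTms (t ∷ ts) = symbTm t ++ symbTms ts

  symb : ∀ {Γ} → Form Γ → List Sym
  symb ⊤ᶠ       = []
  symb ⊥ᶠ       = []
  symb (prop b) = patom b ∷ []
  symb (eq t u) = symbTm t ++ symbTm u
  symb (le l c) = concatMap (λ (_ , t) → symbTm t) l
  symb (¬ᶠ A)   = symb A
  symb (A ∧ᶠ B) = symb A ++ symb B
  symb (A ∨ᶠ B) = symb A ++ symb B
  symb (∀ᶠ s A) = symb A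
  symb (∃ᶠ s A) = symb A

  freeTm  : ∀ {Γ s} → FTm Γ s → List Var
  freeTms : ∀ {Γ as} → All (FTm Γ) as → List Var
  freeTm (var (bnd _))  = []
  freeTm (var (free t)) = (_ , t) ∷ []
  freeTm (app f ts)     = freeTms ts
  freeTms []       = []
  freeTms (t ∷ ts) = freeTm t ++ freeTms ts

  FreeVars : ∀ {Γ} → Form Γ → List Var
  FreeVars ⊤ᶠ       = []
  FreeVars ⊥ᶠ       = []
  FreeVars (prop b) = []
  FreeVars (eq t u) = freeTm t ++ freeTm u
  FreeVars (le l c) = concatMap (λ (_ , t) → freeTm t) l
  FreeVars (¬ᶠ A)   = FreeVars A
  FreeVars (A ∧ᶠ B) = FreeVars A ++ FreeVars B
  FreeVars (A ∨ᶠ B) = FreeVars A ++ FreeVars B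
  FreeVars (∀ᶠ s A) = FreeVars A
  FreeVars (∃ᶠ s A) = FreeVars A

  subterms  : ∀ {s} → Ground s → List Var
  subtermss : ∀ {as} → All Ground as → List Var
  subterms (app f ts) = (_ , app f ts) ∷ subtermss ts
  subtermss []       = []
  subtermss (t ∷ ts) = subterms t ++ subtermss ts

  atomSubterms : Atom [] → List Var
  atomSubterms (eq t u)  = subterms t ++ subterms u
  atomSubterms (le l c)  = concatMap (λ (_ , t) → subterms t) l
  atomSubterms (proxy q) = []

  Supported : Clause → Var → Set
  Supported C u = u ∈ concatMap (atomSubterms ∘ atom) C

  -- Proxies nested in quantified clauses count as well.
  litProxies    : ∀ {Δ} → Literal Δ → List Proxy
  atomProxies   : ∀ {Δ} → Atom Δ → List Proxy
  clauseProxies : ∀ {Δ} → List (Literal Δ) → List Proxy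
  proxyProxies  : Proxy → List Proxy
  litProxies (pos a)        = atomProxies a
  litProxies (neg a)        = atomProxies a
  atomProxies (eq _ _)      = []
  atomProxies (le _ _)      = []
  atomProxies (proxy q)     = q ∷ proxyProxies q
  clauseProxies []          = []
  clauseProxies (ℓ ∷ C)     = litProxies ℓ ++ clauseProxies C
  proxyProxies (patom b)    = []
  proxyProxies (all∀ Δ φ)   = clauseProxies φ

  v : ∀ {Γ s} → Ground s → FTm Γ s
  v t = var (free t)

  vs : ∀ {Γ as} → All Ground as → All (FTm Γ) as
  vs []       = []
  vs (t ∷ ts) = v t ∷ vs ts

  flattenAtom : Atom [] → Form []
  flattenAtom (eq t u)  = eq (v t) (v u)
  flattenAtom (le l c)  = le (mapLin v l) c
  flattenAtom (proxy q) = proxyForm q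

  flatten : Literal [] → Form []
  flatten (pos a) = flattenAtom a
  flatten (neg a) = ¬ᶠ flattenAtom a

  -- An equation v_{f(t₁,…,tₙ)} = f(v_{t₁},…,v_{tₙ}) is represented by the
  -- subterm f(t₁,…,tₙ) it belongs to.
  Eqn : Set
  Eqn = Var

  FlatEQᵗ : Var → List Eqn
  FlatEQᵗ (_ , t) = subterms t

  FlatEQ : Literal [] → List Eqn
  FlatEQ ℓ = atomSubterms (atom ℓ)

  eqnForm : Eqn → Form []
  eqnForm (_ , app f ts) = eq (v (app f ts)) (app f (vs ts))

  rhsVars : Eqn → List Var
  rhsVars (_ , app f ts) = freeTm {[]} (app f (vs ts))

  replace : ∀ {Γ s₀} → Ground s₀ → FTm Γ s₀ → (∀ {s} → FVar [] s → FTm Γ s)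
  replace t r (bnd ())
  replace {s₀ = s₀} t r {s} (free u) with s₀ ≟srt s
  ... | no  _    = var (free u)
  ... | yes refl = if does (t ≟tm u) then r else var (free u)

  infix 8 _[v_↦_]
  _[v_↦_] : ∀ {Γ s} → Form [] → Ground s → FTm Γ s → Form Γ
  A [v t ↦ r ] = subst (replace t r) A

  Val : (USort → Set) → Srt → Set
  Val Dom bool    = Bool
  Val Dom rat     = ℚ
  Val Dom (usr a) = Dom a

  record Structure : Set₁ where
    field
      Dom   : USort → Set
      point : ∀ a → Dom a
      ⟦un⟧  : ∀ {as s} → UFun as s → All (Val Dom) as → Val Dom s
      ⟦th⟧  : ∀ {as s} → TFun as s → All (Val Dom) as → Val Dom s
      ⟦pa⟧  : PAtom → Bool

  module Semantics (M : Structure) where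
    open Structure M

    ⟦_⟧ : Srt → Set
    ⟦_⟧ = Val Dom

    ⟦bi⟧ : ∀ {as s} → Builtin as s → All ⟦_⟧ as → ⟦ s ⟧
    ⟦bi⟧ (truth b) []           = b
    ⟦bi⟧ (const c) []           = c
    ⟦bi⟧ add       (x ∷ y ∷ []) = x + y
    ⟦bi⟧ (scale c) (x ∷ [])     = c * x

    ⟦op⟧ : ∀ {as s} → Op as s → All ⟦_⟧ as → ⟦ s ⟧
    ⟦op⟧ (un f) = ⟦un⟧ f
    ⟦op⟧ (th f) = ⟦th⟧ f
    ⟦op⟧ (bi f) = ⟦bi⟧ f

    module _ {V : Srt → Set} (η : ∀ {s} → V s → ⟦ s ⟧) where
      eval  : ∀ {s} → Tm V s → ⟦ s ⟧
      evals : ∀ {as} → All (Tm V) as → All ⟦_⟧ as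
      eval (var x)    = η x
      eval (app f ts) = ⟦op⟧ f (evals ts)
      evals []       = []
      evals (t ∷ ts) = eval t ∷ evals ts

      evalLin : Lin V → ℚ
      evalLin = foldr (λ (c , t) r → c * eval t + r) 0ℚ

    Valuation : Set
    Valuation = ∀ {s} → Ground s → ⟦ s ⟧

    env : Valuation → ∀ {Γ} → All ⟦_⟧ Γ → ∀ {s} → FVar Γ s → ⟦ s ⟧
    env ρ γ (bnd i)  = lookup γ i
    env ρ γ (free t) = ρ t

    -- The clauses for =, ∨ and ∃ are the double-negation readings, so that the
    -- truth of formulas obeys classical logic.
    Sat : Valuation → ∀ {Γ} → All ⟦_⟧ Γ → Form Γ → Set
    Sat ρ γ ⊤ᶠ       = ⊤
    Sat ρ γ ⊥ᶠ       = ⊥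
    Sat ρ γ (prop b) = T (⟦pa⟧ b)
    Sat ρ γ (eq t u) = ¬ ¬ (eval (env ρ γ) t ≡ eval (env ρ γ) u)
    Sat ρ γ (le l c) = evalLin (env ρ γ) l ≤ c
    Sat ρ γ (¬ᶠ A)   = ¬ Sat ρ γ A
    Sat ρ γ (A ∧ᶠ B) = Sat ρ γ A × Sat ρ γ B
    Sat ρ γ (A ∨ᶠ B) = ¬ (¬ Sat ρ γ A × ¬ Sat ρ γ B)
    Sat ρ γ (∀ᶠ s A) = ∀ x → Sat ρ (x ∷ γ) A
    Sat ρ γ (∃ᶠ s A) = ¬ (∀ x → ¬ Sat ρ (x ∷ γ) A)

  -- A theory is given by its class of models.
  Theory : Set₁
  Theory = Structure → Set

  Implies : Theory → Form [] → Form [] → Set₁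
  Implies 𝒯 A B = (M : Structure) → 𝒯 M → let open Semantics M in
    (ρ : Valuation) → Sat ρ [] A → Sat ρ [] B

  Equivalent : Theory → Form [] → Form [] → Set₁
  Equivalent 𝒯 A B = Implies 𝒯 A B × Implies 𝒯 B A

data Tree : Set where
  leaf : Tree
  node : Tree → Tree → Tree

data Leaf : Tree → Set where
  here : Leaf leaf
  inl  : ∀ {l r} → Leaf l → Leaf (node l r)
  inr  : ∀ {l r} → Leaf r → Leaf (node l r)

data Node : Tree → Set where
  root : ∀ {t} → Node t
  inl  : ∀ {l r} → Node l → Node (node l r)
  inr  : ∀ {l r} → Node r → Node (node l r)

leafNode : ∀ {t} → Leaf t → Node t
leafNode here    = root
leafNode (inl p) = inl (leafNode p)
leafNode (inr p) = inr (leafNode p)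

-- Children x y z : the children of x are y and z.
data Children : ∀ {t} → Node t → Node t → Node t → Set where
  root : ∀ {l r} → Children {node l r} root (inl root) (inr root)
  inl  : ∀ {l r} {x y z : Node l} → Children x y z →
         Children {node l r} (inl x) (inl y) (inl z)
  inr  : ∀ {l r} {x y z : Node r} → Children x y z →
         Children {node l r} (inr x) (inr y) (inr z)

leaves : ∀ t → List (Leaf t)
leaves leaf       = here ∷ []
leaves (node l r) = map inl (leaves l) ++ map inr (leaves r)

_≟leaf_ : ∀ {t} → DecidableEquality (Leaf t)
here  ≟leaf here  = yes refl
inl p ≟leaf inl q with p ≟leaf q
... | yes refl = yes refl
... | no  p≢q  = no λ { refl → p≢q refl }
inl _ ≟leaf inr _ = no λ ()
inr _ ≟leaf inl _ = no λ ()
inr p ≟leaf inr q with p ≟leaf q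
... | yes refl = yes refl
... | no  p≢q  = no λ { refl → p≢q refl }

PartSet : Tree → Set
PartSet t = Leaf t → Bool

∁ : ∀ {t} → PartSet t → PartSet t
∁ A = not ∘ A

st : ∀ {t} → Node t → PartSet t
st root    _       = true
st (inl x) (inl p) = st x p
st (inl x) (inr p) = false
st (inr x) (inl p) = false
st (inr x) (inr p) = st x p

module Interpolation (Sg : Signature) (𝒯 : Logic.Theory Sg) where
  open Signature Sg using (UFun)
  open Logic Sg

  partForm : List Clause → Form []
  partForm Cs = ⋀ (map groundClause Cs)

  record Problem : Set₁ where
    field
      tree  : Tree
      F     : Leaf tree → List Clause
      once  : ∀ {p q C} → C ∈ F p → C ∈ F q → p ≡ q
      unsat : Implies 𝒯 (⋀ (map (partForm ∘ F) (leaves tree))) ⊥ᶠ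

  module WithProblem (Q : Problem) where
    open Problem Q

    P : Set
    P = Leaf tree

    symbF : P → List Sym
    symbF p = symb (partForm (F p))

    -- Interpreted functions belong to every partition.
    _∈partitions_ : P → ∀ {as s} → Op as s → Set
    p ∈partitions un f = fun f ∈ symbF p
    p ∈partitions th _ = ⊤
    p ∈partitions bi _ = ⊤

    _∈partitions?_ : ∀ p {as s} (f : Op as s) → Dec (p ∈partitions f)
    p ∈partitions? un f = fun f ∈? symbF p
      where open import Data.List.Membership.DecPropositional _≟sym_ using (_∈?_)
    p ∈partitions? th _ = yes tt
    p ∈partitions? bi _ = yes tt

    Belongs : P → Eqn → Set
    Belongs p (_ , app f _) = p ∈partitions f

    belongs? : ∀ p e → Dec (Belongs p e)
    belongs? p (_ , app f _) = p ∈partitions? f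

    created : P → List Proxy
    created p = concatMap clauseProxies (F p)

    -- Labellings for a problem with the formula G p at each leaf p. The symbol
    -- condition refers to F, and Ok are the variables allowed in the labels.
    record TreeInterpolant (G : P → Form []) (Ok : Var → Set)
                           (I : Node tree → Form []) : Set₁ where
      field
        atRoot  : Equivalent 𝒯 (I root) ⊥ᶠ
        atLeaf  : ∀ p → Implies 𝒯 (G p) (I (leafNode p))
        atInner : ∀ {x y z} → Children x y z → Implies 𝒯 (I y ∧ᶠ I z) (I x)
        symbols : ∀ x {f} → f ∈ symb (I x) →
                  (∃[ p ] T (st x p) × f ∈ symbF p) ×
                  (∃[ p ] T (∁ (st x) p) × f ∈ symbF p)
        vars    : ∀ x {u} → u ∈ FreeVars (I x) → Ok u

    -- The input has no free variables, and neither have its interpolants.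
    IsTreeInterpolant : (Node tree → Form []) → Set₁
    IsTreeInterpolant = TreeInterpolant (partForm ∘ F) (λ _ → ⊥)

    chain : ∀ {s} → Ground s → Ground s → List (Ground s) → Clause
    chain t₁ t []       = pos (eq t₁ t) ∷ []
    chain t₁ t (u ∷ us) = neg (eq t u) ∷ chain t₁ u us

    -- the terms are t₁, t₂ and those in the list
    transClause : ∀ {s} → Ground s → Ground s → List (Ground s) → Clause
    transClause t₁ t₂ ts = chain t₁ t₁ (t₂ ∷ ts)

    argDiseqs : ∀ {as} → All Ground as → All Ground as → Clause
    argDiseqs []       []       = []
    argDiseqs (t ∷ ts) (u ∷ us) = neg (eq t u) ∷ argDiseqs ts us

    congClause : ∀ {as s} → UFun as s → All Ground as → All Ground as → Clause
    congClause f ts us = pos (eq (app (un f) ts) (app (un f) us)) ∷ argDiseqs ts us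

    triClause : Ground rat → Ground rat → Clause
    triClause t u = pos (eq t u) ∷ neg (t ≤ᵃ u) ∷ neg (u ≤ᵃ t) ∷ []

    record Weighted : Set where
      constructor weighted
      field
        k   : ℚ
        lhs : Lin (_∈ [])
        rhs : ℚ

    ineq : Weighted → Atom []
    ineq w = le (Weighted.lhs w) (Weighted.rhs w)

    farkasClause : List Weighted → Clause
    farkasClause = map (λ w → neg (ineq w))

    combine : List Weighted → Lin (_∈ [])
    combine = concatMap (λ (weighted k l b) → map (λ (c , t) → k * c , t) l)

    bound : List Weighted → ℚ
    bound = foldr (λ (weighted k l b) r → k * b + r) 0ℚ

    coeff : Ground rat → Lin (_∈ []) → ℚ
    coeff x = foldr (λ (c , t) r → if does (x ≟tm t) then c + r else r) 0ℚ

    removeZero : Lin (_∈ []) → Lin (_∈ [])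
    removeZero l = filter (λ (_ , t) → ¬? (coeff t l ℚ.≟ 0ℚ)) l

    record Farkas (ws : List Weighted) : Set where
      field
        positive : All (λ w → 0ℚ < Weighted.k w) ws
        cancels  : ∀ x → coeff x (combine ws) ≡ 0ℚ
        negative : bound ws < 0ℚ

    data Proof : Clause → Set₁ where
      input  : ∀ p {C} → C ∈ F p → Proof C
      instan : ∀ Δ (φ : List (Literal Δ)) (σ : All Ground Δ) →
               Proof (neg (proxy (all∀ Δ φ)) ∷ map (inst σ) φ)
      trans  : ∀ {s} (t₁ t₂ : Ground s) ts → Proof (transClause t₁ t₂ ts)
      cong   : ∀ {as s} (f : UFun as s) ts us → Proof (congClause f ts us)
      tri    : ∀ t u → Proof (triClause t u)
      farkas : ∀ ws → Farkas ws → Proof (farkasClause ws)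
      other  : ∀ C → Implies 𝒯 ⊤ᶠ (groundClause C) → Proof C
      res    : ∀ ℓ C₁ C₂ {D₁ D₂ D} →
               D₁ ≈ (ℓ ∷ C₁) → D₂ ≈ (flip ℓ ∷ C₂) → D ≈ (C₁ ++ C₂) →
               Proof D₁ → Proof D₂ → Proof D

    clauses : ∀ {C} → Proof C → List Clause
    clauses {C} (res _ _ _ _ _ _ π₁ π₂) = C ∷ clauses π₁ ++ clauses π₂
    clauses {C} _                       = C ∷ []

    others : ∀ {C} → Proof C → List Clause
    others (other C _)               = C ∷ []
    others (res _ _ _ _ _ _ π₁ π₂) = others π₁ ++ others π₂
    others _                         = []

    -- The proof only uses symbols and proxies that stem from the input.
    record OverInput {C} (π : Proof C) : Set where
      field
        symbolsOccur   : ∀ {D} → D ∈ clauses π → ∀ {f} → f ∈ symb (groundClause D) →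
                         ∃[ p ] f ∈ symbF p
        proxiesCreated : ∀ {D} → D ∈ clauses π → ∀ {q} → q ∈ clauseProxies D →
                         ∃[ p ] q ∈ created p

    record Colouring : Set where
      field
        colour     : Atom [] → P
        sameColour : ∀ {a b} → a ≋ᵃ b → colour a ≡ colour b
        ofProxy    : ∀ {p q} → q ∈ created p → colour (proxy q) ≡ p

    module Algorithm (κ : Colouring) where
      open Colouring κ

      _↓⁻ᵖ_ : Literal [] → P → Form []
      ℓ ↓⁻ᵖ p = if does (p ≟leaf colour (atom ℓ)) then flatten ℓ else ⊤ᶠ

      _↓⁻_ : List (Literal []) → PartSet tree → Form []
      L ↓⁻ A = ⋀ (map (λ ℓ → ⋀ (map (ℓ ↓⁻ᵖ_) (filterᵇ A (leaves tree)))) L)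

      _↓ᵉ_ : List Eqn → P → Form []
      E ↓ᵉ p = ⋀ (map eqnForm (filter (belongs? p) E))

      _↓_ : List (Literal []) → P → Form []
      L ↓ p = ⋀ (map (λ ℓ → (ℓ ↓⁻ᵖ p) ∧ᶠ (FlatEQ ℓ ↓ᵉ p)) L)

      IsPartialInterpolant : Clause → (Node tree → Form []) → Set₁
      IsPartialInterpolant C =
        TreeInterpolant (λ p → partForm (F p) ∧ᶠ (negate C ↓ p)) (Supported C)

      -- Labels of input clauses, instantiation and congruence lemmas, where
      -- C follows from the part p alone
      local : Clause → P → PartSet tree → Form []
      local C p A = if A p then ¬ᶠ (negate C ↓⁻ ∁ A) else negate C ↓⁻ A

      inside : PartSet tree → Atom [] → Bool
      inside A a = A (colour a)

      -- The terms at the boundary indices. c is the side of the closing literal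
      -- t₁ = tₙ, and prev the side of the literal preceding the current term in
      -- the cycle t₁ = … = tₙ = t₁.
      boundary : ∀ {s} → PartSet tree → (c prev : Bool) →
                 Ground s → List (Ground s) → List (Ground s)
      boundary A c prev t []       = if prev xor c then t ∷ [] else []
      boundary A c prev t (u ∷ us) =
        let e = inside A (eq t u) in
        (if prev xor e then t ∷_ else id) (boundary A c e u us)

      lastOf : ∀ {X : Set} → X → List X → X
      lastOf x []       = x
      lastOf x (y ∷ ys) = lastOf y ys

      pairs : ∀ {s} → List (Ground s) → List (Form [])
      pairs (x ∷ y ∷ zs) = eq (v x) (v y) ∷ pairs zs
      pairs _            = []

      cycleLabel : ∀ {s} → (c : Bool) → List (Ground s) → Form []
      cycleLabel true  []       = ⊥ᶠ
      cycleLabel false []       = ⊤ᶠ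
      cycleLabel false (x ∷ xs) = ⋀ (pairs (x ∷ xs))
      cycleLabel true  (x ∷ xs) = ⋀ (pairs xs) ∧ᶠ ¬ᶠ eq (v (lastOf x xs)) (v x)

      transLabel : ∀ {s} → Ground s → Ground s → List (Ground s) →
                   PartSet tree → Form []
      transLabel t₁ t₂ ts A =
        let c = inside A (eq t₁ (lastOf t₂ ts)) in
        cycleLabel c (boundary A c c t₁ (t₂ ∷ ts))

      farkasLabel : List Weighted → PartSet tree → Form []
      farkasLabel ws A =
        let part = filterᵇ (inside A ∘ ineq) ws in
        if all (inside A ∘ ineq) ws then ⊥ᶠ
        else le (mapLin v (removeZero (combine part))) (bound part)

      data Step (A : PartSet tree) (I : Form []) : Var → Form [] → Set where
        exists : ∀ {as s} {f : Op as s} {ts} →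
                 (∀ p → p ∈partitions f → T (A p)) →
                 Step A I (s , app f ts) (∃ᶠ s (I [v app f ts ↦ var (bnd (here refl)) ]))
        forAll : ∀ {as s} {f : Op as s} {ts} →
                 (∀ p → p ∈partitions f → ¬ T (A p)) →
                 Step A I (s , app f ts) (∀ᶠ s (I [v app f ts ↦ var (bnd (here refl)) ]))
        unfold : ∀ {as s} {f : Op as s} {ts} →
                 ¬ (∀ p → p ∈partitions f → T (A p)) →
                 ¬ (∀ p → p ∈partitions f → ¬ T (A p)) →
                 Step A I (s , app f ts) (I [v app f ts ↦ app f (vs ts) ])

      Outermost : Form [] → Var → Set
      Outermost I u = ∀ {w} → w ∈ FreeVars I → ∀ {e} → e ∈ FlatEQᵗ w → u ∉ rhsVars e

      -- Elim A Un us I J : J results from I by eliminating the variables in Un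
      -- in the order us.
      data Elim (A : PartSet tree) (Un : Var → Set) :
                List Var → Form [] → Form [] → Set where
        done : ∀ {I} → (∀ {u} → u ∈ FreeVars I → ¬ Un u) → Elim A Un [] I I
        skip : ∀ {u us I J} → u ∉ FreeVars I → Elim A Un us I J → Elim A Un (u ∷ us) I J
        step : ∀ {u us I I′ J} → u ∈ FreeVars I → Un u → Outermost I u →
               Step A I u I′ → Elim A Un us I′ J → Elim A Un (u ∷ us) I J

      Unsupported : (D₁ D₂ D : Clause) → Var → Set
      Unsupported D₁ D₂ D u = (Supported D₁ u ⊎ Supported D₂ u) × ¬ Supported D u

      -- The elimination order us is chosen once for all nodes of the tree: with
      -- orders that differ between nodes the result need not be an interpolant.
      -- For instance, let F 1 be ∀x. x = a and F 2 be ∀x. x ≠ b, and let the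
      -- labels of the resolvent be v_b = v_a at 1 and v_b ≠ v_a at 2 before
      -- elimination. Eliminating v_a first at 1 and v_b first at 2 gives
      -- ∀y.∃x. y = x and ∀x.∃y. y ≠ x, which are consistent.
      data Labels : ∀ {C} → Proof C → (Node tree → Form []) → Set₁ where
        input  : ∀ {p C} {m : C ∈ F p} {I} →
                 (∀ x → I x ≡ local C p (st x)) → Labels (input p m) I
        instan : ∀ {Δ φ σ I} → let q = proxy (all∀ Δ φ) in
                 (∀ x → I x ≡ local (neg q ∷ map (inst σ) φ) (colour q) (st x)) →
                 Labels (instan Δ φ σ) I
        trans  : ∀ {s} {t₁ t₂ : Ground s} {ts I} →
                 (∀ x → I x ≡ transLabel t₁ t₂ ts (st x)) → Labels (trans t₁ t₂ ts) I
        cong   : ∀ {as s} {f : UFun as s} {ts us I} pf → pf ∈partitions un f →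
                 (∀ x → I x ≡ local (congClause f ts us) pf (st x)) →
                 Labels (cong f ts us) I
        tri    : ∀ {t u I} → let L = negate (triClause t u) in
                 (∀ x → I x ≡ L ↓⁻ st x ⊎ I x ≡ ¬ᶠ (L ↓⁻ ∁ (st x))) → Labels (tri t u) I
        farkas : ∀ {ws fk I} → (∀ x → I x ≡ farkasLabel ws (st x)) →
                 Labels (farkas ws fk) I
        other  : ∀ {C valid I} → IsPartialInterpolant C I → Labels (other C valid) I
        res    : ∀ {ℓ C₁ C₂ D₁ D₂ D e₁ e₂ e π₁ π₂ I₁ I₂ I} us →
                 Labels π₁ I₁ → Labels π₂ I₂ →
                 (∀ x → Elim (st x) (Unsupported D₁ D₂ D) us
                          (if inside (st x) (atom ℓ) then I₁ x ∨ᶠ I₂ x else I₁ x ∧ᶠ I₂ x)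
                          (I x)) →
                 Labels (res ℓ C₁ C₂ {D₁} {D₂} {D} e₁ e₂ e π₁ π₂) I

{-# OPTIONS --safe #-}

-- Every clause of the proof is labelled by a partial interpolant in which, at a
-- leaf p, the flattening equations of all terms whose head symbol occurs in p may
-- be assumed. Lemmas and the combination of two labels at a resolution step keep
-- this property by propositional reasoning. When v_t with t = f(t₁, …, tₙ) is
-- eliminated, its equation justifies ∃ and the unfolding if f occurs in p; if it
-- does not, v_t may be changed freely, because no variable of the label has t as a
-- proper subterm and so the superterms of t can be re-evaluated, which justifies ∀.
-- Since every node eliminates the same variables in the same order, the
-- implication from two children to their parent is also preserved one variable at
-- a time. At the empty clause v_t can be given the value of t itself.
module Submission where

open import Defs
open import Data.Bool using (Bool; true; false; T; not; if_then_else_; _xor_)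
open import Data.Bool.ListAction using (all)
open import Data.Bool.Properties using (T-≡; T?)
open import Data.Empty using (⊥; ⊥-elim)
open import Data.List using (List; []; _∷_; _++_; map; concatMap; filter; filterᵇ; length)
open import Data.List.Extrema.Nat using (max; xs≤max)
import Data.List.Membership.DecPropositional as DecMembership
open import Data.List.Membership.Propositional using (_∈_; _∉_; lose; find)
open import Data.List.Membership.Propositional.Properties
  using (∈-++⁺ˡ; ∈-++⁺ʳ; ∈-++⁻; ∈-map⁺; ∈-map⁻; ∈-filter⁺; ∈-filter⁻; ∈-concatMap⁺; ∈-concatMap⁻)
open import Data.List.Properties using (length-filter; ++-identityʳ)
open import Data.List.Relation.Binary.Permutation.Propositional
  using (_↭_; refl; prep; swap; trans)
open import Data.List.Relation.Unary.All using (All; []; _∷_; lookup)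
import Data.List.Relation.Unary.All.Properties as All
open import Data.List.Relation.Unary.Any using (here; there)
open import Data.Nat as ℕ using (ℕ; zero; suc)
import Data.Nat.Properties as ℕ
open import Data.Product using (Σ; ∃; ∃-syntax; _×_; _,_; proj₁; proj₂)
open import Data.Product.Function.NonDependent.Propositional using (_×-⇔_)
open import Data.Rational using (ℚ; 0ℚ; 1ℚ; _+_; _*_; -_; _≤_; _<_; nonNegative; positive)
import Data.Rational.Properties as ℚ
open import Data.Rational.Solver using (module +-*-Solver)
open import Data.Sum using (_⊎_; inj₁; inj₂; [_,_]′)
open import Data.Unit using (⊤; tt)
open import Function using (_∘_; id; _⇔_; mk⇔; module Equivalence)
open import Function.Properties.Equivalence using ()
  renaming (refl to ⇔-refl; sym to ⇔-sym; trans to ⇔-trans)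
open import Function.Related.TypeIsomorphisms using (¬-cong-⇔)
open import Relation.Binary using (DecidableEquality; tri<; tri≈; tri>)
import Relation.Binary.PropositionalEquality as ≡
open ≡ using (_≡_; _≢_; refl)
open import Relation.Nullary using (¬_; Dec; yes; no; does; ¬?)
open import Relation.Nullary.Decidable using (decidable-stable; _×-dec_)
open Equivalence using (to; from)

-- The rule used for `v_t` depends on how the partitions of the head symbol lie relative to the leaf
-- set of a node. A parent and its children may therefore apply different rules, and a node whose
-- label lacks `v_t` applies none. Semantically each rule asks for the old label at a changed value
-- of `v_t`: at some value, at every value, or at the value of `f(v_1,…,v_n)`; a label without `v_t`
-- fits all three descriptions. The step from children to parent thus becomes a case analysis on
-- three kinds of rule. It relies on `f` occurring in at least one partition, which is what the
-- requirement that the symbols of the proof stem from the input provides. Equality in a structure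
-- need not be decidable, so classical arguments go through the stability of `Sat` under double
-- negation. That the algorithm never gets stuck is a separate claim: eliminating by decreasing term
-- size works at all nodes at once, because unfolding introduces only smaller variables.

≡⇒⇔ : {X Y : Set} → X ≡ Y → X ⇔ Y
≡⇒⇔ refl = ⇔-refl

Π-⇔ : {X : Set} {P Q : X → Set} → (∀ x → P x ⇔ Q x) → (∀ x → P x) ⇔ (∀ x → Q x)
Π-⇔ e = mk⇔ (λ f x → to (e x) (f x)) (λ f x → from (e x) (f x))

-- Symbols, free variables, subterms and proxies under substitution.

module Syntax (Sg : Signature) where
  open Signature Sg
  open Logic Sg

  infix 4 _⊆_
  -- The right side is a predicate, so that conditions such as `Shared A` can be carried through
  -- recursions without a list that represents them.
  _⊆_ : {X : Set} → List X → (X → Set) → Set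
  xs ⊆ P = ∀ {x} → x ∈ xs → P x

  ⊆-++ : {X : Set} {P : X → Set} {xs ys : List X} → xs ⊆ P → ys ⊆ P → xs ++ ys ⊆ P
  ⊆-++ {xs = xs} p q x∈ with ∈-++⁻ xs x∈
  ... | inj₁ x∈xs = p x∈xs
  ... | inj₂ x∈ys = q x∈ys

  module _ {V W : Srt → Set} (σ : ∀ {s} → V s → Tm W s) {P : Sym → Set}
           (Pσ : ∀ {s} (x : V s) → symbTm (σ x) ⊆ P) where
    symbTm-bind  : ∀ {s} (t : Tm V s) → symbTm t ⊆ P → symbTm (bind σ t) ⊆ P
    symbTms-bind : ∀ {as} (ts : All (Tm V) as) → symbTms ts ⊆ P → symbTms (binds σ ts) ⊆ P
    symbTm-bind (var x)    p = Pσ x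
    symbTm-bind (app f ts) p = ⊆-++ (p ∘ ∈-++⁺ˡ) (symbTms-bind ts (p ∘ ∈-++⁺ʳ (symbOp f)))
    symbTms-bind []       p = λ ()
    symbTms-bind (t ∷ ts) p =
      ⊆-++ (symbTm-bind t (p ∘ ∈-++⁺ˡ)) (symbTms-bind ts (p ∘ ∈-++⁺ʳ (symbTm t)))

    symbLin-bind : ∀ l → concatMap (λ (_ , t) → symbTm t) l ⊆ P →
                   concatMap (λ (_ , t) → symbTm t) (mapLin (bind σ) l) ⊆ P
    symbLin-bind []            p = λ ()
    symbLin-bind ((c , t) ∷ l) p =
      ⊆-++ (symbTm-bind t (p ∘ ∈-++⁺ˡ)) (symbLin-bind l (p ∘ ∈-++⁺ʳ (symbTm t)))

  module _ {V W : Srt → Set} (σ : ∀ {s} → V s → Tm W s) where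
    symbTm-bind⁺  : ∀ {s f} (t : Tm V s) → f ∈ symbTm t → f ∈ symbTm (bind σ t)
    symbTms-bind⁺ : ∀ {as f} (ts : All (Tm V) as) → f ∈ symbTms ts → f ∈ symbTms (binds σ ts)
    symbTm-bind⁺ (app f ts) = ⊆-++ ∈-++⁺ˡ (∈-++⁺ʳ (symbOp f) ∘ symbTms-bind⁺ ts)
    symbTms-bind⁺ (t ∷ ts) =
      ⊆-++ (∈-++⁺ˡ ∘ symbTm-bind⁺ t) (∈-++⁺ʳ (symbTm (bind σ t)) ∘ symbTms-bind⁺ ts)

    symbLin-bind⁺ : ∀ {f} l → f ∈ concatMap (λ (_ , t) → symbTm t) l →
                    f ∈ concatMap (λ (_ , t) → symbTm t) (mapLin (bind σ) l)
    symbLin-bind⁺ ((c , t) ∷ l) =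
      ⊆-++ (∈-++⁺ˡ ∘ symbTm-bind⁺ t) (∈-++⁺ʳ (symbTm (bind σ t)) ∘ symbLin-bind⁺ l)

  weaken-symb : ∀ {Γ s₀ s} {P : Sym → Set} (x : FVar Γ s) → symbTm (weaken {s₀ = s₀} x) ⊆ P
  weaken-symb (bnd i)  = λ ()
  weaken-symb (free t) = λ ()

  symb-subst : ∀ {Γ Γ′} {P : Sym → Set} (σ : ∀ {s} → FVar Γ s → FTm Γ′ s) →
               (∀ {s} (x : FVar Γ s) → symbTm (σ x) ⊆ P) →
               ∀ A → symb A ⊆ P → symb (subst σ A) ⊆ P
  symb-lift : ∀ {Γ Γ′ s₀} {P : Sym → Set} (σ : ∀ {s} → FVar Γ s → FTm Γ′ s) →
              (∀ {s} (x : FVar Γ s) → symbTm (σ x) ⊆ P) →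
              ∀ {s} (x : FVar (s₀ ∷ Γ) s) → symbTm (lift σ x) ⊆ P
  symb-subst σ Pσ ⊤ᶠ       p = λ ()
  symb-subst σ Pσ ⊥ᶠ       p = λ ()
  symb-subst σ Pσ (prop b) p = p
  symb-subst σ Pσ (eq t u) p =
    ⊆-++ (symbTm-bind σ Pσ t (p ∘ ∈-++⁺ˡ)) (symbTm-bind σ Pσ u (p ∘ ∈-++⁺ʳ (symbTm t)))
  symb-subst σ Pσ (le l c) p = symbLin-bind σ Pσ l p
  symb-subst σ Pσ (¬ᶠ A)   p = symb-subst σ Pσ A p
  symb-subst σ Pσ (A ∧ᶠ B) p =
    ⊆-++ (symb-subst σ Pσ A (p ∘ ∈-++⁺ˡ)) (symb-subst σ Pσ B (p ∘ ∈-++⁺ʳ (symb A)))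
  symb-subst σ Pσ (A ∨ᶠ B) p =
    ⊆-++ (symb-subst σ Pσ A (p ∘ ∈-++⁺ˡ)) (symb-subst σ Pσ B (p ∘ ∈-++⁺ʳ (symb A)))
  symb-subst σ Pσ (∀ᶠ s A) p = symb-subst (lift σ) (symb-lift σ Pσ) A p
  symb-subst σ Pσ (∃ᶠ s A) p = symb-subst (lift σ) (symb-lift σ Pσ) A p
  symb-lift σ Pσ (bnd (here e))  = λ ()
  symb-lift σ Pσ (bnd (there i)) = symbTm-bind weaken weaken-symb (σ (bnd i)) (Pσ (bnd i))
  symb-lift σ Pσ (free t)        = symbTm-bind weaken weaken-symb (σ (free t)) (Pσ (free t))

  module _ {Γ Γ′ : Ctx} (σ : ∀ {s} → FVar Γ s → FTm Γ′ s) {P : Var → Set}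
           (Pσ : ∀ {s} (i : s ∈ Γ) → freeTm (σ (bnd i)) ⊆ P) where
    freeTm-bind  : ∀ {s} (t : FTm Γ s) →
                   freeTm t ⊆ (λ (_ , x) → freeTm (σ (free x)) ⊆ P) → freeTm (bind σ t) ⊆ P
    freeTms-bind : ∀ {as} (ts : All (FTm Γ) as) →
                   freeTms ts ⊆ (λ (_ , x) → freeTm (σ (free x)) ⊆ P) → freeTms (binds σ ts) ⊆ P
    freeTm-bind (var (bnd i))  p = Pσ i
    freeTm-bind (var (free x)) p = p (here refl)
    freeTm-bind (app f ts)     p = freeTms-bind ts p
    freeTms-bind []       p = λ ()
    freeTms-bind (t ∷ ts) p =
      ⊆-++ (freeTm-bind t (p ∘ ∈-++⁺ˡ)) (freeTms-bind ts (p ∘ ∈-++⁺ʳ (freeTm t)))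

    freeLin-bind : ∀ l →
                   concatMap (λ (_ , t) → freeTm t) l ⊆ (λ (_ , x) → freeTm (σ (free x)) ⊆ P) →
                   concatMap (λ (_ , t) → freeTm t) (mapLin (bind σ) l) ⊆ P
    freeLin-bind []            p = λ ()
    freeLin-bind ((c , t) ∷ l) p =
      ⊆-++ (freeTm-bind t (p ∘ ∈-++⁺ˡ)) (freeLin-bind l (p ∘ ∈-++⁺ʳ (freeTm t)))

  freeTm-weaken : ∀ {Γ s₀ s} {P : Var → Set} (t : FTm Γ s) →
                  freeTm t ⊆ P → freeTm (bind (weaken {s₀ = s₀}) t) ⊆ P
  freeTm-weaken t p = freeTm-bind weaken (λ i ()) t λ { x∈ (here refl) → p x∈ }

  FreeVars-subst : ∀ {Γ Γ′} {P : Var → Set} (σ : ∀ {s} → FVar Γ s → FTm Γ′ s) →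
                   (∀ {s} (i : s ∈ Γ) → freeTm (σ (bnd i)) ⊆ P) →
                   ∀ A → FreeVars A ⊆ (λ (_ , x) → freeTm (σ (free x)) ⊆ P) →
                   FreeVars (subst σ A) ⊆ P
  FreeVars-lift  : ∀ {Γ Γ′ s₀} {P : Var → Set} (σ : ∀ {s} → FVar Γ s → FTm Γ′ s) →
                   (∀ {s} (i : s ∈ Γ) → freeTm (σ (bnd i)) ⊆ P) →
                   ∀ (A : Form (s₀ ∷ Γ)) → FreeVars A ⊆ (λ (_ , x) → freeTm (σ (free x)) ⊆ P) →
                   FreeVars (subst (lift σ) A) ⊆ P
  FreeVars-subst σ Pσ ⊤ᶠ       p = λ ()
  FreeVars-subst σ Pσ ⊥ᶠ       p = λ ()
  FreeVars-subst σ Pσ (prop b) p = λ ()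
  FreeVars-subst σ Pσ (eq t u) p =
    ⊆-++ (freeTm-bind σ Pσ t (p ∘ ∈-++⁺ˡ)) (freeTm-bind σ Pσ u (p ∘ ∈-++⁺ʳ (freeTm t)))
  FreeVars-subst σ Pσ (le l c) p = freeLin-bind σ Pσ l p
  FreeVars-subst σ Pσ (¬ᶠ A)   p = FreeVars-subst σ Pσ A p
  FreeVars-subst σ Pσ (A ∧ᶠ B) p =
    ⊆-++ (FreeVars-subst σ Pσ A (p ∘ ∈-++⁺ˡ)) (FreeVars-subst σ Pσ B (p ∘ ∈-++⁺ʳ (FreeVars A)))
  FreeVars-subst σ Pσ (A ∨ᶠ B) p =
    ⊆-++ (FreeVars-subst σ Pσ A (p ∘ ∈-++⁺ˡ)) (FreeVars-subst σ Pσ B (p ∘ ∈-++⁺ʳ (FreeVars A)))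
  FreeVars-subst σ Pσ (∀ᶠ s A) p = FreeVars-lift σ Pσ A p
  FreeVars-subst σ Pσ (∃ᶠ s A) p = FreeVars-lift σ Pσ A p
  FreeVars-lift σ Pσ A p =
    FreeVars-subst (lift σ)
      (λ { (here e) → λ () ; (there i) → freeTm-weaken (σ (bnd i)) (Pσ i) })
      A λ {(_ , x)} x∈ → freeTm-weaken (σ (free x)) (p x∈)

  bind-closed  : ∀ {s} (σ : ∀ {s} → s ∈ [] → Ground s) (t : Ground s) → bind σ t ≡ t
  binds-closed : ∀ {as} (σ : ∀ {s} → s ∈ [] → Ground s) (ts : All Ground as) → binds σ ts ≡ ts
  bind-closed σ (app f ts) = ≡.cong (app f) (binds-closed σ ts)
  binds-closed σ []       = refl
  binds-closed σ (t ∷ ts) = ≡.cong₂ _∷_ (bind-closed σ t) (binds-closed σ ts)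

  -- Lets an input clause count as its own instance under the empty substitution, so that input
  -- clauses and instantiation lemmas share the argument of `clause-inst`.
  inst-closed : ∀ ℓ → inst [] ℓ ≡ ℓ
  inst-closed = lit
    where
    σ : ∀ {s} → s ∈ [] → Ground s
    σ = lookup {P = Ground} []
    lin : ∀ l → mapLin (bind σ) l ≡ l
    lin []            = refl
    lin ((c , t) ∷ l) = ≡.cong₂ _∷_ (≡.cong (c ,_) (bind-closed σ t)) (lin l)
    atm : ∀ a → instAtom [] a ≡ a
    atm (eq t u)  = ≡.cong₂ eq (bind-closed σ t) (bind-closed σ u)
    atm (le l c)  = ≡.cong (λ l′ → le l′ c) (lin l)
    atm (proxy q) = refl
    lit : ∀ ℓ → inst [] ℓ ≡ ℓ
    lit (pos a) = ≡.cong pos (atm a)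
    lit (neg a) = ≡.cong neg (atm a)

  subterms-self : ∀ {s} (t : Ground s) → (s , t) ∈ subterms t
  subterms-self (app f ts) = here refl

  subterms-trans  : ∀ {s r w} (t : Ground s) {u : Ground r} →
                    (r , u) ∈ subterms t → w ∈ subterms u → w ∈ subterms t
  subtermss-trans : ∀ {as r w} (ts : All Ground as) {u : Ground r} →
                    (r , u) ∈ subtermss ts → w ∈ subterms u → w ∈ subtermss ts
  subterms-trans (app f ts) (here refl) w∈ = w∈
  subterms-trans (app f ts) (there u∈)  w∈ = there (subtermss-trans ts u∈ w∈)
  subtermss-trans (t ∷ ts) u∈ w∈ with ∈-++⁻ (subterms t) u∈
  ... | inj₁ u∈t  = ∈-++⁺ˡ (subterms-trans t u∈t w∈)
  ... | inj₂ u∈ts = ∈-++⁺ʳ (subterms t) (subtermss-trans ts u∈ts w∈)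

  args⊆subtermss : ∀ {as} (ts : All Ground as) → freeTms {[]} (vs ts) ⊆ (_∈ subtermss ts)
  args⊆subtermss (t ∷ ts) (here refl) = ∈-++⁺ˡ (subterms-self t)
  args⊆subtermss (t ∷ ts) (there x∈)  = ∈-++⁺ʳ (subterms t) (args⊆subtermss ts x∈)

  -- A proper subterm is an argument of some subterm. This translates `Outermost`, which speaks of
  -- right-hand sides of flattening equations, into the absence of proper superterms.
  subtermss⇒rhs  : ∀ {as u} (ts : All Ground as) → u ∈ subtermss ts →
                   u ∈ freeTms {[]} (vs ts) ⊎ ∃[ e ] e ∈ subtermss ts × u ∈ rhsVars e
  subterms⇒rhs   : ∀ {s u} (t : Ground s) → u ∈ subterms t →
                   u ≡ (s , t) ⊎ ∃[ e ] e ∈ subterms t × u ∈ rhsVars e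
  subtermss⇒rhs (t ∷ ts) u∈ with ∈-++⁻ (subterms t) u∈
  ... | inj₁ u∈t with subterms⇒rhs t u∈t
  ...   | inj₁ refl           = inj₁ (here refl)
  ...   | inj₂ (e , e∈ , u∈e) = inj₂ (e , ∈-++⁺ˡ e∈ , u∈e)
  subtermss⇒rhs (t ∷ ts) u∈ | inj₂ u∈ts with subtermss⇒rhs ts u∈ts
  ...   | inj₁ u∈vs           = inj₁ (there u∈vs)
  ...   | inj₂ (e , e∈ , u∈e) = inj₂ (e , ∈-++⁺ʳ (subterms t) e∈ , u∈e)
  subterms⇒rhs (app f ts) (here refl) = inj₁ refl
  subterms⇒rhs (app f ts) (there u∈) with subtermss⇒rhs ts u∈
  ... | inj₁ u∈vs           = inj₂ (_ , here refl , u∈vs)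
  ... | inj₂ (e , e∈ , u∈e) = inj₂ (e , there e∈ , u∈e)

  symb-∀* : ∀ {Γ} Δ (A : Form (Δ ++ Γ)) → symb (∀* Δ A) ≡ symb A
  symb-∀* []      A = refl
  symb-∀* (s ∷ Δ) A = symb-∀* Δ (∀ᶠ s A)

  FreeVars-∀* : ∀ {Γ} Δ (A : Form (Δ ++ Γ)) → FreeVars (∀* Δ A) ≡ FreeVars A
  FreeVars-∀* []      A = refl
  FreeVars-∀* (s ∷ Δ) A = FreeVars-∀* Δ (∀ᶠ s A)

  private
    closed : ∀ {Δ Γ : Ctx} (h : ∀ {s} → s ∈ Δ → s ∈ Γ) {s} (t : Term Δ s) →
             freeTm (bind (var ∘ bnd {Γ} ∘ h) t) ⊆ λ _ → ⊥
    closeds : ∀ {Δ Γ : Ctx} (h : ∀ {s} → s ∈ Δ → s ∈ Γ) {as} (ts : All (Term Δ) as) →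
             freeTms (binds (var ∘ bnd {Γ} ∘ h) ts) ⊆ λ _ → ⊥
    closed h (app f ts) = closeds h ts
    closeds h (t ∷ ts)  = ⊆-++ (closed h t) (closeds h ts)

  clauseForm-closed : ∀ {Δ Γ : Ctx} (h : ∀ {s} → s ∈ Δ → s ∈ Γ) C →
                      FreeVars (clauseForm (bnd {Γ} ∘ h) C) ⊆ λ _ → ⊥
  litForm-closed    : ∀ {Δ Γ : Ctx} (h : ∀ {s} → s ∈ Δ → s ∈ Γ) ℓ →
                      FreeVars (litForm (bnd {Γ} ∘ h) ℓ) ⊆ λ _ → ⊥
  atomForm-closed   : ∀ {Δ Γ : Ctx} (h : ∀ {s} → s ∈ Δ → s ∈ Γ) a →
                      FreeVars (atomForm (bnd {Γ} ∘ h) a) ⊆ λ _ → ⊥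
  linForm-closed    : ∀ {Δ Γ : Ctx} (h : ∀ {s} → s ∈ Δ → s ∈ Γ) l →
                      concatMap (λ (_ , t) → freeTm t) (mapLin (bind (var ∘ bnd {Γ} ∘ h)) l) ⊆ λ _ → ⊥
  proxyForm-closed  : ∀ {Γ} q → FreeVars (proxyForm {Γ} q) ⊆ λ _ → ⊥
  clauseForm-closed h (ℓ ∷ C)  = ⊆-++ (litForm-closed h ℓ) (clauseForm-closed h C)
  litForm-closed h (pos a)     = atomForm-closed h a
  litForm-closed h (neg a)     = atomForm-closed h a
  atomForm-closed h (eq t u)   = ⊆-++ (closed h t) (closed h u)
  atomForm-closed h (le l c)   = linForm-closed h l
  atomForm-closed h (proxy q)  = proxyForm-closed q
  linForm-closed h ((c , t) ∷ l) = ⊆-++ (closed h t) (linForm-closed h l)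
  proxyForm-closed {Γ} (all∀ Δ φ) x∈ =
    clauseForm-closed ∈-++⁺ˡ φ
      (≡.subst (_ ∈_) (FreeVars-∀* Δ (clauseForm (bnd {Δ ++ Γ} ∘ ∈-++⁺ˡ) φ)) x∈)

  private
    symb-clause : ∀ {Δ Γ Γ′ : Ctx} {P : Sym → Set} (ι : ∀ {s} → s ∈ Δ → FVar Γ s)
                  (ι′ : ∀ {s} → s ∈ Δ → FVar Γ′ s) C →
                  symb (clauseForm ι C) ⊆ P → symb (clauseForm ι′ C) ⊆ P
    symb-lit    : ∀ {Δ Γ Γ′ : Ctx} {P : Sym → Set} (ι : ∀ {s} → s ∈ Δ → FVar Γ s)
                  (ι′ : ∀ {s} → s ∈ Δ → FVar Γ′ s) ℓ →
                  symb (litForm ι ℓ) ⊆ P → symb (litForm ι′ ℓ) ⊆ P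
    symb-atom   : ∀ {Δ Γ Γ′ : Ctx} {P : Sym → Set} (ι : ∀ {s} → s ∈ Δ → FVar Γ s)
                  (ι′ : ∀ {s} → s ∈ Δ → FVar Γ′ s) a →
                  symb (atomForm ι a) ⊆ P → symb (atomForm ι′ a) ⊆ P
    symb-proxy  : ∀ {Γ Γ′ : Ctx} {P : Sym → Set} q →
                  symb (proxyForm {Γ} q) ⊆ P → symb (proxyForm {Γ′} q) ⊆ P
    symb-clause ι ι′ []      p = λ ()
    symb-clause ι ι′ (ℓ ∷ C) p =
      ⊆-++ (symb-lit ι ι′ ℓ (p ∘ ∈-++⁺ˡ)) (symb-clause ι ι′ C (p ∘ ∈-++⁺ʳ (symb (litForm ι ℓ))))
    symb-lit ι ι′ (pos a) p = symb-atom ι ι′ a p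
    symb-lit ι ι′ (neg a) p = symb-atom ι ι′ a p
    symb-atom ι ι′ (eq t u) p =
      ⊆-++ (symbTm-bind (var ∘ ι′) (λ _ ()) t (p ∘ ∈-++⁺ˡ ∘ symbTm-bind⁺ (var ∘ ι) t))
           (symbTm-bind (var ∘ ι′) (λ _ ()) u
             (p ∘ ∈-++⁺ʳ (symbTm (bind (var ∘ ι) t)) ∘ symbTm-bind⁺ (var ∘ ι) u))
    symb-atom ι ι′ (le l c) p =
      symbLin-bind (var ∘ ι′) (λ _ ()) l (p ∘ symbLin-bind⁺ (var ∘ ι) l)
    symb-atom ι ι′ (proxy q) p = symb-proxy q p
    symb-proxy (patom b)  p = p
    symb-proxy {Γ} {Γ′} {P} (all∀ Δ φ) p x∈ =
      symb-clause (bnd ∘ ∈-++⁺ˡ) (bnd ∘ ∈-++⁺ˡ) φ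
        (λ y∈ → p (≡.subst (_ ∈_) (≡.sym (symb-∀* Δ (clauseForm (bnd ∘ ∈-++⁺ˡ) φ))) y∈))
        (≡.subst (_ ∈_) (symb-∀* Δ (clauseForm (bnd ∘ ∈-++⁺ˡ) φ)) x∈)

  symb-all∀ : ∀ {Γ} {P : Sym → Set} Δ φ → symb (proxyForm {Γ} (all∀ Δ φ)) ⊆ P →
              symb (clauseForm (bnd {Δ ++ Γ} ∘ ∈-++⁺ˡ) φ) ⊆ P
  symb-all∀ Δ φ p {x} x∈ = p (≡.subst (x ∈_) (≡.sym (symb-∀* Δ (clauseForm (bnd ∘ ∈-++⁺ˡ) φ))) x∈)

  -- The formula of a clause contains the formulas of its quantified proxies, nested ones included.
  -- Hence the symbols of a quantified proxy occur in the partition that created it, where its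
  -- instances can be evaluated.
  clauseProxies-symb : ∀ {Δ Γ : Ctx} {P : Sym → Set} (ι : ∀ {s} → s ∈ Δ → FVar Γ s) C →
                       symb (clauseForm ι C) ⊆ P →
                       clauseProxies C ⊆ λ q → symb (proxyForm {[]} q) ⊆ P
  litProxies-symb    : ∀ {Δ Γ : Ctx} {P : Sym → Set} (ι : ∀ {s} → s ∈ Δ → FVar Γ s) ℓ →
                       symb (litForm ι ℓ) ⊆ P →
                       litProxies ℓ ⊆ λ q → symb (proxyForm {[]} q) ⊆ P
  atomProxies-symb   : ∀ {Δ Γ : Ctx} {P : Sym → Set} (ι : ∀ {s} → s ∈ Δ → FVar Γ s) a →
                       symb (atomForm ι a) ⊆ P →
                       atomProxies a ⊆ λ q → symb (proxyForm {[]} q) ⊆ P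
  proxyProxies-symb  : ∀ {Γ : Ctx} {P : Sym → Set} q →
                       symb (proxyForm {Γ} q) ⊆ P →
                       proxyProxies q ⊆ λ q → symb (proxyForm {[]} q) ⊆ P
  clauseProxies-symb ι []      p = λ ()
  clauseProxies-symb {P = P} ι (ℓ ∷ C) p {q} =
    ⊆-++ {P = λ q → symb (proxyForm {[]} q) ⊆ P} (λ {q} → litProxies-symb ι ℓ (p ∘ ∈-++⁺ˡ) {q})
         (λ {q} → clauseProxies-symb ι C (p ∘ ∈-++⁺ʳ (symb (litForm ι ℓ))) {q}) {q}
  litProxies-symb ι (pos a) = atomProxies-symb ι a
  litProxies-symb ι (neg a) = atomProxies-symb ι a
  atomProxies-symb ι (eq t u)  p ()
  atomProxies-symb ι (le l c)  p ()
  atomProxies-symb ι (proxy q) p (here refl) = symb-proxy q p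
  atomProxies-symb ι (proxy q) p (there q∈)  = proxyProxies-symb q p q∈
  proxyProxies-symb (all∀ Δ φ) p q∈ = clauseProxies-symb (bnd ∘ ∈-++⁺ˡ) φ (symb-all∀ Δ φ p) q∈

  -- Instantiating a quantified clause exposes the proxies nested in it. They come from the same
  -- input clause, so they have the same colour as the quantified clause itself.
  proxy-nested : ∀ {Δ q q′} (C : List (Literal Δ)) → q ∈ clauseProxies C → q′ ∈ proxyProxies q →
                 q′ ∈ clauseProxies C
  lit-nested   : ∀ {Δ q q′} (ℓ : Literal Δ) → q ∈ litProxies ℓ → q′ ∈ proxyProxies q →
                 q′ ∈ litProxies ℓ
  atom-nested  : ∀ {Δ q q′} (a : Atom Δ) → q ∈ atomProxies a → q′ ∈ proxyProxies q →
                 q′ ∈ atomProxies a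
  proxy-nested (ℓ ∷ C) q∈ q′∈ with ∈-++⁻ (litProxies ℓ) q∈
  ... | inj₁ q∈ℓ = ∈-++⁺ˡ (lit-nested ℓ q∈ℓ q′∈)
  ... | inj₂ q∈C = ∈-++⁺ʳ (litProxies ℓ) (proxy-nested C q∈C q′∈)
  lit-nested (pos a) = atom-nested a
  lit-nested (neg a) = atom-nested a
  atom-nested (proxy q) (here refl) q′∈ = there q′∈
  atom-nested (proxy (all∀ Δ φ)) (there q∈) q′∈ = there (proxy-nested φ q∈ q′∈)

  _≟var_ : DecidableEquality Var
  (s , t) ≟var (r , u) with s ≟srt r
  ... | no s≢r   = no λ { refl → s≢r refl }
  ... | yes refl with t ≟tm u
  ...   | no t≢u   = no λ { refl → t≢u refl }
  ...   | yes refl = yes refl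

-- Evaluation and truth: substitution, coincidence, instances and changes of the valuation.

module Models (Sg : Signature) (M : Logic.Structure Sg) where
  open Logic Sg
  open Structure M
  open Semantics M
  open Syntax Sg

  module _ {V W : Srt → Set} (σ : ∀ {s} → V s → Tm W s)
           (η : ∀ {s} → V s → ⟦ s ⟧) (η′ : ∀ {s} → W s → ⟦ s ⟧)
           (e : ∀ {s} (x : V s) → η x ≡ eval η′ (σ x)) where
    eval-bind  : ∀ {s} (t : Tm V s) → eval η t ≡ eval η′ (bind σ t)
    evals-bind : ∀ {as} (ts : All (Tm V) as) → evals η ts ≡ evals η′ (binds σ ts)
    eval-bind (var x)    = e x
    eval-bind (app f ts) = ≡.cong (⟦op⟧ f) (evals-bind ts)
    evals-bind []       = refl
    evals-bind (t ∷ ts) = ≡.cong₂ _∷_ (eval-bind t) (evals-bind ts)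

    evalLin-bind : ∀ l → evalLin η l ≡ evalLin η′ (mapLin (bind σ) l)
    evalLin-bind []            = refl
    evalLin-bind ((c , t) ∷ l) = ≡.cong₂ (λ a b → c * a + b) (eval-bind t) (evalLin-bind l)

  -- Two valuations are needed because a substitution also acts on the free variables; `Sat-replace`
  -- uses an updated valuation on the left.
  Sat-subst : ∀ {Γ Γ′} (σ : ∀ {s} → FVar Γ s → FTm Γ′ s) (ρ ρ′ : Valuation)
              (γ : All ⟦_⟧ Γ) (γ′ : All ⟦_⟧ Γ′) →
              (∀ {s} (x : FVar Γ s) → env ρ γ x ≡ eval (env ρ′ γ′) (σ x)) →
              ∀ A → Sat ρ γ A ⇔ Sat ρ′ γ′ (subst σ A)
  env-lift  : ∀ {Γ Γ′ s₀} (σ : ∀ {s} → FVar Γ s → FTm Γ′ s) (ρ ρ′ : Valuation)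
              (γ : All ⟦_⟧ Γ) (γ′ : All ⟦_⟧ Γ′) →
              (∀ {s} (x : FVar Γ s) → env ρ γ x ≡ eval (env ρ′ γ′) (σ x)) →
              ∀ (a : ⟦ s₀ ⟧) {s} (x : FVar (s₀ ∷ Γ) s) →
              env ρ (a ∷ γ) x ≡ eval (env ρ′ (a ∷ γ′)) (lift σ x)
  Sat-subst σ ρ ρ′ γ γ′ e ⊤ᶠ       = ⇔-refl
  Sat-subst σ ρ ρ′ γ γ′ e ⊥ᶠ       = ⇔-refl
  Sat-subst σ ρ ρ′ γ γ′ e (prop b) = ⇔-refl
  Sat-subst σ ρ ρ′ γ γ′ e (eq t u) =
    ≡⇒⇔ (≡.cong₂ (λ a b → ¬ ¬ (a ≡ b)) (eval-bind σ _ _ e t) (eval-bind σ _ _ e u))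
  Sat-subst σ ρ ρ′ γ γ′ e (le l c) = ≡⇒⇔ (≡.cong (_≤ c) (evalLin-bind σ _ _ e l))
  Sat-subst σ ρ ρ′ γ γ′ e (¬ᶠ A)   = ¬-cong-⇔ (Sat-subst σ ρ ρ′ γ γ′ e A)
  Sat-subst σ ρ ρ′ γ γ′ e (A ∧ᶠ B) = Sat-subst σ ρ ρ′ γ γ′ e A ×-⇔ Sat-subst σ ρ ρ′ γ γ′ e B
  Sat-subst σ ρ ρ′ γ γ′ e (A ∨ᶠ B) =
    ¬-cong-⇔ (¬-cong-⇔ (Sat-subst σ ρ ρ′ γ γ′ e A) ×-⇔ ¬-cong-⇔ (Sat-subst σ ρ ρ′ γ γ′ e B))
  Sat-subst σ ρ ρ′ γ γ′ e (∀ᶠ s A) =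
    Π-⇔ λ a → Sat-subst (lift σ) ρ ρ′ (a ∷ γ) (a ∷ γ′) (env-lift σ ρ ρ′ γ γ′ e a) A
  Sat-subst σ ρ ρ′ γ γ′ e (∃ᶠ s A) = ¬-cong-⇔
    (Π-⇔ λ a → ¬-cong-⇔ (Sat-subst (lift σ) ρ ρ′ (a ∷ γ) (a ∷ γ′) (env-lift σ ρ ρ′ γ γ′ e a) A))
  env-lift σ ρ ρ′ γ γ′ e a (bnd (here refl)) = refl
  env-lift σ ρ ρ′ γ γ′ e a (bnd (there i))   = ≡.trans (e (bnd i))
    (eval-bind weaken _ _ (λ { (bnd i) → refl ; (free t) → refl }) (σ (bnd i)))
  env-lift σ ρ ρ′ γ γ′ e a (free t)          = ≡.trans (e (free t))
    (eval-bind weaken _ _ (λ { (bnd i) → refl ; (free t) → refl }) (σ (free t)))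

  Agree : (xs : List Var) (ρ ρ′ : Valuation) → Set
  Agree xs ρ ρ′ = xs ⊆ λ (_ , t) → ρ t ≡ ρ′ t

  module _ {ρ ρ′ : Valuation} where
    eval-agree  : ∀ {Γ s} {γ : All ⟦_⟧ Γ} (t : FTm Γ s) →
                  Agree (freeTm t) ρ ρ′ → eval (env ρ γ) t ≡ eval (env ρ′ γ) t
    evals-agree : ∀ {Γ as} {γ : All ⟦_⟧ Γ} (ts : All (FTm Γ) as) →
                  Agree (freeTms ts) ρ ρ′ → evals (env ρ γ) ts ≡ evals (env ρ′ γ) ts
    eval-agree (var (bnd i))  e = refl
    eval-agree (var (free t)) e = e (here refl)
    eval-agree (app f ts)     e = ≡.cong (⟦op⟧ f) (evals-agree ts e)
    evals-agree []       e = refl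
    evals-agree (t ∷ ts) e =
      ≡.cong₂ _∷_ (eval-agree t (e ∘ ∈-++⁺ˡ)) (evals-agree ts (e ∘ ∈-++⁺ʳ (freeTm t)))

    evalLin-agree : ∀ {Γ} {γ : All ⟦_⟧ Γ} (l : Lin (FVar Γ)) →
                    Agree (concatMap (λ (_ , t) → freeTm t) l) ρ ρ′ →
                    evalLin (env ρ γ) l ≡ evalLin (env ρ′ γ) l
    evalLin-agree []            e = refl
    evalLin-agree ((c , t) ∷ l) e =
      ≡.cong₂ (λ a b → c * a + b) (eval-agree t (e ∘ ∈-++⁺ˡ)) (evalLin-agree l (e ∘ ∈-++⁺ʳ (freeTm t)))

    Sat-agree : ∀ {Γ} {γ : All ⟦_⟧ Γ} A → Agree (FreeVars A) ρ ρ′ → Sat ρ γ A ⇔ Sat ρ′ γ A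
    Sat-agree ⊤ᶠ       e = ⇔-refl
    Sat-agree ⊥ᶠ       e = ⇔-refl
    Sat-agree (prop b) e = ⇔-refl
    Sat-agree (eq t u) e = ≡⇒⇔ (≡.cong₂ (λ a b → ¬ ¬ (a ≡ b))
      (eval-agree t (e ∘ ∈-++⁺ˡ)) (eval-agree u (e ∘ ∈-++⁺ʳ (freeTm t))))
    Sat-agree (le l c) e = ≡⇒⇔ (≡.cong (_≤ c) (evalLin-agree l e))
    Sat-agree (¬ᶠ A)   e = ¬-cong-⇔ (Sat-agree A e)
    Sat-agree (A ∧ᶠ B) e = Sat-agree A (e ∘ ∈-++⁺ˡ) ×-⇔ Sat-agree B (e ∘ ∈-++⁺ʳ (FreeVars A))
    Sat-agree (A ∨ᶠ B) e = ¬-cong-⇔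
      (¬-cong-⇔ (Sat-agree A (e ∘ ∈-++⁺ˡ)) ×-⇔ ¬-cong-⇔ (Sat-agree B (e ∘ ∈-++⁺ʳ (FreeVars A))))
    Sat-agree (∀ᶠ s A) e = Π-⇔ λ a → Sat-agree A e
    Sat-agree (∃ᶠ s A) e = ¬-cong-⇔ (Π-⇔ λ a → ¬-cong-⇔ (Sat-agree A e))

  -- Propositional atoms and inequalities are decidable, equality, `∨ᶠ` and `∃ᶠ` are read as
  -- negations, and the other connectives inherit stability from their parts.
  Sat-stable : ∀ {ρ : Valuation} {Γ} {γ : All ⟦_⟧ Γ} A → ¬ ¬ Sat ρ γ A → Sat ρ γ A
  Sat-stable ⊤ᶠ       h = tt
  Sat-stable ⊥ᶠ       h = h id
  Sat-stable (prop b) h = decidable-stable (T? (⟦pa⟧ b)) h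
  Sat-stable (eq t u) h k = h λ n → n k
  Sat-stable (le l c) h = decidable-stable (_ ℚ.≤? c) h
  Sat-stable (¬ᶠ A)   h k = h λ n → n k
  Sat-stable (A ∧ᶠ B) h = Sat-stable A (λ k → h (k ∘ proj₁)) , Sat-stable B (λ k → h (k ∘ proj₂))
  Sat-stable (A ∨ᶠ B) h k = h λ n → n k
  Sat-stable (∀ᶠ s A) h a = Sat-stable A λ k → h λ f → k (f a)
  Sat-stable (∃ᶠ s A) h k = h λ n → n k

  Sat-⋀ : ∀ {ρ : Valuation} {Γ} {γ : All ⟦_⟧ Γ} {X : Set} (F : X → Form Γ) xs →
          Sat ρ γ (⋀ (map F xs)) ⇔ (∀ x → x ∈ xs → Sat ρ γ (F x))
  Sat-⋀ {ρ} {γ = γ} F xs = mk⇔ (fwd xs) (bwd xs)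
    where
    fwd : ∀ xs → Sat ρ γ (⋀ (map F xs)) → ∀ x → x ∈ xs → Sat ρ γ (F x)
    fwd (x ∷ xs) (h , _)  x (here refl) = h
    fwd (_ ∷ xs) (_ , hs) x (there x∈)  = fwd xs hs x x∈
    bwd : ∀ xs → (∀ x → x ∈ xs → Sat ρ γ (F x)) → Sat ρ γ (⋀ (map F xs))
    bwd []       h = tt
    bwd (x ∷ xs) h = h x (here refl) , bwd xs (λ y y∈ → h y (there y∈))

  Sat-∀* : ∀ {ρ : Valuation} {Γ} {γ : All ⟦_⟧ Γ} Δ (A : Form (Δ ++ Γ)) →
           Sat ρ γ (∀* Δ A) ⇔ (∀ (δ : All ⟦_⟧ Δ) → Sat ρ (All.++⁺ δ γ) A)
  Sat-∀* []      A = mk⇔ (λ { h [] → h }) (λ h → h [])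
  Sat-∀* (s ∷ Δ) A = ⇔-trans (Sat-∀* Δ (∀ᶠ s A))
    (mk⇔ (λ { h (a ∷ δ) → h δ a }) (λ h δ a → h (a ∷ δ)))

  lookup-++⁺ˡ : ∀ {Δ Γ s} (δ : All ⟦_⟧ Δ) (γ : All ⟦_⟧ Γ) (i : s ∈ Δ) →
                lookup (All.++⁺ δ γ) (∈-++⁺ˡ i) ≡ lookup δ i
  lookup-++⁺ˡ (a ∷ δ) γ (here refl) = refl
  lookup-++⁺ˡ (a ∷ δ) γ (there i)   = lookup-++⁺ˡ δ γ i

  private
    SameEnv : ∀ {Δ Γ Γ′ : Ctx} (ρ ρ′ : Valuation) (γ : All ⟦_⟧ Γ) (γ′ : All ⟦_⟧ Γ′)
              (ι : ∀ {s} → s ∈ Δ → FVar Γ s) (ι′ : ∀ {s} → s ∈ Δ → FVar Γ′ s) → Set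
    SameEnv {Δ} ρ ρ′ γ γ′ ι ι′ = ∀ {s} (i : s ∈ Δ) → env ρ γ (ι i) ≡ env ρ′ γ′ (ι′ i)

  clauseForm-cong : ∀ {Δ Γ Γ′ : Ctx} {ρ ρ′ : Valuation} {γ : All ⟦_⟧ Γ} {γ′ : All ⟦_⟧ Γ′}
                    (ι : ∀ {s} → s ∈ Δ → FVar Γ s) (ι′ : ∀ {s} → s ∈ Δ → FVar Γ′ s) →
                    SameEnv ρ ρ′ γ γ′ ι ι′ →
                    ∀ C → Sat ρ γ (clauseForm ι C) ⇔ Sat ρ′ γ′ (clauseForm ι′ C)
  litForm-cong    : ∀ {Δ Γ Γ′ : Ctx} {ρ ρ′ : Valuation} {γ : All ⟦_⟧ Γ} {γ′ : All ⟦_⟧ Γ′}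
                    (ι : ∀ {s} → s ∈ Δ → FVar Γ s) (ι′ : ∀ {s} → s ∈ Δ → FVar Γ′ s) →
                    SameEnv ρ ρ′ γ γ′ ι ι′ →
                    ∀ ℓ → Sat ρ γ (litForm ι ℓ) ⇔ Sat ρ′ γ′ (litForm ι′ ℓ)
  atomForm-cong   : ∀ {Δ Γ Γ′ : Ctx} {ρ ρ′ : Valuation} {γ : All ⟦_⟧ Γ} {γ′ : All ⟦_⟧ Γ′}
                    (ι : ∀ {s} → s ∈ Δ → FVar Γ s) (ι′ : ∀ {s} → s ∈ Δ → FVar Γ′ s) →
                    SameEnv ρ ρ′ γ γ′ ι ι′ →
                    ∀ a → Sat ρ γ (atomForm ι a) ⇔ Sat ρ′ γ′ (atomForm ι′ a)
  proxyForm-cong  : ∀ {Γ Γ′ : Ctx} {ρ ρ′ : Valuation} {γ : All ⟦_⟧ Γ} {γ′ : All ⟦_⟧ Γ′} q →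
                    Sat ρ γ (proxyForm q) ⇔ Sat ρ′ γ′ (proxyForm q)
  clauseForm-cong ι ι′ e []      = ⇔-refl
  clauseForm-cong ι ι′ e (ℓ ∷ C) =
    ¬-cong-⇔ (¬-cong-⇔ (litForm-cong ι ι′ e ℓ) ×-⇔ ¬-cong-⇔ (clauseForm-cong ι ι′ e C))
  litForm-cong ι ι′ e (pos a) = atomForm-cong ι ι′ e a
  litForm-cong ι ι′ e (neg a) = ¬-cong-⇔ (atomForm-cong ι ι′ e a)
  atomForm-cong {ρ = ρ} {ρ′} {γ} {γ′} ι ι′ e (eq t u) =
    ≡⇒⇔ (≡.cong₂ (λ a b → ¬ ¬ (a ≡ b)) (same t) (same u))
    where
    same : ∀ {s} (t : Term _ s) →
           eval (env ρ γ) (bind (var ∘ ι) t) ≡ eval (env ρ′ γ′) (bind (var ∘ ι′) t)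
    same t = ≡.trans (≡.sym (eval-bind (var ∘ ι) (env ρ γ ∘ ι) _ (λ _ → refl) t))
                     (eval-bind (var ∘ ι′) _ _ e t)
  atomForm-cong {ρ = ρ} {γ = γ} ι ι′ e (le l c) = ≡⇒⇔ (≡.cong (_≤ c)
    (≡.trans (≡.sym (evalLin-bind (var ∘ ι) (env ρ γ ∘ ι) _ (λ _ → refl) l))
             (evalLin-bind (var ∘ ι′) _ _ e l)))
  atomForm-cong ι ι′ e (proxy q) = proxyForm-cong q
  proxyForm-cong (patom b)  = ⇔-refl
  proxyForm-cong {γ = γ} {γ′} (all∀ Δ φ) =
    ⇔-trans (Sat-∀* Δ _) (⇔-trans (Π-⇔ λ δ → clauseForm-cong (bnd ∘ ∈-++⁺ˡ) (bnd ∘ ∈-++⁺ˡ)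
      (λ i → ≡.trans (lookup-++⁺ˡ δ γ i) (≡.sym (lookup-++⁺ˡ δ γ′ i))) φ)
    (⇔-sym (Sat-∀* Δ _)))

  -- Under the double-negation reading of `∨ᶠ` no true literal can be exhibited; it can only be
  -- refuted that all literals are false.
  Sat-clauseForm : ∀ {Δ Γ : Ctx} {ρ : Valuation} {γ : All ⟦_⟧ Γ} (ι : ∀ {s} → s ∈ Δ → FVar Γ s) C →
                   Sat ρ γ (clauseForm ι C) → ¬ (C ⊆ λ ℓ → ¬ Sat ρ γ (litForm ι ℓ))
  Sat-clauseForm ι (ℓ ∷ C) h n =
    h (n (here refl) , λ hC → Sat-clauseForm ι C hC (n ∘ there))

  -- The flattening equations for the functions with symbols in R, as equalities
  -- of values.
  Def : Valuation → (Sym → Set) → Set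
  Def ρ R = ∀ {as s} (f : Op as s) ts → symbOp f ⊆ R →
            ρ (app f ts) ≡ ⟦op⟧ f (evals (env ρ []) (vs ts))

  canonical : Valuation
  canonical = eval λ ()

  canonical-def : ∀ {R} → Def canonical R
  canonical-def f ts _ = ≡.cong (⟦op⟧ f) (args ts)
    where
    args : ∀ {as} (ts : All Ground as) → evals (λ ()) ts ≡ evals (env canonical []) (vs ts)
    args []       = refl
    args (t ∷ ts) = ≡.cong (_ ∷_) (args ts)

  flatten-flip : ∀ {ρ : Valuation} ℓ → Sat ρ [] (flatten ℓ) → ¬ Sat ρ [] (flatten (flip ℓ))
  flatten-flip (pos a) h n = n h
  flatten-flip (neg a) h n = h n

  module Instance {Δ : Ctx} {ρ : Valuation} {R : Sym → Set} (def : Def ρ R) (σ : All Ground Δ) where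
    private
      val : ∀ {s} → s ∈ Δ → ⟦ s ⟧
      val i = ρ (lookup σ i)

    -- The values of the substituted terms are read off their variables, so only equations for
    -- symbols of the pattern `t` itself are used. This is why the partition that owns the
    -- quantified clause suffices, whatever symbols the terms in `σ` contain.
    eval-inst  : ∀ {s} (t : Term Δ s) → symbTm t ⊆ R → eval val t ≡ ρ (bind (lookup σ) t)
    evals-inst : ∀ {as} (ts : All (Term Δ) as) → symbTms ts ⊆ R →
                 evals val ts ≡ evals (env ρ []) (vs (binds (lookup σ) ts))
    eval-inst (var i)    r = refl
    eval-inst (app f ts) r =
      ≡.trans (≡.cong (⟦op⟧ f) (evals-inst ts (r ∘ ∈-++⁺ʳ (symbOp f))))
              (≡.sym (def f (binds (lookup σ) ts) (r ∘ ∈-++⁺ˡ)))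
    evals-inst []       r = refl
    evals-inst (t ∷ ts) r =
      ≡.cong₂ _∷_ (eval-inst t (r ∘ ∈-++⁺ˡ)) (evals-inst ts (r ∘ ∈-++⁺ʳ (symbTm t)))

    module _ {Γ : Ctx} {γ : All ⟦_⟧ Γ} (ι : ∀ {s} → s ∈ Δ → FVar Γ s)
             (e : ∀ {s} (i : s ∈ Δ) → val i ≡ env ρ γ (ι i)) where
      private
        term : ∀ {s} (t : Term Δ s) → symbTm (bind (var ∘ ι) t) ⊆ R →
               eval (env ρ γ) (bind (var ∘ ι) t) ≡ ρ (bind (lookup σ) t)
        term t r = ≡.trans (≡.sym (eval-bind (var ∘ ι) val _ e t))
                           (eval-inst t (r ∘ symbTm-bind⁺ (var ∘ ι) t))

        lin : ∀ l → concatMap (λ (_ , t) → symbTm t) (mapLin (bind (var ∘ ι)) l) ⊆ R →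
              evalLin (env ρ γ) (mapLin (bind (var ∘ ι)) l) ≡
              evalLin (env ρ []) (mapLin v (mapLin (bind (lookup σ)) l))
        lin []            r = refl
        lin ((c , t) ∷ l) r = ≡.cong₂ (λ a b → c * a + b) (term t (r ∘ ∈-++⁺ˡ))
          (lin l (r ∘ ∈-++⁺ʳ (symbTm (bind (var ∘ ι) t))))

        atm : ∀ a → symb (atomForm ι a) ⊆ R →
              Sat ρ γ (atomForm ι a) ⇔ Sat ρ [] (flattenAtom (instAtom σ a))
        atm (eq t u) r = ≡⇒⇔ (≡.cong₂ (λ a b → ¬ ¬ (a ≡ b)) (term t (r ∘ ∈-++⁺ˡ))
          (term u (r ∘ ∈-++⁺ʳ (symbTm (bind (var ∘ ι) t)))))
        atm (le l c)  r = ≡⇒⇔ (≡.cong (_≤ c) (lin l r))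
        atm (proxy q) r = proxyForm-cong q

      lit-inst : ∀ ℓ → symb (litForm ι ℓ) ⊆ R →
                 Sat ρ γ (litForm ι ℓ) ⇔ Sat ρ [] (flatten (inst σ ℓ))
      lit-inst (pos a) = atm a
      lit-inst (neg a) r = ¬-cong-⇔ (atm a r)

      clause-inst : ∀ C → symb (clauseForm ι C) ⊆ R → Sat ρ γ (clauseForm ι C) →
                    ¬ (C ⊆ λ ℓ → Sat ρ [] (flatten (flip (inst σ ℓ))))
      clause-inst C r h n = Sat-clauseForm ι C h λ {ℓ} ℓ∈ s →
        flatten-flip (inst σ ℓ) (to (lit-inst ℓ (lits C r ℓ∈)) s) (n ℓ∈)
        where
        lits : ∀ C → symb (clauseForm ι C) ⊆ R → C ⊆ λ ℓ → symb (litForm ι ℓ) ⊆ R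
        lits (ℓ ∷ C) r (here refl) = r ∘ ∈-++⁺ˡ
        lits (ℓ ∷ C) r (there ℓ∈)  = lits C (r ∘ ∈-++⁺ʳ (symb (litForm ι ℓ))) ℓ∈

  module _ (ρ : Valuation) {s₀ : Srt} (t₀ : Ground s₀) (a : ⟦ s₀ ⟧) where
    -- The case analysis follows that of `replace`, so that in `Sat-replace` the two agree by
    -- reflexivity in every case.
    upd : Valuation
    upd {s} t with s₀ ≟srt s
    ... | no  _    = ρ t
    ... | yes refl = if does (t₀ ≟tm t) then a else ρ t

    upd-self : upd t₀ ≡ a
    upd-self with s₀ ≟srt s₀
    ... | no n     = ⊥-elim (n refl)
    ... | yes refl with t₀ ≟tm t₀
    ...   | yes _ = refl
    ...   | no n  = ⊥-elim (n refl)

    upd-other : ∀ {s} (t : Ground s) → (s₀ , t₀) ≢ (s , t) → upd t ≡ ρ t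
    upd-other {s} t n with s₀ ≟srt s
    ... | no _     = refl
    ... | yes refl with t₀ ≟tm t
    ...   | yes refl = ⊥-elim (n refl)
    ...   | no _     = refl

    Sat-upd-∉ : ∀ I → (s₀ , t₀) ∉ FreeVars I → Sat upd [] I ⇔ Sat ρ [] I
    Sat-upd-∉ I u∉ = Sat-agree I λ {(_ , t)} t∈ → upd-other t λ { refl → u∉ t∈ }

    open DecMembership _≟var_ using (_∈?_)

    -- Assigns a to v_t₀ and re-evaluates the proper superterms of t₀, so that
    -- their flattening equations hold again.
    redef  : Valuation
    redefs : ∀ {as} → All Ground as → All ⟦_⟧ as
    redef {s} (app f ts) with (s₀ , t₀) ≟var (s , app f ts)
    ... | yes refl = a
    ... | no _ with (s₀ , t₀) ∈? subtermss ts
    ...   | yes _ = ⟦op⟧ f (redefs ts)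
    ...   | no _  = ρ (app f ts)
    redefs []       = []
    redefs (t ∷ ts) = redef t ∷ redefs ts

    redef-other : ∀ {s} (t : Ground s) → (s₀ , t₀) ∉ subterms t → redef t ≡ ρ t
    redef-other {s} (app f ts) n with (s₀ , t₀) ≟var (s , app f ts)
    ... | yes refl = ⊥-elim (n (here refl))
    ... | no _ with (s₀ , t₀) ∈? subtermss ts
    ...   | yes u∈ = ⊥-elim (n (there u∈))
    ...   | no _   = refl

    private
      redefs-vs : ∀ {as} (ts : All Ground as) → redefs ts ≡ evals (env redef []) (vs ts)
      redefs-vs []       = refl
      redefs-vs (t ∷ ts) = ≡.cong (redef t ∷_) (redefs-vs ts)

    -- Only the equation of `t₀` itself can break. A proper superterm of `t₀` satisfies its equation
    -- by construction, and every other term keeps its value together with the values of its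
    -- arguments.
    redef-def : ∀ {as s} (f : Op as s) ts → (s₀ , t₀) ≢ (s , app f ts) →
                ρ (app f ts) ≡ ⟦op⟧ f (evals (env ρ []) (vs ts)) →
                redef (app f ts) ≡ ⟦op⟧ f (evals (env redef []) (vs ts))
    redef-def {s = s} f ts n d with (s₀ , t₀) ≟var (s , app f ts)
    ... | yes refl = ⊥-elim (n refl)
    ... | no _ with (s₀ , t₀) ∈? subtermss ts
    ...   | yes _ = ≡.cong (⟦op⟧ f) (redefs-vs ts)
    ...   | no u∉ = ≡.trans d (≡.cong (⟦op⟧ f) (≡.sym (evals-agree {redef} {ρ} (vs ts) λ {(_ , w)} w∈ →
                      redef-other w λ u∈ → u∉ (subtermss-trans ts (args⊆subtermss ts w∈) u∈))))

  redef-self : ∀ (ρ : Valuation) {s} (t : Ground s) a → redef ρ t a t ≡ a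
  redef-self ρ {s} (app f ts) a with (s , app f ts) ≟var (s , app f ts)
  ... | yes refl = refl
  ... | no n     = ⊥-elim (n refl)

  -- Reduces every elimination rule to a change of the valuation at `t`: `r` is the new bound
  -- variable for the two quantifiers, and the right-hand side of the flattening equation for
  -- unfolding.
  Sat-replace : ∀ {ρ : Valuation} {Γ} {γ : All ⟦_⟧ Γ} {s} (t : Ground s) (r : FTm Γ s) I →
                Sat (upd ρ t (eval (env ρ γ) r)) [] I ⇔ Sat ρ γ (I [v t ↦ r ])
  Sat-replace {ρ} {γ = γ} {s₀} t r I = Sat-subst (replace t r) _ ρ [] γ env-replace I
    where
    env-replace : ∀ {s} (x : FVar [] s) →
                  env (upd ρ t (eval (env ρ γ) r)) [] x ≡ eval (env ρ γ) (replace t r x)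
    env-replace {s} (free u) with s₀ ≟srt s
    ... | no _     = refl
    ... | yes refl with t ≟tm u
    ...   | yes _ = refl
    ...   | no _  = refl

-- Leaf sets of a node and its children.

data Split : Bool → Bool → Bool → Set where
  left    : Split true true false
  right   : Split true false true
  outside : Split false false false

Split-sym : ∀ {a b c} → Split a b c → Split a c b
Split-sym left    = right
Split-sym right   = left
Split-sym outside = outside

Split-∁ : ∀ {a b c} → Split a b c → not b ≡ true → c ≡ true ⊎ not a ≡ true
Split-∁ left    ()
Split-∁ right   _ = inj₁ refl
Split-∁ outside _ = inj₂ refl

Split-∪ : ∀ {a b c} → Split a b c → a ≡ true → b ≡ true ⊎ c ≡ true
Split-∪ left  _ = inj₁ refl
Split-∪ right _ = inj₂ refl

-- The leaf set of a node is the disjoint union of those of its children, stated pointwise: matching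
-- on the result leaves three of the eight combinations of truth values.
st-split : ∀ {t} {x y z : Node t} → Children x y z → ∀ p → Split (st x p) (st y p) (st z p)
st-split root    (inl p) = left
st-split root    (inr p) = right
st-split (inl c) (inl p) = st-split c p
st-split (inl c) (inr p) = outside
st-split (inr c) (inl p) = outside
st-split (inr c) (inr p) = st-split c p

st-leaf : ∀ {t} (p : Leaf t) → st (leafNode p) p ≡ true
st-leaf here    = refl
st-leaf (inl p) = st-leaf p
st-leaf (inr p) = st-leaf p

st-leaf⁻ : ∀ {t} (p q : Leaf t) → st (leafNode p) q ≡ true → q ≡ p
st-leaf⁻ here    here    e = refl
st-leaf⁻ (inl p) (inl q) e = ≡.cong inl (st-leaf⁻ p q e)
st-leaf⁻ (inr p) (inr q) e = ≡.cong inr (st-leaf⁻ p q e)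

∈-leaves : ∀ {t} (p : Leaf t) → p ∈ leaves t
∈-leaves here    = here refl
∈-leaves (inl p) = ∈-++⁺ˡ (∈-map⁺ inl (∈-leaves p))
∈-leaves {node l r} (inr p) = ∈-++⁺ʳ (map inl (leaves l)) (∈-map⁺ inr (∈-leaves p))

not-true : ∀ {b} → not b ≡ true → b ≢ true
not-true {true} ()
not-true {false} _ ()

true? : (b : Bool) → b ≡ true ⊎ not b ≡ true
true? true  = inj₁ refl
true? false = inj₂ refl

-- The invariant of the labelling, and clauses that follow from one partition.

module Invariants (Sg : Signature) (𝒯 : Logic.Theory Sg)
                  (Q : Interpolation.Problem Sg 𝒯) where
  open Logic Sg
  open Syntax Sg
  open Interpolation Sg 𝒯
  open Problem Q
  open WithProblem Q

  symb-⋀ : ∀ {X : Set} {f} (G : X → Form []) xs → f ∈ symb (⋀ (map G xs)) →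
           ∃[ x ] x ∈ xs × f ∈ symb (G x)
  symb-⋀ G (x ∷ xs) f∈ with ∈-++⁻ (symb (G x)) f∈
  ... | inj₁ f∈x  = x , here refl , f∈x
  ... | inj₂ f∈xs = let y , y∈ , f∈y = symb-⋀ G xs f∈xs in y , there y∈ , f∈y

  symb-⋀⁺ : ∀ {X : Set} {f} (G : X → Form []) {x xs} → x ∈ xs → f ∈ symb (G x) →
            f ∈ symb (⋀ (map G xs))
  symb-⋀⁺ G (here refl) f∈ = ∈-++⁺ˡ f∈
  symb-⋀⁺ G {xs = y ∷ _} (there x∈) f∈ = ∈-++⁺ʳ (symb (G y)) (symb-⋀⁺ G x∈ f∈)

  FreeVars-⋀ : ∀ {X : Set} {u} (G : X → Form []) xs → u ∈ FreeVars (⋀ (map G xs)) →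
               ∃[ x ] x ∈ xs × u ∈ FreeVars (G x)
  FreeVars-⋀ G (x ∷ xs) u∈ with ∈-++⁻ (FreeVars (G x)) u∈
  ... | inj₁ u∈x  = x , here refl , u∈x
  ... | inj₂ u∈xs = let y , y∈ , u∈y = FreeVars-⋀ G xs u∈xs in y , there y∈ , u∈y

  partForm-closed : ∀ Cs {u} → u ∉ FreeVars (partForm Cs)
  partForm-closed Cs u∈ = let C , _ , u∈C = FreeVars-⋀ groundClause Cs u∈
                          in clauseForm-closed id C u∈C

  created-symb : ∀ {p q} → q ∈ created p → symb (proxyForm {[]} q) ⊆ (_∈ symbF p)
  created-symb {p} q∈ =
    let C , C∈ , q∈C = find (∈-concatMap⁻ clauseProxies {xs = F p} q∈)
    in clauseProxies-symb bnd C (symb-⋀⁺ groundClause C∈) q∈C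

  created-nested : ∀ {p q q′} → q ∈ created p → q′ ∈ proxyProxies q → q′ ∈ created p
  created-nested {p} q∈ q′∈ =
    let C , C∈ , q∈C = find (∈-concatMap⁻ clauseProxies {xs = F p} q∈)
    in ∈-concatMap⁺ clauseProxies (lose C∈ (proxy-nested C q∈C q′∈))

  ∈partitions⇔ : ∀ {p as s} (f : Op as s) → p ∈partitions f ⇔ (symbOp f ⊆ (_∈ symbF p))
  ∈partitions⇔ (un f) = mk⇔ (λ { f∈ (here refl) → f∈ }) (λ h → h (here refl))
  ∈partitions⇔ (th f) = mk⇔ (λ _ ()) (λ _ → tt)
  ∈partitions⇔ (bi f) = mk⇔ (λ _ ()) (λ _ → tt)

  atom-flip : ∀ (ℓ : Literal []) → atom (flip ℓ) ≡ atom ℓ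
  atom-flip (pos a) = refl
  atom-flip (neg a) = refl

  lin-symb : ∀ l {f} → f ∉ concatMap (λ (_ , t) → symbTm t) (mapLin (v {[]}) l)
  lin-symb (_ ∷ l) f∈ = lin-symb l f∈

  flatten-symb : ∀ ℓ {f} → f ∈ symb (flatten ℓ) →
                 ∃[ q ] atom ℓ ≡ proxy q × f ∈ symb (proxyForm {[]} q)
  flatten-symb = lit
    where
    atm : ∀ a {f} → f ∈ symb (flattenAtom a) → ∃[ q ] a ≡ proxy q × f ∈ symb (proxyForm {[]} q)
    atm (eq t u)  ()
    atm (le l c)  f∈ = ⊥-elim (lin-symb l f∈)
    atm (proxy q) f∈ = q , refl , f∈
    lit : ∀ ℓ {f} → f ∈ symb (flatten ℓ) → ∃[ q ] atom ℓ ≡ proxy q × f ∈ symb (proxyForm {[]} q)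
    lit (pos a) = atm a
    lit (neg a) = atm a

  lin-vars : ∀ l → concatMap (λ (_ , t) → freeTm t) (mapLin (v {[]}) l) ⊆
             (_∈ concatMap (λ (_ , t) → subterms t) l)
  lin-vars ((_ , t) ∷ l) (here refl) = ∈-++⁺ˡ (subterms-self t)
  lin-vars ((_ , t) ∷ l) (there u∈)  = ∈-++⁺ʳ (subterms t) (lin-vars l u∈)

  flatten-vars : ∀ ℓ → FreeVars (flatten ℓ) ⊆ (_∈ atomSubterms (atom ℓ))
  flatten-vars = lit
    where
    atm : ∀ a → FreeVars (flattenAtom a) ⊆ (_∈ atomSubterms a)
    atm (eq t u)  (here refl)         = ∈-++⁺ˡ (subterms-self t)
    atm (eq t u)  (there (here refl)) = ∈-++⁺ʳ (subterms t) (subterms-self u)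
    atm (le l c)  u∈ = lin-vars l u∈
    atm (proxy q) u∈ = ⊥-elim (proxyForm-closed q u∈)
    lit : ∀ ℓ → FreeVars (flatten ℓ) ⊆ (_∈ atomSubterms (atom ℓ))
    lit (pos a) = atm a
    lit (neg a) = atm a

  supported : ∀ {ℓ C u} → ℓ ∈ C → u ∈ atomSubterms (atom ℓ) → Supported C u
  supported ℓ∈ u∈ = ∈-concatMap⁺ (atomSubterms ∘ atom) (lose ℓ∈ u∈)

  supported⁻ : ∀ C {u} → Supported C u → ∃[ ℓ ] ℓ ∈ C × u ∈ atomSubterms (atom ℓ)
  supported⁻ C u∈ = find (∈-concatMap⁻ (atomSubterms ∘ atom) {xs = C} u∈)

  supported-trans : ∀ C {r w} {t : Ground r} → Supported C (r , t) → w ∈ subterms t → Supported C w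
  supported-trans C t∈ w∈ = let ℓ , ℓ∈ , t∈ℓ = supported⁻ C t∈ in supported ℓ∈ (atm (atom ℓ) t∈ℓ w∈)
    where
    atm : ∀ a {r w} {t : Ground r} → (r , t) ∈ atomSubterms a → w ∈ subterms t → w ∈ atomSubterms a
    atm (eq t u) t∈ w∈ with ∈-++⁻ (subterms t) t∈
    ... | inj₁ t∈t = ∈-++⁺ˡ (subterms-trans t t∈t w∈)
    ... | inj₂ t∈u = ∈-++⁺ʳ (subterms t) (subterms-trans u t∈u w∈)
    atm (le l c) t∈ w∈ =
      let (_ , u) , u∈ , t∈u = find (∈-concatMap⁻ (λ (_ , u) → subterms u) {xs = l} t∈)
      in ∈-concatMap⁺ (λ (_ , u) → subterms u) (lose u∈ (subterms-trans u t∈u w∈))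

  module _ (κ : Colouring) where
    open Colouring κ
    open Algorithm κ

    -- The assumptions at leaf `p` when `C` is negated, as facts about `ρ` instead of a formula; one
    -- clause is then exchanged for another literal by literal. Interpreted functions have no
    -- symbols, so `def` always includes their equations.
    record Premise (M : Structure) (p : P) (C : Clause) (ρ : Semantics.Valuation M) : Set where
      constructor premise
      open Semantics M
      field
        def : Models.Def Sg M ρ (_∈ symbF p)
        inp : Sat ρ [] (partForm (F p))
        negated : ∀ ℓ → ℓ ∈ C → colour (atom ℓ) ≡ p → Sat ρ [] (flatten (flip ℓ))

    -- Like IsPartialInterpolant, except that at a leaf the flattening equations
    -- of all terms are assumed, including the unsupported ones. In this form
    -- the invariant does not change while variables are being eliminated.
    record Invariant′ (C : Clause) (Ok : Var → Set) (I : Node tree → Form []) : Set₁ where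
      field
        atRoot  : ∀ M → 𝒯 M → let open Semantics M in (ρ : Valuation) → ¬ Sat ρ [] (I root)
        atLeaf  : ∀ p M → 𝒯 M → let open Semantics M in (ρ : Valuation) →
                  Premise M p C ρ → Sat ρ [] (I (leafNode p))
        atInner : ∀ {x y z} → Children x y z → ∀ M → 𝒯 M → let open Semantics M in
                  (ρ : Valuation) → Sat ρ [] (I y) → Sat ρ [] (I z) → Sat ρ [] (I x)
        symbols : ∀ x {f} → f ∈ symb (I x) →
                  (∃[ p ] T (st x p) × f ∈ symbF p) ×
                  (∃[ p ] T (∁ (st x) p) × f ∈ symbF p)
        vars    : ∀ x → FreeVars (I x) ⊆ Ok

    -- The more general `Ok` serves the moment between combining two labels and eliminating: the
    -- clause is already the resolvent, but the variables are still those of the premises.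
    Invariant : Clause → (Node tree → Form []) → Set₁
    Invariant C = Invariant′ C (Supported C)

    colour-flip : ∀ ℓ → colour (atom (flip ℓ)) ≡ colour (atom ℓ)
    colour-flip ℓ = ≡.cong colour (atom-flip ℓ)


    module _ {M : Structure} where
      open Semantics M
      open Models Sg M

      Sat-↓⁻ : ∀ {ρ : Valuation} C A → Sat ρ [] (negate C ↓⁻ A) ⇔
               (∀ ℓ → ℓ ∈ C → A (colour (atom ℓ)) ≡ true → Sat ρ [] (flatten (flip ℓ)))
      Sat-↓⁻ {ρ} C A = mk⇔ fwd bwd
        where
        fwd : Sat ρ [] (negate C ↓⁻ A) → ∀ ℓ → ℓ ∈ C → A (colour (atom ℓ)) ≡ true →
              Sat ρ [] (flatten (flip ℓ))
        fwd h ℓ ℓ∈ e with to (Sat-⋀ (flip ℓ ↓⁻ᵖ_) _)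
                             (to (Sat-⋀ _ (negate C)) h (flip ℓ) (∈-map⁺ flip ℓ∈))
                             (colour (atom (flip ℓ)))
                             (∈-filter⁺ (T? ∘ A) (∈-leaves _)
                               (from T-≡ (≡.trans (≡.cong A (colour-flip ℓ)) e)))
        ... | k with colour (atom (flip ℓ)) ≟leaf colour (atom (flip ℓ))
        ...   | yes _ = k
        ...   | no n  = ⊥-elim (n refl)
        bwd : (∀ ℓ → ℓ ∈ C → A (colour (atom ℓ)) ≡ true → Sat ρ [] (flatten (flip ℓ))) →
              Sat ρ [] (negate C ↓⁻ A)
        bwd h = from (Sat-⋀ _ (negate C)) λ ℓ′ ℓ′∈ →
          from (Sat-⋀ (ℓ′ ↓⁻ᵖ_) _) λ p p∈ →
            lit ℓ′ (∈-map⁻ flip ℓ′∈) p (∈-filter⁻ (T? ∘ A) {xs = leaves tree} p∈)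
          where
          lit : ∀ ℓ′ → ∃[ ℓ ] ℓ ∈ C × ℓ′ ≡ flip ℓ → ∀ p → p ∈ leaves tree × T (A p) →
                Sat ρ [] (ℓ′ ↓⁻ᵖ p)
          lit _ (ℓ , ℓ∈ , refl) p (_ , Ap) with p ≟leaf colour (atom (flip ℓ))
          ... | yes refl = h ℓ ℓ∈ (≡.trans (≡.cong A (≡.sym (colour-flip ℓ))) (to T-≡ Ap))
          ... | no _     = tt

    ↓⁻-symb : ∀ C A {f} → f ∈ symb (negate C ↓⁻ A) →
              ∃[ ℓ ] ℓ ∈ C × A (colour (atom ℓ)) ≡ true × f ∈ symb (flatten (flip ℓ))
    ↓⁻-symb C A f∈ with symb-⋀ _ (negate C) f∈
    ... | ℓ′ , ℓ′∈ , f∈ with symb-⋀ (ℓ′ ↓⁻ᵖ_) (filterᵇ A (leaves tree)) f∈ | ∈-map⁻ flip ℓ′∈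
    ...   | p , p∈ , f∈ | ℓ , ℓ∈ , refl with p ≟leaf colour (atom (flip ℓ)) | f∈
    ...     | yes refl | f∈ = ℓ , ℓ∈ , ≡.trans (≡.cong A (≡.sym (colour-flip ℓ)))
                                (to T-≡ (proj₂ (∈-filter⁻ (T? ∘ A) {xs = leaves tree} p∈))) , f∈
    ...     | no _     | ()

    ↓⁻-vars : ∀ C A → FreeVars (negate C ↓⁻ A) ⊆ Supported C
    ↓⁻-vars C A u∈ with FreeVars-⋀ _ (negate C) u∈
    ... | ℓ′ , ℓ′∈ , u∈ with FreeVars-⋀ (ℓ′ ↓⁻ᵖ_) (filterᵇ A (leaves tree)) u∈ | ∈-map⁻ flip ℓ′∈
    ...   | p , p∈ , u∈ | ℓ , ℓ∈ , refl with p ≟leaf colour (atom (flip ℓ)) | u∈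
    ...     | yes _ | u∈ = supported ℓ∈
                (≡.subst (λ a → _ ∈ atomSubterms a) (atom-flip ℓ) (flatten-vars (flip ℓ) u∈))
    ...     | no _  | ()

    -- The label at a node mentions only literals coloured on the side of the node that does not
    -- contain `p`. Proxies are all coloured `p`, so no uninterpreted symbol enters a label. At the
    -- leaf `p` the premise refutes the literals coloured `p` and the assumed conjunction all
    -- others, which contradicts the validity of `C` there.
    local-invariant :
      ∀ {C p I} →
      (∀ ℓ → ℓ ∈ C → ∀ q → atom ℓ ≡ proxy q → colour (proxy q) ≡ p) →
      (∀ M → 𝒯 M → let open Semantics M in (ρ : Valuation) →
       Models.Def Sg M ρ (_∈ symbF p) → Sat ρ [] (partForm (F p)) →
       ¬ (∀ ℓ → ℓ ∈ C → Sat ρ [] (flatten (flip ℓ)))) →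
      (∀ x → I x ≡ local C p (st x)) → Invariant C I
    local-invariant {C} {p} {I} prox valid I≡ = record
      { atRoot = λ M 𝒯M ρ h → root⊥ M ρ (≡.subst (Semantics.Sat M ρ []) (I≡ root) h)
      ; atLeaf = λ p′ M 𝒯M ρ pre →
          ≡.subst (Semantics.Sat M ρ []) (≡.sym (I≡ (leafNode p′))) (leaf⊤ p′ M 𝒯M ρ pre)
      ; atInner = λ {x} {y} {z} c M 𝒯M ρ hy hz → ≡.subst (Semantics.Sat M ρ []) (≡.sym (I≡ x))
          (inner c M ρ (≡.subst (Semantics.Sat M ρ []) (I≡ y) hy)
                       (≡.subst (Semantics.Sat M ρ []) (I≡ z) hz))
      ; symbols = λ x {f} f∈ → ⊥-elim (noSymb (st x) (≡.subst (λ A → f ∈ symb A) (I≡ x) f∈))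
      ; vars = λ x {u} u∈ → vars′ (st x) (≡.subst (λ A → u ∈ FreeVars A) (I≡ x) u∈)
      }
      where
      root⊥ : ∀ M → let open Semantics M in (ρ : Valuation) → ¬ Sat ρ [] (local C p (st root))
      root⊥ M ρ n = n (from (Sat-↓⁻ C (∁ (st root))) λ ℓ ℓ∈ ())

      leaf⊤ : ∀ p′ M → 𝒯 M → let open Semantics M in (ρ : Valuation) →
              Premise M p′ C ρ → Sat ρ [] (local C p (st (leafNode p′)))
      leaf⊤ p′ M 𝒯M ρ (premise def inp ngd) with st (leafNode p′) p in e
      ... | false = from (Sat-↓⁻ C (st (leafNode p′))) λ ℓ ℓ∈ e → ngd ℓ ℓ∈ (st-leaf⁻ p′ _ e)
      ... | true with st-leaf⁻ p′ p e
      ...   | refl = λ h → valid M 𝒯M ρ def inp λ ℓ ℓ∈ →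
        [ (λ e → ngd ℓ ℓ∈ (st-leaf⁻ p _ e)) , to (Sat-↓⁻ C (∁ (st (leafNode p)))) h ℓ ℓ∈ ]′
          (true? (st (leafNode p) (colour (atom ℓ))))

      inner : ∀ {x y z} → Children x y z → ∀ M → let open Semantics M in (ρ : Valuation) →
              Sat ρ [] (local C p (st y)) → Sat ρ [] (local C p (st z)) → Sat ρ [] (local C p (st x))
      inner {x} {y} {z} c M ρ hy hz with st x p | st y p | st z p | st-split c p
      -- A leaf outside the child that contains `p` lies in its sibling or outside the parent. The
      -- label of the sibling refutes the literals of the first kind, the assumption `k` those of
      -- the second.
      ... | _ | _ | _ | left    = λ k → hy (from (Sat-↓⁻ C (∁ (st y))) λ ℓ ℓ∈ e →
        [ to (Sat-↓⁻ C (st z)) hz ℓ ℓ∈ , to (Sat-↓⁻ C (∁ (st x))) k ℓ ℓ∈ ]′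
          (Split-∁ (st-split c (colour (atom ℓ))) e))
      ... | _ | _ | _ | right   = λ k → hz (from (Sat-↓⁻ C (∁ (st z))) λ ℓ ℓ∈ e →
        [ to (Sat-↓⁻ C (st y)) hy ℓ ℓ∈ , to (Sat-↓⁻ C (∁ (st x))) k ℓ ℓ∈ ]′
          (Split-∁ (Split-sym (st-split c (colour (atom ℓ)))) e))
      ... | _ | _ | _ | outside = from (Sat-↓⁻ C (st x)) λ ℓ ℓ∈ e →
        [ to (Sat-↓⁻ C (st y)) hy ℓ ℓ∈ , to (Sat-↓⁻ C (st z)) hz ℓ ℓ∈ ]′
          (Split-∪ (st-split c (colour (atom ℓ))) e)

      noProxy : ∀ {A f ℓ} → A p ≡ false → ℓ ∈ C → A (colour (atom ℓ)) ≡ true →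
                f ∉ symb (flatten (flip ℓ))
      noProxy {A} {f} {ℓ} Ap ℓ∈ e f∈ with flatten-symb (flip ℓ) f∈
      ... | q , a≡ , _ with () ← ≡.trans (≡.sym Ap) (≡.trans (≡.cong A (≡.sym
              (≡.trans (≡.cong colour (≡.trans (≡.sym (atom-flip ℓ)) a≡))
                       (prox ℓ ℓ∈ q (≡.trans (≡.sym (atom-flip ℓ)) a≡))))) e)

      noSymb : ∀ A {f} → f ∉ symb (local C p A)
      noSymb A f∈ with A p in Ap
      ... | true  = let ℓ , ℓ∈ , e , f∈ℓ = ↓⁻-symb C (∁ A) f∈ in noProxy {∁ A} (≡.cong not Ap) ℓ∈ e f∈ℓ
      ... | false = let ℓ , ℓ∈ , e , f∈ℓ = ↓⁻-symb C A f∈ in noProxy {A} Ap ℓ∈ e f∈ℓ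

      vars′ : ∀ A → FreeVars (local C p A) ⊆ Supported C
      vars′ A u∈ with A p
      ... | true  = ↓⁻-vars C (∁ A) u∈
      ... | false = ↓⁻-vars C A u∈

-- Input clauses, instantiation, congruence and trichotomy lemmas.

module Local (Sg : Signature) (𝒯 : Logic.Theory Sg) (Q : Interpolation.Problem Sg 𝒯)
             (κ : Interpolation.WithProblem.Colouring Sg 𝒯 Q) where
  open Signature Sg using (UFun)
  open Logic Sg
  open Syntax Sg
  open Interpolation Sg 𝒯
  open Problem Q
  open WithProblem Q
  open Invariants Sg 𝒯 Q
  open Colouring κ
  open Algorithm κ

  ∈-clauseProxies : ∀ {Δ ℓ q} {C : List (Literal Δ)} → ℓ ∈ C → atom ℓ ≡ proxy q → q ∈ clauseProxies C
  ∈-clauseProxies {ℓ = pos _} (here refl) refl = here refl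
  ∈-clauseProxies {ℓ = neg _} (here refl) refl = here refl
  ∈-clauseProxies {C = ℓ ∷ _} (there ℓ∈)  e    = ∈-++⁺ʳ (litProxies ℓ) (∈-clauseProxies ℓ∈ e)

  input-invariant : ∀ {p C I} → C ∈ F p → (∀ x → I x ≡ local C p (st x)) → Invariant κ C I
  input-invariant {p} {C} C∈ = local-invariant κ
    (λ ℓ ℓ∈ q a≡ → ofProxy (∈-concatMap⁺ clauseProxies (lose C∈ (∈-clauseProxies ℓ∈ a≡))))
    λ M 𝒯M ρ def inp refuted → let open Models Sg M in
      Instance.clause-inst {ρ = ρ} def [] bnd (λ ()) C (symb-⋀⁺ groundClause C∈)
        (to (Sat-⋀ groundClause (F p)) inp C C∈)
        λ {ℓ} ℓ∈ → ≡.subst (λ ℓ → Semantics.Sat M ρ [] (flatten (flip ℓ))) (≡.sym (inst-closed ℓ))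
          (refuted ℓ ℓ∈)

  atom-inst⁻ : ∀ {Δ} (σ : All Ground Δ) ℓ {q} → atom (inst σ ℓ) ≡ proxy q → atom ℓ ≡ proxy q
  atom-inst⁻ σ (pos (proxy q)) refl = refl
  atom-inst⁻ σ (neg (proxy q)) refl = refl

  module _ {M : Structure} where
    open Semantics M

    values : Valuation → ∀ {Δ} → All Ground Δ → All ⟦_⟧ Δ
    values ρ []      = []
    values ρ (t ∷ σ) = ρ t ∷ values ρ σ

    lookup-values : ∀ (ρ : Valuation) {Δ s} (σ : All Ground Δ) (i : s ∈ Δ) →
                    ρ (lookup σ i) ≡ lookup (values ρ σ) i
    lookup-values ρ (t ∷ σ) (here refl) = refl
    lookup-values ρ (t ∷ σ) (there i)   = lookup-values ρ σ i

  instan-invariant : ∀ {Δ φ σ p I} → let q = all∀ Δ φ; C = neg (proxy q) ∷ map (inst σ) φ in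
                     q ∈ created p → (∀ x → I x ≡ local C (colour (proxy q)) (st x)) → Invariant κ C I
  instan-invariant {Δ} {φ} {σ} {p} q∈ I≡ = local-invariant κ
    (λ { _ (here refl) q refl → refl
       ; ℓ (there ℓ∈) q′ a≡ → proxies (∈-map⁻ (inst σ) ℓ∈) a≡ })
    (λ M 𝒯M ρ def inp refuted → let open Models Sg M in
      Instance.clause-inst {ρ = ρ} def σ {Δ ++ []} {All.++⁺ (values {M} ρ σ) []} (bnd ∘ ∈-++⁺ˡ)
        (λ i → ≡.trans (lookup-values {M} ρ σ i) (≡.sym (lookup-++⁺ˡ (values {M} ρ σ) [] i))) φ
        (symb-all∀ Δ φ (≡.subst (λ p → symb (proxyForm {[]} (all∀ Δ φ)) ⊆ (_∈ symbF p))
          (≡.sym (ofProxy q∈)) (created-symb q∈)))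
        -- Refuting the first literal asserts the quantified clause itself, which is then
        -- instantiated at the values that `ρ` gives to the variables of the terms in `σ`.
        (to (Sat-∀* Δ _) (refuted _ (here refl)) (values {M} ρ σ))
        λ {ℓ} ℓ∈ → refuted _ (there (∈-map⁺ (inst σ) ℓ∈)))
    I≡
    where
    proxies : ∀ {ℓ q′} → ∃[ k ] k ∈ φ × ℓ ≡ inst σ k → atom ℓ ≡ proxy q′ →
              colour (proxy q′) ≡ colour (proxy (all∀ Δ φ))
    proxies (k , k∈ , refl) a≡ = ≡.trans
      (ofProxy (created-nested q∈ (∈-clauseProxies k∈ (atom-inst⁻ σ k a≡))))
      (≡.sym (ofProxy q∈))

  argDiseqs-eq : ∀ {as} (ts us : All Ground as) → argDiseqs ts us ⊆ λ ℓ → ∀ q → atom ℓ ≢ proxy q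
  argDiseqs-eq []       []       ()
  argDiseqs-eq (t ∷ ts) (u ∷ us) (here refl) q ()
  argDiseqs-eq (t ∷ ts) (u ∷ us) (there ℓ∈)  = argDiseqs-eq ts us ℓ∈

  argDiseqs-equal : ∀ {M : Structure} → let open Semantics M in
                    ∀ {ρ : Valuation} {as} (ts us : All Ground as) →
                    (∀ ℓ → ℓ ∈ argDiseqs ts us → Sat ρ [] (flatten (flip ℓ))) →
                    ¬ ¬ (evals (env ρ []) (vs ts) ≡ evals (env ρ []) (vs us))
  argDiseqs-equal []       []       h n = n refl
  argDiseqs-equal (t ∷ ts) (u ∷ us) h n =
    h _ (here refl) λ e → argDiseqs-equal ts us (λ ℓ ℓ∈ → h ℓ (there ℓ∈)) λ es → n (≡.cong₂ _∷_ e es)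

  -- The flattening equations of both applications hold at `p` because `f` occurs there, and equal
  -- arguments make their right-hand sides equal.
  cong-invariant : ∀ {as s} {f : UFun as s} {ts us p I} → p ∈partitions un f →
                   (∀ x → I x ≡ local (congClause f ts us) p (st x)) →
                   Invariant κ (congClause f ts us) I
  cong-invariant {f = f} {ts} {us} {p} f∈ = local-invariant κ
    (λ { _ (here refl) q ()
       ; ℓ (there ℓ∈) q a≡ → ⊥-elim (argDiseqs-eq ts us ℓ∈ q a≡) })
    λ M 𝒯M ρ def inp refuted → let open Semantics M in
      argDiseqs-equal {M} {ρ} ts us (λ ℓ ℓ∈ → refuted ℓ (there ℓ∈)) λ es →
      refuted _ (here refl) λ n → n (≡.trans (def (un f) ts (to (∈partitions⇔ (un f)) f∈))
        (≡.trans (≡.cong (⟦op⟧ (un f)) es) (≡.sym (def (un f) us (to (∈partitions⇔ (un f)) f∈)))))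

  -- Of the three flattened literals of ¬ C exactly one is false, and both
  -- alternatives for the label say that its colour is not in A.
  OneFalse : (M : Structure) → Semantics.Valuation M → Clause → Set
  OneFalse M ρ C = ∃[ k ] k ∈ C × ¬ Semantics.Sat M ρ [] (flatten (flip k)) ×
                   (∀ ℓ → ℓ ∈ C → ℓ ≡ k ⊎ Semantics.Sat M ρ [] (flatten (flip ℓ)))

  module _ {C : Clause} {I : Node tree → Form []}
           (I≡ : ∀ x → I x ≡ negate C ↓⁻ st x ⊎ I x ≡ ¬ᶠ (negate C ↓⁻ ∁ (st x)))
           {M : Structure} {ρ : Semantics.Valuation M} where
    open Semantics M

    either-label : (one : OneFalse M ρ C) → ∀ x →
                   Sat ρ [] (I x) ⇔ (not (st x (colour (atom (proj₁ one)))) ≡ true)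
    either-label (k , k∈ , false-k , others-true) x with I x | I≡ x
    ... | _ | inj₁ refl = mk⇔
      (λ h → fwd (true? (st x (colour (atom k)))) h)
      (λ e → from (Sat-↓⁻ κ {M} C (st x)) λ ℓ ℓ∈ e′ → bwd ℓ e e′ (others-true ℓ ℓ∈))
      where
      fwd : st x (colour (atom k)) ≡ true ⊎ not (st x (colour (atom k))) ≡ true →
            Sat ρ [] (negate C ↓⁻ st x) → not (st x (colour (atom k))) ≡ true
      fwd (inj₁ e) h = ⊥-elim (false-k (to (Sat-↓⁻ κ {M} C (st x)) h k k∈ e))
      fwd (inj₂ e) h = e
      bwd : ∀ ℓ → not (st x (colour (atom k))) ≡ true → st x (colour (atom ℓ)) ≡ true →
            ℓ ≡ k ⊎ Sat ρ [] (flatten (flip ℓ)) → Sat ρ [] (flatten (flip ℓ))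
      bwd ℓ e e′ (inj₁ refl) = ⊥-elim (not-true e e′)
      bwd ℓ e e′ (inj₂ s)    = s
    ... | _ | inj₂ refl = mk⇔
      (λ h → fwd (true? (st x (colour (atom k)))) h)
      (λ e h → false-k (to (Sat-↓⁻ κ {M} C (∁ (st x))) h k k∈ e))
      where
      sat : ∀ ℓ → st x (colour (atom k)) ≡ true → not (st x (colour (atom ℓ))) ≡ true →
            ℓ ≡ k ⊎ Sat ρ [] (flatten (flip ℓ)) → Sat ρ [] (flatten (flip ℓ))
      sat ℓ e e′ (inj₁ refl) = ⊥-elim (not-true e′ e)
      sat ℓ e e′ (inj₂ s)    = s
      fwd : st x (colour (atom k)) ≡ true ⊎ not (st x (colour (atom k))) ≡ true →
            ¬ Sat ρ [] (negate C ↓⁻ ∁ (st x)) → not (st x (colour (atom k))) ≡ true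
      fwd (inj₁ e) h = ⊥-elim (h (from (Sat-↓⁻ κ {M} C (∁ (st x))) λ ℓ ℓ∈ e′ →
                         sat ℓ e e′ (others-true ℓ ℓ∈)))
      fwd (inj₂ e) h = e

  -- By `either-label` a label only says that the colour of the false literal lies outside of the
  -- leaf set, whichever alternative was chosen. So the choices at different nodes need no
  -- coordination, and the conditions reduce to the position of a single leaf in the tree.
  oneFalse-invariant :
    ∀ {C I} → (∀ ℓ → ℓ ∈ C → ∀ q → atom ℓ ≢ proxy q) →
    (∀ M (ρ : Semantics.Valuation M) → OneFalse M ρ C) →
    (∀ x → I x ≡ negate C ↓⁻ st x ⊎ I x ≡ ¬ᶠ (negate C ↓⁻ ∁ (st x))) → Invariant κ C I
  oneFalse-invariant {C} {I} noProxies one I≡ = record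
    { atRoot  = λ M 𝒯M ρ h → not-true (to (either-label I≡ (one M ρ) root) h) refl
    ; atLeaf  = λ p M 𝒯M ρ pre → from (either-label I≡ (one M ρ) (leafNode p)) (leaf-case p M ρ pre (one M ρ))
    ; atInner = λ {x} {y} {z} c M 𝒯M ρ hy hz → from (either-label I≡ (one M ρ) x)
        (inner c _ (to (either-label I≡ (one M ρ) y) hy) (to (either-label I≡ (one M ρ) z) hz))
    ; symbols = λ x f∈ → ⊥-elim (noSymb x f∈)
    ; vars    = vars′
    }
    where
    leaf-case : ∀ p M (ρ : Semantics.Valuation M) → Premise κ M p C ρ → (one : OneFalse M ρ C) →
                not (st (leafNode p) (colour (atom (proj₁ one)))) ≡ true
    leaf-case p M ρ pre (k , k∈ , false-k , _) with true? (st (leafNode p) (colour (atom k)))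
    ... | inj₁ e = ⊥-elim (false-k (Premise.negated pre k k∈ (st-leaf⁻ p _ e)))
    ... | inj₂ e = e

    inner : ∀ {x y z} → Children x y z → ∀ p → not (st y p) ≡ true → not (st z p) ≡ true →
            not (st x p) ≡ true
    inner {x} {y} {z} c p ey ez with st x p | st y p | st z p | st-split c p
    inner c p () ez | _ | _ | _ | left
    inner c p ey () | _ | _ | _ | right
    inner c p ey ez | _ | _ | _ | outside = refl

    noLit : ∀ A {f} → f ∉ symb (negate C ↓⁻ A)
    noLit A f∈ = let ℓ , ℓ∈ , _ , f∈ℓ = ↓⁻-symb κ C A f∈
                     q , a≡ , _ = flatten-symb (flip ℓ) f∈ℓ
                 in noProxies ℓ ℓ∈ q (≡.trans (≡.sym (atom-flip ℓ)) a≡)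

    noSymb : ∀ x {f} → f ∉ symb (I x)
    noSymb x f∈ with I x | I≡ x
    ... | _ | inj₁ refl = noLit (st x) f∈
    ... | _ | inj₂ refl = noLit (∁ (st x)) f∈

    vars′ : ∀ x → FreeVars (I x) ⊆ Supported C
    vars′ x u∈ with I x | I≡ x
    ... | _ | inj₁ refl = ↓⁻-vars κ C (st x) u∈
    ... | _ | inj₂ refl = ↓⁻-vars κ C (∁ (st x)) u∈

  Sat-≤ᵃ : ∀ {M : Structure} → let open Semantics M in {ρ : Valuation} → ∀ t u →
           Sat ρ [] (flattenAtom (t ≤ᵃ u)) ⇔ (ρ t ≤ ρ u)
  Sat-≤ᵃ {ρ = ρ} t u = ⇔-trans (≡⇒⇔ (≡.cong (_≤ 0ℚ) {y = ρ t + - ρ u} diff)) (mk⇔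
      (λ h → ≡.subst₂ _≤_ lhs (ℚ.+-identityˡ (ρ u)) (ℚ.+-monoˡ-≤ (ρ u) {ρ t + - ρ u} {0ℚ} h))
      (λ h → ≡.subst (ρ t + - ρ u ≤_) (ℚ.+-inverseʳ (ρ u)) (ℚ.+-monoˡ-≤ (- ρ u) {ρ t} {ρ u} h)))
    where
    diff : 1ℚ * ρ t + (- 1ℚ * ρ u + 0ℚ) ≡ ρ t + - ρ u
    diff = ≡.cong₂ _+_ (ℚ.*-identityˡ (ρ t)) (≡.trans (ℚ.+-identityʳ _)
             (≡.trans (≡.sym (ℚ.neg-distribˡ-* 1ℚ (ρ u))) (≡.cong -_ (ℚ.*-identityˡ (ρ u)))))
    lhs : ρ t + - ρ u + ρ u ≡ ρ t
    lhs = ≡.trans (ℚ.+-assoc (ρ t) (- ρ u) (ρ u))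
            (≡.trans (≡.cong (ρ t +_) (ℚ.+-inverseˡ (ρ u))) (ℚ.+-identityʳ (ρ t)))

  tri-oneFalse : ∀ t u M (ρ : Semantics.Valuation M) → OneFalse M ρ (triClause t u)
  tri-oneFalse t u M ρ with ℚ.<-cmp (ρ t) (ρ u)
  ... | tri≈ _ e _ = _ , here refl , (λ n → n λ k → k e) , λ
    { _ (here refl) → inj₁ refl
    ; _ (there (here refl)) → inj₂ (from (Sat-≤ᵃ {M} {ρ} t u) (ℚ.≤-reflexive e))
    ; _ (there (there (here refl))) → inj₂ (from (Sat-≤ᵃ {M} {ρ} u t) (ℚ.≤-reflexive (≡.sym e))) }
  ... | tri< l n _ = _ , there (there (here refl)) ,
    (λ h → ℚ.<-irrefl refl (ℚ.<-≤-trans l (to (Sat-≤ᵃ {M} {ρ} u t) h))) , λ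
    { _ (here refl) → inj₂ (λ k → k n)
    ; _ (there (here refl)) → inj₂ (from (Sat-≤ᵃ {M} {ρ} t u) (ℚ.<⇒≤ l))
    ; _ (there (there (here refl))) → inj₁ refl }
  ... | tri> _ n g = _ , there (here refl) ,
    (λ h → ℚ.<-irrefl refl (ℚ.<-≤-trans g (to (Sat-≤ᵃ {M} {ρ} t u) h))) , λ
    { _ (here refl) → inj₂ (λ k → k n)
    ; _ (there (here refl)) → inj₁ refl
    ; _ (there (there (here refl))) → inj₂ (from (Sat-≤ᵃ {M} {ρ} u t) (ℚ.<⇒≤ g)) }

  tri-invariant : ∀ {t u I} → let L = negate (triClause t u) in
                  (∀ x → I x ≡ L ↓⁻ st x ⊎ I x ≡ ¬ᶠ (L ↓⁻ ∁ (st x))) → Invariant κ (triClause t u) I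
  tri-invariant {t} {u} = oneFalse-invariant
    (λ { _ (here refl) q () ; _ (there (here refl)) q () ; _ (there (there (here refl))) q () })
    (tri-oneFalse t u)

-- Transitivity lemmas.

module Transitivity (Sg : Signature) (𝒯 : Logic.Theory Sg) (Q : Interpolation.Problem Sg 𝒯)
                    (κ : Interpolation.WithProblem.Colouring Sg 𝒯 Q) where
  open Logic Sg
  open Syntax Sg
  open Interpolation Sg 𝒯
  open Problem Q
  open WithProblem Q
  open Invariants Sg 𝒯 Q
  open Colouring κ
  open Algorithm κ

  -- The truth of a label, read off while walking along t₁, …, tₙ. The walk is
  -- outside of A (out), in a segment of A that began at a (in-seg a), or still in
  -- the segment of A that contains the closing literal (first).
  module Walk {s : Srt} {M : Structure} (ρ : Semantics.Valuation M) where
    open Semantics M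

    infix 4 _≐_
    _≐_ : Ground s → Ground s → Set
    t ≐ u = ¬ ¬ (ρ t ≡ ρ u)

    ≐-refl : ∀ {t} → t ≐ t
    ≐-refl n = n refl

    ≐-sym : ∀ {t u} → t ≐ u → u ≐ t
    ≐-sym e n = e (n ∘ ≡.sym)

    ≐-trans : ∀ {t u w} → t ≐ u → u ≐ w → t ≐ w
    ≐-trans e f n = e λ e → f λ f → n (≡.trans e f)

    -- How the walk may end: opened means that the closing literal is not in A,
    -- and closed x that it is in A and that the segment containing it ends at x.
    data End : Set where
      opened : End
      closed : Ground s → End

    endOut : End → Ground s → Set
    endOut opened     t = ⊤
    endOut (closed x) t = ¬ (t ≐ x)

    endIn : End → Ground s → Ground s → Set
    endIn opened     a t = a ≐ t
    endIn (closed x) a t = ¬ (a ≐ x)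

    Edge : Set
    Edge = Ground s → Ground s → Bool

    module _ (k : End) (e : Edge) where
      out    : Ground s → List (Ground s) → Set
      in-seg : Ground s → Ground s → List (Ground s) → Set
      out t []       = endOut k t
      out t (u ∷ us) = if e t u then in-seg t u us else out u us
      in-seg a t []       = endIn k a t
      in-seg a t (u ∷ us) = if e t u then in-seg a u us else a ≐ t × out u us

    -- The first boundary term ends the segment of the closing literal and becomes the parameter of
    -- `closed` for the rest of the walk. If there is none, the whole cycle is in `A` and the label
    -- is `⊥ᶠ`.
    first : Edge → Ground s → List (Ground s) → Set
    first e t []       = ⊥
    first e t (u ∷ us) = if e t u then first e u us else out (closed t) e u us

    Splits : (ex ey ez : Edge) → Set
    Splits ex ey ez = ∀ t u → Split (ex t u) (ey t u) (ez t u)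

    swapS : ∀ {ex ey ez} → Splits ex ey ez → Splits ex ez ey
    swapS sp t u = Split-sym (sp t u)

    -- Both children are walked simultaneously. No literal belongs to both, so at most one of them
    -- is inside a segment, and a segment of the parent is a chain of alternating segments of the
    -- children. The equation `b ≐ a` between the start of the parent's segment and the start of the
    -- child's current one is kept along the walk.
    merge-out : ∀ {ex ey ez} → Splits ex ey ez → ∀ t us →
                out opened ey t us → out opened ez t us → out opened ex t us
    merge-in  : ∀ {ex ey ez} → Splits ex ey ez → ∀ {a b} t us → b ≐ a →
                in-seg opened ey a t us → out opened ez t us → in-seg opened ex b t us
    merge-out sp t [] hy hz = tt
    merge-out {ex} {ey} {ez} sp t (u ∷ us) hy hz with ex t u | ey t u | ez t u | sp t u
    ... | _ | _ | _ | left    = merge-in sp u us ≐-refl hy hz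
    ... | _ | _ | _ | right   = merge-in (swapS sp) u us ≐-refl hz hy
    ... | _ | _ | _ | outside = merge-out sp u us hy hz
    merge-in sp t [] b≐a hy hz = ≐-trans b≐a hy
    merge-in {ex} {ey} {ez} sp t (u ∷ us) b≐a hy hz with ex t u | ey t u | ez t u | sp t u
    ... | _ | _ | _ | left    = merge-in sp u us b≐a hy hz
    ... | _ | _ | _ | right   = merge-in (swapS sp) u us (≐-trans b≐a (proj₁ hy)) hz (proj₂ hy)
    ... | _ | _ | _ | outside = ≐-trans b≐a (proj₁ hy) , merge-out sp u us (proj₂ hy) hz

    module _ {cx cy : Ground s} (cx≐cy : cx ≐ cy) where
      -- The closing literal belongs to the parent and to the child `y`. Their closing segments end
      -- at `cx` and `cy`; the parent's may run on through segments of the children, so these ends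
      -- are only equal in value. The suffix tells which child is inside a segment.
      close-out : ∀ {ex ey ez} → Splits ex ey ez → ∀ t us →
                  out (closed cy) ey t us → out opened ez t us → out (closed cx) ex t us
      close-iny : ∀ {ex ey ez} → Splits ex ey ez → ∀ {a b} t us → b ≐ a →
                  in-seg (closed cy) ey a t us → out opened ez t us → in-seg (closed cx) ex b t us
      close-inz : ∀ {ex ey ez} → Splits ex ey ez → ∀ {a b} t us → b ≐ a →
                  out (closed cy) ey t us → in-seg opened ez a t us → in-seg (closed cx) ex b t us
      close-out sp t [] hy hz = λ e → hy (≐-trans e cx≐cy)
      close-out {ex} {ey} {ez} sp t (u ∷ us) hy hz with ex t u | ey t u | ez t u | sp t u
      ... | _ | _ | _ | left    = close-iny sp u us ≐-refl hy hz
      ... | _ | _ | _ | right   = close-inz sp u us ≐-refl hy hz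
      ... | _ | _ | _ | outside = close-out sp u us hy hz
      close-iny sp t [] b≐a hy hz = λ e → hy (≐-trans (≐-sym b≐a) (≐-trans e cx≐cy))
      close-iny {ex} {ey} {ez} sp t (u ∷ us) b≐a hy hz with ex t u | ey t u | ez t u | sp t u
      ... | _ | _ | _ | left    = close-iny sp u us b≐a hy hz
      ... | _ | _ | _ | right   = close-inz sp u us (≐-trans b≐a (proj₁ hy)) (proj₂ hy) hz
      ... | _ | _ | _ | outside = ≐-trans b≐a (proj₁ hy) , close-out sp u us (proj₂ hy) hz
      close-inz sp t [] b≐a hy hz = λ e →
        hy (≐-trans (≐-sym hz) (≐-trans (≐-sym b≐a) (≐-trans e cx≐cy)))
      close-inz {ex} {ey} {ez} sp t (u ∷ us) b≐a hy hz with ex t u | ey t u | ez t u | sp t u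
      ... | _ | _ | _ | left    = close-iny sp u us (≐-trans b≐a (proj₁ hz)) hy (proj₂ hz)
      ... | _ | _ | _ | right   = close-inz sp u us b≐a hy hz
      ... | _ | _ | _ | outside = ≐-trans b≐a (proj₁ hz) , close-out sp u us hy (proj₂ hz)

    -- The parent is still in its closing segment, which the child `y` has already left at `c`. If
    -- the walk ends in this state, the parent contains the whole cycle, and the disequality in the
    -- label of `y` contradicts the equalities collected.
    first-iny : ∀ {ex ey ez c} → Splits ex ey ez → ∀ {a} t us → a ≐ c →
                in-seg (closed c) ey a t us → out opened ez t us → first ex t us
    first-inz : ∀ {ex ey ez c} → Splits ex ey ez → ∀ {a} t us → a ≐ c →
                out (closed c) ey t us → in-seg opened ez a t us → first ex t us
    first-iny sp t [] a≐c hy hz = hy a≐c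
    first-iny {ex} {ey} {ez} sp t (u ∷ us) a≐c hy hz with ex t u | ey t u | ez t u | sp t u
    ... | _ | _ | _ | left    = first-iny sp u us a≐c hy hz
    ... | _ | _ | _ | right   = first-inz sp u us (≐-trans (≐-sym (proj₁ hy)) a≐c) (proj₂ hy) hz
    ... | _ | _ | _ | outside =
      close-out (≐-trans (≐-sym (proj₁ hy)) a≐c) sp u us (proj₂ hy) hz
    first-inz sp t [] a≐c hy hz = hy (≐-trans (≐-sym hz) a≐c)
    first-inz {ex} {ey} {ez} sp t (u ∷ us) a≐c hy hz with ex t u | ey t u | ez t u | sp t u
    ... | _ | _ | _ | left    = first-iny sp u us (≐-trans (≐-sym (proj₁ hz)) a≐c) hy (proj₂ hz)
    ... | _ | _ | _ | right   = first-inz sp u us a≐c hy hz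
    ... | _ | _ | _ | outside =
      close-out (≐-trans (≐-sym (proj₁ hz)) a≐c) sp u us hy (proj₂ hz)

    merge-first : ∀ {ex ey ez} → Splits ex ey ez → ∀ t us →
                  first ey t us → out opened ez t us → first ex t us
    merge-first {ex} {ey} {ez} sp t (u ∷ us) hy hz with ex t u | ey t u | ez t u | sp t u
    ... | _ | _ | _ | left    = merge-first sp u us hy hz
    ... | _ | _ | _ | right   = first-inz sp u us ≐-refl hy hz
    ... | _ | _ | _ | outside = close-out ≐-refl sp u us hy hz

    Holds : Edge → Ground s → List (Ground s) → Set
    Holds e t []       = ⊤
    Holds e t (u ∷ us) = (e t u ≡ true → t ≐ u) × Holds e u us

    holds-out : ∀ {e} k t us → Holds e t us → endOut k (lastOf t us) →
                (∀ {a} → a ≐ lastOf t us → endIn k a (lastOf t us)) → out k e t us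
    holds-in  : ∀ {e} k {a} t us → a ≐ t → Holds e t us → endOut k (lastOf t us) →
                (∀ {a} → a ≐ lastOf t us → endIn k a (lastOf t us)) → in-seg k e a t us
    holds-out k t [] h o i = o
    holds-out {e} k t (u ∷ us) (h , hs) o i with e t u
    ... | true  = holds-in k u us (h refl) hs o i
    ... | false = holds-out k u us hs o i
    holds-in k t [] a≐t h o i = i a≐t
    holds-in {e} k t (u ∷ us) a≐t (h , hs) o i with e t u
    ... | true  = holds-in k u us (≐-trans a≐t (h refl)) hs o i
    ... | false = a≐t , holds-out k u us hs o i

    holds-first : ∀ {e t₁} t us → t₁ ≐ t → Holds e t us → ¬ (t₁ ≐ lastOf t us) → first e t us
    holds-first t [] t₁≐t h n = n t₁≐t
    holds-first {e} t (u ∷ us) t₁≐t (h , hs) n with e t u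
    ... | true  = holds-first u us (≐-trans t₁≐t (h refl)) hs n
    ... | false = holds-out (closed t) u us hs (λ e → n (≐-trans t₁≐t (≐-sym e)))
                    (λ a≐l e → n (≐-trans t₁≐t (≐-trans (≐-sym e) a≐l)))

    first-all : ∀ {e} → (∀ t u → e t u ≡ true) → ∀ t us → ¬ first e t us
    first-all all t (u ∷ us) h rewrite all t u = first-all all u us h

    module _ (A : PartSet tree) where
      edge : Edge
      edge t u = inside A (eq t u)

      private
        ⟪_⟫ : Form [] → Set
        ⟪_⟫ = Sat ρ []

      opened-out : ∀ t us → ⟪ ⋀ (pairs (boundary A false false t us)) ⟫ ⇔ out opened edge t us
      opened-in  : ∀ a t us → ⟪ ⋀ (pairs (a ∷ boundary A false true t us)) ⟫ ⇔ in-seg opened edge a t us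
      opened-out t []       = ⇔-refl
      opened-out t (u ∷ us) with inside A (eq t u)
      ... | true  = opened-in t u us
      ... | false = opened-out u us
      opened-in a t []       = mk⇔ proj₁ (_, tt)
      opened-in a t (u ∷ us) with inside A (eq t u)
      ... | true  = opened-in a u us
      ... | false = ⇔-refl ×-⇔ opened-out u us

      -- `y` is only a default for `lastOf`: outside of `A`, with the closing literal in `A`, the
      -- number of remaining boundary terms is odd, so the list is not empty.
      closed-out : ∀ x y t us → let ts = boundary A true false t us in
                   (⟪ ⋀ (pairs ts) ⟫ × ¬ (lastOf y ts ≐ x)) ⇔ out (closed x) edge t us
      closed-in  : ∀ x a t us → let ts = boundary A true true t us in
                   (⟪ ⋀ (pairs (a ∷ ts)) ⟫ × ¬ (lastOf a ts ≐ x)) ⇔ in-seg (closed x) edge a t us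
      closed-out x y t []       = mk⇔ proj₂ (tt ,_)
      closed-out x y t (u ∷ us) with inside A (eq t u)
      ... | true  = closed-in x t u us
      ... | false = closed-out x y u us
      closed-in x a t []       = mk⇔ proj₂ (tt ,_)
      closed-in x a t (u ∷ us) with inside A (eq t u)
      ... | true  = closed-in x a u us
      ... | false = ⇔-trans (mk⇔ (λ { ((h , hs) , n) → h , hs , n }) (λ { (h , hs , n) → (h , hs) , n }))
                            (⇔-refl ×-⇔ closed-out x t u us)

      cycle-opened : ∀ (ts : List (Ground s)) → cycleLabel false ts ≡ ⋀ (pairs ts)
      cycle-opened []       = refl
      cycle-opened (t ∷ ts) = refl

      cycle-closed : ∀ t us → ⟪ cycleLabel true (boundary A true true t us) ⟫ ⇔ first edge t us
      cycle-closed t []       = ⇔-refl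
      cycle-closed t (u ∷ us) with inside A (eq t u)
      ... | true  = cycle-closed u us
      ... | false = closed-out t t u us

      cycle-sem : Bool → Ground s → List (Ground s) → Set
      cycle-sem true  t us = first edge t us
      cycle-sem false t us = out opened edge t us

      Sat-cycle : ∀ c t us → ⟪ cycleLabel c (boundary A c c t us) ⟫ ⇔ cycle-sem c t us
      Sat-cycle true  t us = cycle-closed t us
      Sat-cycle false t us = ≡.subst (λ B → ⟪ B ⟫ ⇔ out opened edge t us)
        (≡.sym (cycle-opened (boundary A false false t us))) (opened-out t us)

  module _ {s : Srt} (t₁ t₂ : Ground s) (ts : List (Ground s)) where
    private
      C : Clause
      C = transClause t₁ t₂ ts

      closing : Atom []
      closing = eq t₁ (lastOf t₂ ts)

    closing∈ : ∀ t us → pos (eq t₁ (lastOf t us)) ∈ chain t₁ t us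
    closing∈ t []       = here refl
    closing∈ t (u ∷ us) = there (closing∈ u us)

    subterms⊆chain : ∀ t us → ∃[ ℓ ] ℓ ∈ chain t₁ t us × (s , t) ∈ atomSubterms (atom ℓ)
    subterms⊆chain t []       = _ , here refl , ∈-++⁺ʳ (subterms t₁) (subterms-self t)
    subterms⊆chain t (u ∷ us) = _ , here refl , ∈-++⁺ˡ (subterms-self t)

    chain-supported : ∀ t us {w} → w ∈ t ∷ us → Supported (chain t₁ t us) (s , w)
    chain-supported t us (here refl) = let ℓ , ℓ∈ , w∈ = subterms⊆chain t us in supported ℓ∈ w∈
    chain-supported t (u ∷ us) (there w∈) =
      ∈-++⁺ʳ (subterms t ++ subterms u) (chain-supported u us w∈)

    boundary⊆ : ∀ A c prev (t : Ground s) us → boundary A c prev t us ⊆ (_∈ t ∷ us)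
    boundary⊆ A c prev t [] w∈ with prev xor c | w∈
    ... | true  | here refl = here refl
    boundary⊆ A c prev t (u ∷ us) w∈ with prev xor inside A (eq t u) | w∈
    ... | true  | here refl = here refl
    ... | true  | there w∈′ = there (boundary⊆ A c _ u us w∈′)
    ... | false | w∈′       = there (boundary⊆ A c _ u us w∈′)

    pairs-vars : ∀ (us : List (Ground s)) → FreeVars (⋀ (pairs us)) ⊆ λ w → ∃[ u ] u ∈ us × w ≡ (s , u)
    pairs-vars (u ∷ u′ ∷ us) (here refl)         = _ , here refl , refl
    pairs-vars (u ∷ u′ ∷ us) (there (here refl)) = _ , there (here refl) , refl
    pairs-vars (u ∷ u′ ∷ us) (there (there w∈))  =
      let w , w∈us , e = pairs-vars us w∈ in w , there (there w∈us) , e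

    lastOf∈ : ∀ (u : Ground s) us → lastOf u us ∈ u ∷ us
    lastOf∈ u []        = here refl
    lastOf∈ u (u′ ∷ us) = there (lastOf∈ u′ us)

    cycle-vars : ∀ c (us : List (Ground s)) → FreeVars (cycleLabel c us) ⊆ λ w → ∃[ u ] u ∈ us × w ≡ (s , u)
    cycle-vars true  []       ()
    cycle-vars false []       ()
    cycle-vars false (u ∷ us) w∈ = pairs-vars (u ∷ us) w∈
    cycle-vars true  (u ∷ us) w∈ with ∈-++⁻ (FreeVars (⋀ (pairs us))) w∈
    ... | inj₁ w∈us = let w , w∈ , e = pairs-vars us w∈us in w , there w∈ , e
    ... | inj₂ (here refl)         = _ , lastOf∈ u us , refl
    ... | inj₂ (there (here refl)) = _ , here refl , refl

    pairs-symb : ∀ (us : List (Ground s)) {f} → f ∉ symb (⋀ (pairs us))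
    pairs-symb (u ∷ u′ ∷ us) f∈ = pairs-symb us f∈

    cycle-symb : ∀ c (us : List (Ground s)) {f} → f ∉ symb (cycleLabel c us)
    cycle-symb false (u ∷ us) f∈ = pairs-symb (u ∷ us) f∈
    cycle-symb true  (u ∷ us) f∈ with ∈-++⁻ (symb (⋀ (pairs us))) f∈
    ... | inj₁ f∈us = pairs-symb us f∈us

    trans-invariant : ∀ {I} → (∀ x → I x ≡ transLabel t₁ t₂ ts (st x)) → Invariant κ C I
    trans-invariant {I} I≡ = record
      { atRoot  = λ M 𝒯M ρ h → Walk.first-all {s} {M} ρ (λ _ _ → refl) t₁ (t₂ ∷ ts) (to (sem M ρ root) h)
      ; atLeaf  = λ p M 𝒯M ρ pre → from (sem M ρ (leafNode p)) (leaf-case p M ρ pre)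
      ; atInner = λ {x} {y} {z} c M 𝒯M ρ hy hz →
          from (sem M ρ x) (inner c M ρ (to (sem M ρ y) hy) (to (sem M ρ z) hz))
      ; symbols = λ x f∈ →
          ⊥-elim (cycle-symb (inside (st x) closing) _ (≡.subst (λ A → _ ∈ symb A) (I≡ x) f∈))
      ; vars    = λ x {u} u∈ → vars′ x (≡.subst (λ A → u ∈ FreeVars A) (I≡ x) u∈)
      }
      where
      Sem : ∀ M → Semantics.Valuation M → Node tree → Set
      Sem M ρ x = Walk.cycle-sem {s} {M} ρ (st x) (inside (st x) closing) t₁ (t₂ ∷ ts)

      sem : ∀ M (ρ : Semantics.Valuation M) x → Semantics.Sat M ρ [] (I x) ⇔ Sem M ρ x
      sem M ρ x = ⇔-trans (≡⇒⇔ (≡.cong (Semantics.Sat M ρ []) (I≡ x)))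
                          (Walk.Sat-cycle {s} {M} ρ (st x) (inside (st x) closing) t₁ (t₂ ∷ ts))

      vars′ : ∀ x → FreeVars (transLabel t₁ t₂ ts (st x)) ⊆ Supported C
      vars′ x u∈ =
        let c = inside (st x) closing
            w , w∈ , e = cycle-vars c (boundary (st x) c c t₁ (t₂ ∷ ts)) u∈
        in ≡.subst (Supported C) (≡.sym e)
             (chain-supported t₁ (t₂ ∷ ts) (boundary⊆ (st x) c c t₁ (t₂ ∷ ts) w∈))

      inner : ∀ {x y z} → Children x y z → ∀ M (ρ : Semantics.Valuation M) →
              Sem M ρ y → Sem M ρ z → Sem M ρ x
      inner {x} {y} {z} c M ρ hy hz
        with st x (colour closing) | st y (colour closing) | st z (colour closing) | st-split c (colour closing)
      ... | _ | _ | _ | left    = merge-first (λ t u → st-split c (colour (eq t u))) t₁ (t₂ ∷ ts) hy hz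
        where open Walk {s} {M} ρ
      ... | _ | _ | _ | right   =
        merge-first (λ t u → Split-sym (st-split c (colour (eq t u)))) t₁ (t₂ ∷ ts) hz hy
        where open Walk {s} {M} ρ
      ... | _ | _ | _ | outside = merge-out (λ t u → st-split c (colour (eq t u))) t₁ (t₂ ∷ ts) hy hz
        where open Walk {s} {M} ρ

      module _ (p : P) (M : Structure) (ρ : Semantics.Valuation M) (pre : Premise κ M p C ρ) where
        open Semantics M
        open Walk {s} {M} ρ

        holds : ∀ t us → (∀ ℓ → ℓ ∈ chain t₁ t us → ℓ ∈ C) → Holds (edge (st (leafNode p))) t us
        holds t []       sub = tt
        holds t (u ∷ us) sub =
          (λ e → Premise.negated pre _ (sub _ (here refl)) (st-leaf⁻ p _ e)) ,
          holds u us (λ ℓ ℓ∈ → sub ℓ (there ℓ∈))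

        leaf-case : Sem M ρ (leafNode p)
        leaf-case with st (leafNode p) (colour closing) in e
        ... | true  = holds-first t₁ (t₂ ∷ ts) ≐-refl (holds t₁ (t₂ ∷ ts) λ ℓ ℓ∈ → ℓ∈)
                        (Premise.negated pre _ (there (closing∈ t₂ ts)) (st-leaf⁻ p _ e))
        ... | false = holds-out opened t₁ (t₂ ∷ ts) (holds t₁ (t₂ ∷ ts) λ ℓ ℓ∈ → ℓ∈) tt id

-- Values of linear expressions.

exchange : ∀ a b c → a + (b + c) ≡ b + (a + c)
exchange = solve 3 (λ a b c → a :+ (b :+ c) := b :+ (a :+ c)) refl
  where open +-*-Solver

module Arithmetic (Sg : Signature) (M : Logic.Structure Sg) where
  open Logic Sg
  open Semantics M
  open Models Sg M

  module _ (ρ : Valuation) where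
    lin : Lin (_∈ []) → ℚ
    lin l = evalLin (env ρ []) (mapLin v l)

    lin-++ : ∀ l l′ → lin (l ++ l′) ≡ lin l + lin l′
    lin-++ []            l′ = ≡.sym (ℚ.+-identityˡ (lin l′))
    lin-++ ((c , t) ∷ l) l′ = ≡.trans (≡.cong (c * ρ t +_) (lin-++ l l′))
                                      (≡.sym (ℚ.+-assoc (c * ρ t) (lin l) (lin l′)))

    lin-scale : ∀ k l → lin (map (λ (c , t) → k * c , t) l) ≡ k * lin l
    lin-scale k []            = ≡.sym (ℚ.*-zeroʳ k)
    lin-scale k ((c , t) ∷ l) = ≡.trans
      (≡.cong₂ _+_ (ℚ.*-assoc k c (ρ t)) (lin-scale k l))
      (≡.sym (ℚ.*-distribˡ-+ k (c * ρ t) (lin l)))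

    lin-↭ : ∀ {l l′} → l ↭ l′ → lin l ≡ lin l′
    lin-↭ refl                         = refl
    lin-↭ (prep (c , t) p)             = ≡.cong (c * ρ t +_) (lin-↭ p)
    lin-↭ (swap {xs = l} (c , t) (d , u) p) = ≡.trans (exchange (c * ρ t) (d * ρ u) (lin l))
      (≡.cong (λ r → d * ρ u + (c * ρ t + r)) (lin-↭ p))
    lin-↭ (trans p q)                  = ≡.trans (lin-↭ p) (lin-↭ q)

    lin-filter : ∀ {P : ℚ × Ground rat → Set} (P? : ∀ x → Dec (P x)) l →
                 lin l ≡ lin (filter (λ x → ¬? (P? x)) l) + lin (filter P? l)
    lin-filter P? [] = refl
    lin-filter P? ((c , t) ∷ l) with P? (c , t)
    ... | yes _ = ≡.trans (≡.cong (c * ρ t +_) (lin-filter P? l))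
      (exchange (c * ρ t) (lin (filter (λ x → ¬? (P? x)) l)) (lin (filter P? l)))
    ... | no _  = ≡.trans (≡.cong (c * ρ t +_) (lin-filter P? l))
      (≡.sym (ℚ.+-assoc (c * ρ t) (lin (filter (λ x → ¬? (P? x)) l)) (lin (filter P? l))))

    Sat-≋ᵃ : ∀ {a b} → a ≋ᵃ b → Sat ρ [] (flattenAtom a) ⇔ Sat ρ [] (flattenAtom b)
    Sat-≋ᵃ refl = ⇔-refl
    Sat-≋ᵃ (arith {l} {l′} {c} k 0<k p) = ⇔-trans
      (mk⇔ (ℚ.*-monoˡ-≤-nonNeg k {{nonNegative (ℚ.<⇒≤ 0<k)}})
           (ℚ.*-cancelˡ-≤-pos k {{positive 0<k}}))
      (≡⇒⇔ (≡.cong (_≤ k * c) (≡.sym (≡.trans (lin-↭ p) (lin-scale k l)))))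

    Sat-≋ : ∀ {ℓ ℓ′} → ℓ ≋ ℓ′ → Sat ρ [] (flatten (flip ℓ)) ⇔ Sat ρ [] (flatten (flip ℓ′))
    Sat-≋ (pos e) = ¬-cong-⇔ (Sat-≋ᵃ e)
    Sat-≋ (neg e) = Sat-≋ᵃ e

-- Farkas lemmas.

module FarkasLemma (Sg : Signature) (𝒯 : Logic.Theory Sg) (Q : Interpolation.Problem Sg 𝒯)
                   (κ : Interpolation.WithProblem.Colouring Sg 𝒯 Q) where
  open Logic Sg
  open Syntax Sg
  open Interpolation Sg 𝒯
  open Problem Q
  open WithProblem Q
  open Invariants Sg 𝒯 Q
  open Colouring κ
  open Algorithm κ

  module _ {P : ℚ × Ground rat → Set} (P? : ∀ x → Dec (P x)) where
    coeff-filter : ∀ x l → (∀ {c} → P (c , x)) → coeff x (filter P? l) ≡ coeff x l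
    coeff-filter x []            px = refl
    coeff-filter x ((c , t) ∷ l) px with P? (c , t)
    ... | yes _ = ≡.cong (λ r → if does (x ≟tm t) then c + r else r) (coeff-filter x l px)
    ... | no n with x ≟tm t
    ...   | yes refl = ⊥-elim (n px)
    ...   | no _     = coeff-filter x l px

    coeff-filter-¬ : ∀ x l → (∀ {c} → ¬ P (c , x)) → coeff x (filter P? l) ≡ 0ℚ
    coeff-filter-¬ x []            npx = refl
    coeff-filter-¬ x ((c , t) ∷ l) npx with P? (c , t)
    ... | no _  = coeff-filter-¬ x l npx
    ... | yes p with x ≟tm t
    ...   | yes refl = ⊥-elim (npx p)
    ...   | no _     = coeff-filter-¬ x l npx

  module _ {M : Structure} (ρ : Semantics.Valuation M) where
    open Semantics M
    open Arithmetic Sg M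

    lin-single : ∀ t l → lin ρ (filter (λ (_ , u) → t ≟tm u) l) ≡ coeff t l * ρ t
    lin-single t []            = ≡.sym (ℚ.*-zeroˡ (ρ t))
    lin-single t ((c , u) ∷ l) with t ≟tm u
    ... | yes refl = ≡.trans (≡.cong (c * ρ t +_) (lin-single t l))
                         (≡.sym (ℚ.*-distribʳ-+ (ρ t) c (coeff t l)))
    ... | no _     = lin-single t l

    -- All summands with the same term as the first are split off together; they contribute their
    -- coefficient times the value of the term, which is zero. What remains is a filtered list
    -- rather than the tail, hence the induction on a bound of the length.
    lin-vanish : ∀ n l → length l ℕ.≤ n → (∀ x → coeff x l ≡ 0ℚ) → lin ρ l ≡ 0ℚ
    lin-vanish n         []            _ z = refl
    lin-vanish (ℕ.suc n) ((c , t) ∷ l) (ℕ.s≤s len) z = ≡.trans (lin-filter ρ t? ((c , t) ∷ l))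
      (≡.cong₂ _+_
        (lin-vanish n (filter (λ x → ¬? (t? x)) ((c , t) ∷ l)) shorter cleared)
        (≡.trans (lin-single t ((c , t) ∷ l)) (≡.trans (≡.cong (_* ρ t) (z t)) (ℚ.*-zeroˡ (ρ t)))))
      where
      t? : ∀ (x : ℚ × Ground rat) → Dec (t ≡ proj₂ x)
      t? (_ , u) = t ≟tm u
      shorter : length (filter (λ x → ¬? (t? x)) ((c , t) ∷ l)) ℕ.≤ n
      shorter with t ≟tm t
      ... | yes _ = ℕ.≤-trans (length-filter (λ x → ¬? (t? x)) l) len
      ... | no k  = ⊥-elim (k refl)
      cleared : ∀ x → coeff x (filter (λ x → ¬? (t? x)) ((c , t) ∷ l)) ≡ 0ℚ
      cleared x with t ≟tm x
      ... | yes refl = coeff-filter-¬ (λ x → ¬? (t? x)) x ((c , t) ∷ l) (λ k → k refl)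
      ... | no t≢x   = ≡.trans (coeff-filter (λ x → ¬? (t? x)) x ((c , t) ∷ l) t≢x) (z x)

    -- The removed summands by themselves form an expression all of whose coefficients are zero, so
    -- `lin-vanish` applies to them.
    lin-removeZero : ∀ l → lin ρ (removeZero l) ≡ lin ρ l
    lin-removeZero l = ≡.sym (≡.trans (lin-filter ρ zero? l)
      (≡.trans (≡.cong (lin ρ (removeZero l) +_) (lin-vanish _ (filter zero? l) ℕ.≤-refl vanishing))
               (ℚ.+-identityʳ (lin ρ (removeZero l)))))
      where
      zero? : ∀ (x : ℚ × Ground rat) → Dec (coeff (proj₂ x) l ≡ 0ℚ)
      zero? (_ , t) = coeff t l ℚ.≟ 0ℚ
      vanishing : ∀ x → coeff x (filter zero? l) ≡ 0ℚ
      vanishing x with coeff x l ℚ.≟ 0ℚ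
      ... | yes z = ≡.trans (coeff-filter zero? x l z) z
      ... | no nz = coeff-filter-¬ zero? x l nz

    total : List Weighted → ℚ
    total ws = lin ρ (combine ws)

    total-∷ : ∀ k l b ws → total (weighted k l b ∷ ws) ≡ k * lin ρ l + total ws
    total-∷ k l b ws = ≡.trans (lin-++ ρ (map (λ (c , t) → k * c , t) l) (combine ws))
                               (≡.cong (_+ total ws) (lin-scale ρ k l))

    module _ (ex ey ez : Weighted → Bool) (sp : ∀ w → Split (ex w) (ey w) (ez w)) where
      total-split : ∀ ws → total (filterᵇ ex ws) ≡ total (filterᵇ ey ws) + total (filterᵇ ez ws)
      total-split [] = refl
      total-split (w@(weighted k l b) ∷ ws) with ex w | ey w | ez w | sp w
      ... | _ | _ | _ | outside = total-split ws
      ... | _ | _ | _ | left    = ≡.trans (total-∷ k l b (filterᵇ ex ws)) (≡.trans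
        (≡.cong (k * lin ρ l +_) (total-split ws)) (≡.trans
        (≡.sym (ℚ.+-assoc (k * lin ρ l) (total (filterᵇ ey ws)) (total (filterᵇ ez ws))))
        (≡.cong (_+ total (filterᵇ ez ws)) (≡.sym (total-∷ k l b (filterᵇ ey ws))))))
      ... | _ | _ | _ | right   = ≡.trans (total-∷ k l b (filterᵇ ex ws)) (≡.trans
        (≡.cong (k * lin ρ l +_) (total-split ws)) (≡.trans
        (exchange (k * lin ρ l) (total (filterᵇ ey ws)) (total (filterᵇ ez ws)))
        (≡.cong (total (filterᵇ ey ws) +_) (≡.sym (total-∷ k l b (filterᵇ ez ws))))))

      bound-split : ∀ ws → bound (filterᵇ ex ws) ≡ bound (filterᵇ ey ws) + bound (filterᵇ ez ws)
      bound-split [] = refl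
      bound-split (w@(weighted k l b) ∷ ws) with ex w | ey w | ez w | sp w
      ... | _ | _ | _ | outside = bound-split ws
      ... | _ | _ | _ | left    = ≡.trans (≡.cong (k * b +_) (bound-split ws))
        (≡.sym (ℚ.+-assoc (k * b) (bound (filterᵇ ey ws)) (bound (filterᵇ ez ws))))
      ... | _ | _ | _ | right   = ≡.trans (≡.cong (k * b +_) (bound-split ws))
        (exchange (k * b) (bound (filterᵇ ey ws)) (bound (filterᵇ ez ws)))

    Bounded : List Weighted → Set
    Bounded ws = total ws ≤ bound ws

    bounded : ∀ ws e → All (λ w → 0ℚ < Weighted.k w) ws →
              (∀ w → w ∈ ws → e w ≡ true → Sat ρ [] (flattenAtom (ineq w))) → Bounded (filterᵇ e ws)
    bounded [] e [] h = ℚ.≤-refl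
    bounded (w@(weighted k l b) ∷ ws) e (0<k ∷ ks) h with e w in ew
    ... | false = bounded ws e ks λ w w∈ → h w (there w∈)
    ... | true  = ≡.subst (_≤ k * b + bound (filterᵇ e ws)) (≡.sym (total-∷ k l b (filterᵇ e ws)))
      (ℚ.+-mono-≤ (ℚ.*-monoˡ-≤-nonNeg k {{nonNegative (ℚ.<⇒≤ 0<k)}} (h w (here refl) ew))
                  (bounded ws e ks λ w w∈ → h w (there w∈)))

  all-filterᵇ : ∀ {X : Set} (e : X → Bool) xs → all e xs ≡ true → filterᵇ e xs ≡ xs
  all-filterᵇ e []       _ = refl
  all-filterᵇ e (x ∷ xs) h with e x
  ... | true = ≡.cong (x ∷_) (all-filterᵇ e xs h)

  -- Every label has the truth value of the summed inequality over the literals coloured in `A`.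
  -- This includes `⊥ᶠ`, since the sum over all literals states that zero is at most a negative
  -- number. Children are then merged by adding inequalities.
  farkas-invariant : ∀ {ws I} → Farkas ws → (∀ x → I x ≡ farkasLabel ws (st x)) →
                     Invariant κ (farkasClause ws) I
  farkas-invariant {ws} {I} fk I≡ = record
    { atRoot  = λ M 𝒯M ρ h → absurd M ρ
        (≡.subst (Bounded {M} ρ) (all-filterᵇ _ ws (all-true ws)) (to (sem M ρ root) h))
    ; atLeaf  = λ p M 𝒯M ρ pre → from (sem M ρ (leafNode p)) (bounded {M} ρ ws _ (Farkas.positive fk)
        λ w w∈ e → Premise.negated pre _ (∈-map⁺ (λ w → neg (ineq w)) w∈) (st-leaf⁻ p _ e))
    ; atInner = λ {x} {y} {z} c M 𝒯M ρ hy hz → from (sem M ρ x) (≡.subst₂ _≤_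
        (≡.sym (total-split {M} ρ _ _ _ (λ w → st-split c (colour (ineq w))) ws))
        (≡.sym (bound-split {M} ρ _ _ _ (λ w → st-split c (colour (ineq w))) ws))
        (ℚ.+-mono-≤ (to (sem M ρ y) hy) (to (sem M ρ z) hz)))
    ; symbols = λ x {f} f∈ → ⊥-elim (noSymb (st x) (≡.subst (λ A → f ∈ symb A) (I≡ x) f∈))
    ; vars    = λ x {u} u∈ → vars′ (st x) (≡.subst (λ A → u ∈ FreeVars A) (I≡ x) u∈)
    }
    where
    part : PartSet tree → List Weighted
    part A = filterᵇ (inside A ∘ ineq) ws

    all-true : ∀ (ws : List Weighted) → all (λ _ → true) ws ≡ true
    all-true []       = refl
    all-true (w ∷ ws) = all-true ws

    absurd : ∀ M (ρ : Semantics.Valuation M) → ¬ Bounded {M} ρ ws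
    absurd M ρ h = ℚ.<-irrefl refl (ℚ.≤-<-trans
      (≡.subst (_≤ bound ws) (lin-vanish {M} ρ _ (combine ws) ℕ.≤-refl (Farkas.cancels fk)) h)
      (Farkas.negative fk))

    sem : ∀ M (ρ : Semantics.Valuation M) x → Semantics.Sat M ρ [] (I x) ⇔ Bounded {M} ρ (part (st x))
    sem M ρ x with all (inside (st x) ∘ ineq) ws in e | I≡ x
    ... | true  | I≡x = mk⇔
      (λ h → ⊥-elim (≡.subst (Semantics.Sat M ρ []) I≡x h))
      (λ h → ⊥-elim (absurd M ρ (≡.subst (Bounded {M} ρ) (all-filterᵇ _ ws e) h)))
    ... | false | I≡x = ⇔-trans (≡⇒⇔ (≡.cong (Semantics.Sat M ρ []) I≡x))
      (≡⇒⇔ (≡.cong (_≤ bound (part (st x))) (lin-removeZero {M} ρ (combine (part (st x))))))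

    noSymb : ∀ A {f} → f ∉ symb (farkasLabel ws A)
    noSymb A f∈ with all (inside A ∘ ineq) ws
    ... | false = lin-symb (removeZero (combine (part A))) f∈

    combine-terms : ∀ (vs : List Weighted) {x} → x ∈ combine vs →
                    ∃[ w ] w ∈ vs × ∃[ c ] (c , proj₂ x) ∈ Weighted.lhs w
    combine-terms (w ∷ vs) x∈ with ∈-++⁻ (map (λ (c , t) → Weighted.k w * c , t) (Weighted.lhs w)) x∈
    ... | inj₂ x∈vs = let w′ , w′∈ , r = combine-terms vs x∈vs in w′ , there w′∈ , r
    ... | inj₁ x∈w with ∈-map⁻ (λ (c , t) → Weighted.k w * c , t) x∈w
    ...   | (c , t) , ct∈ , refl = w , here refl , c , ct∈

    vars′ : ∀ A → FreeVars (farkasLabel ws A) ⊆ Supported (farkasClause ws)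
    vars′ A u∈ with all (inside A ∘ ineq) ws
    ... | false with find (∈-concatMap⁻ (λ (_ , t) → subterms t) {xs = removeZero (combine (part A))}
                            (lin-vars (removeZero (combine (part A))) u∈))
    ...   | x , x∈ , u∈x with combine-terms (part A) (proj₁ (∈-filter⁻ _ {xs = combine (part A)} x∈))
    ...     | w , w∈ , c , ct∈ = supported
                (∈-map⁺ (λ w → neg (ineq w)) (proj₁ (∈-filter⁻ (T? ∘ inside A ∘ ineq) {xs = ws} w∈)))
                (∈-concatMap⁺ (λ (_ , t) → subterms t) (lose ct∈ u∈x))

-- Resolution: combination of labels and elimination of variables.

find-leaf : ∀ {t} {R : Leaf t → Set} → (∀ p → Dec (R p)) → (∃[ p ] R p) ⊎ (∀ p → ¬ R p)
find-leaf {leaf} R? with R? here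
... | yes r = inj₁ (here , r)
... | no n  = inj₂ λ { here → n }
find-leaf {node l r} R? with find-leaf (R? ∘ inl) | find-leaf (R? ∘ inr)
... | inj₁ (p , h) | _            = inj₁ (inl p , h)
... | inj₂ _       | inj₁ (p , h) = inj₁ (inr p , h)
... | inj₂ nl      | inj₂ nr      = inj₂ λ { (inl p) → nl p ; (inr p) → nr p }

module Resolution (Sg : Signature) (𝒯 : Logic.Theory Sg) (Q : Interpolation.Problem Sg 𝒯)
                  (κ : Interpolation.WithProblem.Colouring Sg 𝒯 Q) where
  open Logic Sg
  open Syntax Sg
  open Interpolation Sg 𝒯
  open Problem Q
  open WithProblem Q
  open Invariants Sg 𝒯 Q
  open Colouring κ
  open Algorithm κ

  -- A premise provides at least what a partial tree interpolant may assume at a leaf: the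
  -- flattening equations of `C` are among those of all terms.
  other-invariant : ∀ {C I} → IsPartialInterpolant C I → Invariant κ C I
  other-invariant {C} {I} J = record
    { atRoot  = λ M 𝒯M ρ → proj₁ (TreeInterpolant.atRoot J) M 𝒯M ρ
    ; atLeaf  = λ p M 𝒯M ρ pre → TreeInterpolant.atLeaf J p M 𝒯M ρ (Premise.inp pre , projection p M ρ pre)
    ; atInner = λ c M 𝒯M ρ hy hz → TreeInterpolant.atInner J c M 𝒯M ρ (hy , hz)
    ; symbols = TreeInterpolant.symbols J
    ; vars    = TreeInterpolant.vars J
    }
    where
    module _ (p : P) (M : Structure) (ρ : Semantics.Valuation M) (pre : Premise κ M p C ρ) where
      open Semantics M
      open Models Sg M

      kernel : ∀ ℓ → ℓ ∈ C → Sat ρ [] (flip ℓ ↓⁻ᵖ p)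
      kernel ℓ ℓ∈ with p ≟leaf colour (atom (flip ℓ))
      ... | yes refl = Premise.negated pre ℓ ℓ∈ (≡.sym (colour-flip κ ℓ))
      ... | no _     = tt

      equation : ∀ e → Belongs p e → Sat ρ [] (eqnForm e)
      equation (_ , app f ts) b n = n (Premise.def pre f ts (to (∈partitions⇔ f) b))

      projection : Sat ρ [] (negate C ↓ p)
      projection = from (Sat-⋀ _ (negate C)) λ ℓ′ ℓ′∈ → let ℓ , ℓ∈ , e = ∈-map⁻ flip ℓ′∈ in
        ≡.subst (λ ℓ′ → Sat ρ [] (ℓ′ ↓⁻ᵖ p)) (≡.sym e) (kernel ℓ ℓ∈) ,
        from (Sat-⋀ eqnForm _) λ e e∈ →
          equation e (proj₂ (∈-filter⁻ (belongs? p) {xs = FlatEQ ℓ′} e∈))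

  colour-≋ : ∀ {ℓ ℓ′} → ℓ ≋ ℓ′ → colour (atom ℓ) ≡ colour (atom ℓ′)
  colour-≋ (pos e) = sameColour e
  colour-≋ (neg e) = sameColour e

  module _ {M : Structure} {p : P} {ρ : Semantics.Valuation M} where
    open Semantics M
    open Models Sg M
    open Arithmetic Sg M

    -- Literals are matched up to reordering and rescaling of inequalities, which preserves colour
    -- and truth. The pivot has to be refuted only at the leaf of its colour.
    premise-⊑ : ∀ {ℓ C D D₁} → D₁ ⊑ (ℓ ∷ C) → C ⊑ D →
                (colour (atom ℓ) ≡ p → Sat ρ [] (flatten (flip ℓ))) →
                Premise κ M p D ρ → Premise κ M p D₁ ρ
    premise-⊑ {ℓ} {C} {D} D₁⊑ C⊑ pivot (premise def inp ngd) = premise def inp λ k k∈ e → lit k e (D₁⊑ k∈)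
      where
      lit : ∀ k → colour (atom k) ≡ p → ∃[ k′ ] k′ ∈ ℓ ∷ C × k ≋ k′ → Sat ρ [] (flatten (flip k))
      lit k e (_ , here refl , k≋) = from (Sat-≋ ρ k≋) (pivot (≡.trans (≡.sym (colour-≋ k≋)) e))
      lit k e (k′ , there k′∈ , k≋) = let k″ , k″∈ , k′≋ = C⊑ k′∈ in
        from (Sat-≋ ρ k≋) (from (Sat-≋ ρ k′≋) (ngd k″ k″∈
          (≡.trans (≡.sym (≡.trans (colour-≋ k≋) (colour-≋ k′≋))) e)))

    flip-flip : ∀ ℓ → ¬ Sat ρ [] (flatten (flip ℓ)) → Sat ρ [] (flatten (flip (flip ℓ)))
    flip-flip (pos a) h = Sat-stable (flattenAtom a) h
    flip-flip (neg a) h = h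

  combined : Literal [] → (I₁ I₂ : Node tree → Form []) → Node tree → Form []
  combined ℓ I₁ I₂ x = if inside (st x) (atom ℓ) then I₁ x ∨ᶠ I₂ x else I₁ x ∧ᶠ I₂ x

  combined-invariant :
    ∀ {ℓ C₁ C₂ D₁ D₂ D I₁ I₂} → D₁ ≈ (ℓ ∷ C₁) → D₂ ≈ (flip ℓ ∷ C₂) → D ≈ (C₁ ++ C₂) →
    Invariant κ D₁ I₁ → Invariant κ D₂ I₂ →
    Invariant′ κ D (λ u → Supported D₁ u ⊎ Supported D₂ u) (combined ℓ I₁ I₂)
  combined-invariant {ℓ} {C₁} {C₂} {D₁} {D₂} {D} {I₁} {I₂} (D₁⊑ , _) (D₂⊑ , _) (_ , C⊑) inv₁ inv₂ = record
    { atRoot  = λ M 𝒯M ρ h → h (Invariant′.atRoot inv₁ M 𝒯M ρ , Invariant′.atRoot inv₂ M 𝒯M ρ)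
    ; atLeaf  = leaf-case
    ; atInner = inner
    ; symbols = symbols′
    ; vars    = vars′
    }
    where
    leaf-case : ∀ p M → 𝒯 M → let open Semantics M in (ρ : Valuation) →
                Premise κ M p D ρ → Sat ρ [] (combined ℓ I₁ I₂ (leafNode p))
    leaf-case p M 𝒯M ρ pre with st (leafNode p) (colour (atom ℓ)) in e
    -- A cut on the pivot: if the first label fails, then the negation of `ℓ` cannot hold, so by
    -- stability `ℓ` holds, which completes the premise of the second label.
    ... | true = λ (n₁ , n₂) →
      n₂ (Invariant′.atLeaf inv₂ p M 𝒯M ρ (premise-⊑ {M} {p} D₂⊑ (C⊑ ∘ ∈-++⁺ʳ C₁)
        (λ _ → flip-flip {M} {p} ℓ λ h →
          n₁ (Invariant′.atLeaf inv₁ p M 𝒯M ρ (premise-⊑ {M} {p} D₁⊑ (C⊑ ∘ ∈-++⁺ˡ) (λ _ → h) pre)))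
        pre))
    ... | false =
      Invariant′.atLeaf inv₁ p M 𝒯M ρ (premise-⊑ {M} {p} D₁⊑ (C⊑ ∘ ∈-++⁺ˡ) (λ c → ⊥-elim (outer c)) pre) ,
      Invariant′.atLeaf inv₂ p M 𝒯M ρ (premise-⊑ {M} {p} D₂⊑ (C⊑ ∘ ∈-++⁺ʳ C₁)
        (λ c → ⊥-elim (outer (≡.trans (≡.sym (colour-flip κ ℓ)) c))) pre)
      where
      outer : colour (atom ℓ) ≢ p
      outer refl with () ← ≡.trans (≡.sym (st-leaf p)) e

    inner : ∀ {x y z} → Children x y z → ∀ M → 𝒯 M → let open Semantics M in (ρ : Valuation) →
            Sat ρ [] (combined ℓ I₁ I₂ y) → Sat ρ [] (combined ℓ I₁ I₂ z) → Sat ρ [] (combined ℓ I₁ I₂ x)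
    inner {x} {y} {z} c M 𝒯M ρ hy hz
      with st x (colour (atom ℓ)) | st y (colour (atom ℓ)) | st z (colour (atom ℓ)) | st-split c (colour (atom ℓ))
    ... | _ | _ | _ | left    = λ (n₁ , n₂) → hy
      ((λ h → n₁ (Invariant′.atInner inv₁ c M 𝒯M ρ h (proj₁ hz))) ,
       (λ h → n₂ (Invariant′.atInner inv₂ c M 𝒯M ρ h (proj₂ hz))))
    ... | _ | _ | _ | right   = λ (n₁ , n₂) → hz
      ((λ h → n₁ (Invariant′.atInner inv₁ c M 𝒯M ρ (proj₁ hy) h)) ,
       (λ h → n₂ (Invariant′.atInner inv₂ c M 𝒯M ρ (proj₂ hy) h)))
    ... | _ | _ | _ | outside =
      Invariant′.atInner inv₁ c M 𝒯M ρ (proj₁ hy) (proj₁ hz) ,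
      Invariant′.atInner inv₂ c M 𝒯M ρ (proj₂ hy) (proj₂ hz)

    symbols′ : ∀ x {f} → f ∈ symb (combined ℓ I₁ I₂ x) →
               (∃[ p ] T (st x p) × f ∈ symbF p) × (∃[ p ] T (∁ (st x) p) × f ∈ symbF p)
    symbols′ x f∈ with inside (st x) (atom ℓ)
    ... | true  with ∈-++⁻ (symb (I₁ x)) f∈
    ...   | inj₁ f∈₁ = Invariant′.symbols inv₁ x f∈₁
    ...   | inj₂ f∈₂ = Invariant′.symbols inv₂ x f∈₂
    symbols′ x f∈ | false with ∈-++⁻ (symb (I₁ x)) f∈
    ...   | inj₁ f∈₁ = Invariant′.symbols inv₁ x f∈₁
    ...   | inj₂ f∈₂ = Invariant′.symbols inv₂ x f∈₂

    vars′ : ∀ x → FreeVars (combined ℓ I₁ I₂ x) ⊆ λ u → Supported D₁ u ⊎ Supported D₂ u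
    vars′ x u∈ with inside (st x) (atom ℓ)
    ... | true  with ∈-++⁻ (FreeVars (I₁ x)) u∈
    ...   | inj₁ u∈₁ = inj₁ (Invariant′.vars inv₁ x u∈₁)
    ...   | inj₂ u∈₂ = inj₂ (Invariant′.vars inv₂ x u∈₂)
    vars′ x u∈ | false with ∈-++⁻ (FreeVars (I₁ x)) u∈
    ...   | inj₁ u∈₁ = inj₁ (Invariant′.vars inv₁ x u∈₁)
    ...   | inj₂ u∈₂ = inj₂ (Invariant′.vars inv₂ x u∈₂)

  module _ {as : List Srt} {s : Srt} (f : Op as s) where
    -- The side conditions of `Step`, separated from the resulting formula. They depend on `f` and
    -- `A` alone and one of them always holds, so a node whose label does not contain the variable
    -- has a kind as well.
    data Kind (A : PartSet tree) : Set where
      ex  : (∀ p → p ∈partitions f → T (A p)) → Kind A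
      univ : (∀ p → p ∈partitions f → ¬ T (A p)) → Kind A
      unf : ¬ (∀ p → p ∈partitions f → T (A p)) → ¬ (∀ p → p ∈partitions f → ¬ T (A p)) → Kind A

    inside? : ∀ (A : PartSet tree) → (∃[ p ] p ∈partitions f × T (A p)) ⊎ (∀ p → p ∈partitions f → ¬ T (A p))
    inside? A with find-leaf (λ p → (p ∈partitions? f) ×-dec T? (A p))
    ... | inj₁ h = inj₁ h
    ... | inj₂ n = inj₂ λ p p∈ a → n p (p∈ , a)

    outside? : ∀ (A : PartSet tree) → (∃[ p ] p ∈partitions f × T (∁ A p)) ⊎ (∀ p → p ∈partitions f → T (A p))
    outside? A with inside? (∁ A)
    ... | inj₁ h = inj₁ h
    ... | inj₂ n = inj₂ λ p p∈ → stable (A p) (n p p∈)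
      where
      stable : ∀ b → ¬ T (not b) → T b
      stable true  _ = tt
      stable false n = n tt

    kind : ∀ (A : PartSet tree) → Kind A
    kind A with outside? A | inside? A
    ... | inj₂ h           | _                 = ex h
    ... | inj₁ _           | inj₂ h            = univ h
    ... | inj₁ (p , p∈ , a) | inj₁ (q , q∈ , b) =
      unf (λ h → contra (A p) a (h p p∈)) (λ h → h q q∈ b)
      where
      contra : ∀ b → T (not b) → ¬ T b
      contra false _ ()

    -- `a₀` is the value of the right-hand side of the flattening equation; unfolding is
    -- instantiation at this value, which is the same at all nodes.
    Quantified : ∀ {A} → Kind A → {X : Set} → X → (X → Set) → Set
    Quantified (ex _)    a₀ φ = ¬ (∀ a → ¬ φ a)
    Quantified (univ _)   a₀ φ = ∀ a → φ a
    Quantified (unf _ _) a₀ φ = φ a₀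

    module _ (inhabited : ∃[ p ] p ∈partitions f) where
      -- As `A` is the disjoint union of `B` and `C`, only seven combinations of kinds are possible.
      -- At most one child is existential, and then the other is universal and accepts its witness;
      -- an unfolding child meets another unfolding one at the common `a₀` or a universal one. That
      -- `f` occurs in some partition excludes, for instance, two existential children, whose
      -- witnesses could differ.
      merge : ∀ {A B C : PartSet tree} → (∀ p → Split (A p) (B p) (C p)) →
              (kA : Kind A) (kB : Kind B) (kC : Kind C) →
              {X : Set} {a₀ : X} {φA φB φC : X → Set} → (∀ a → φB a → φC a → φA a) →
              Quantified kB a₀ φB → Quantified kC a₀ φC → Quantified kA a₀ φA
      merge {A} {B} {C} sp = go
        where
        p₀ : P
        p₀ = proj₁ inhabited
        p₀∈ : p₀ ∈partitions f
        p₀∈ = proj₂ inhabited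

        B⊆A : ∀ p → T (B p) → T (A p)
        B⊆A p b with A p | B p | C p | sp p
        ... | _ | _ | _ | left = tt
        C⊆A : ∀ p → T (C p) → T (A p)
        C⊆A p c with A p | B p | C p | sp p
        ... | _ | _ | _ | right = tt
        disjoint : ∀ p → T (B p) → ¬ T (C p)
        disjoint p b c with A p | B p | C p | sp p
        disjoint p b () | _ | _ | _ | left
        A∖B : ∀ p → T (A p) → ¬ T (B p) → T (C p)
        A∖B p a nb with A p | B p | C p | sp p
        ... | _ | _ | _ | left    = ⊥-elim (nb tt)
        ... | _ | _ | _ | right   = tt
        A∖C : ∀ p → T (A p) → ¬ T (C p) → T (B p)
        A∖C p a nc with A p | B p | C p | sp p
        ... | _ | _ | _ | left    = tt
        ... | _ | _ | _ | right   = ⊥-elim (nc tt)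

        go : (kA : Kind A) (kB : Kind B) (kC : Kind C) →
             {X : Set} {a₀ : X} {φA φB φC : X → Set} → (∀ a → φB a → φC a → φA a) →
             Quantified kB a₀ φB → Quantified kC a₀ φC → Quantified kA a₀ φA
        go _          (ex b)     (ex c)     i hb hc = ⊥-elim (disjoint p₀ (b p₀ p₀∈) (c p₀ p₀∈))
        go _          (ex b)     (unf _ c)  i hb hc = ⊥-elim (c λ p p∈ → disjoint p (b p p∈))
        go _          (unf _ b)  (ex c)     i hb hc = ⊥-elim (b λ p p∈ h → disjoint p h (c p p∈))
        go (ex _)     (ex b)     (univ c)   i hb hc n = hb λ a h → n a (i a h (hc a))
        go (univ k)   (ex b)     (univ c)   i hb hc = ⊥-elim (k p₀ p₀∈ (B⊆A p₀ (b p₀ p₀∈)))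
        go (unf k _)  (ex b)     (univ c)   i hb hc = ⊥-elim (k λ p p∈ → B⊆A p (b p p∈))
        go (ex _)     (univ b)   (ex c)     i hb hc n = hc λ a h → n a (i a (hb a) h)
        go (univ k)   (univ b)   (ex c)     i hb hc = ⊥-elim (k p₀ p₀∈ (C⊆A p₀ (c p₀ p₀∈)))
        go (unf k _)  (univ b)   (ex c)     i hb hc = ⊥-elim (k λ p p∈ → C⊆A p (c p p∈))
        go (ex k)     (univ b)   (univ c)   i hb hc =
          ⊥-elim (c p₀ p₀∈ (A∖B p₀ (k p₀ p₀∈) (b p₀ p₀∈)))
        go (univ k)   (univ b)   (univ c)   i hb hc a = i a (hb a) (hc a)
        go (unf _ k)  (univ b)   (univ c)   i hb hc =
          ⊥-elim (k λ p p∈ a → c p p∈ (A∖B p a (b p p∈)))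
        go (ex k)     (univ b)   (unf c _)  i hb hc = ⊥-elim (c λ p p∈ → A∖B p (k p p∈) (b p p∈))
        go (univ k)   (univ b)   (unf _ c)  i hb hc = ⊥-elim (c λ p p∈ h → k p p∈ (C⊆A p h))
        go (unf _ _)  (univ b)   (unf _ _)  i hb hc = i _ (hb _) hc
        go (ex k)     (unf b _)  (univ c)   i hb hc = ⊥-elim (b λ p p∈ → A∖C p (k p p∈) (c p p∈))
        go (univ k)   (unf _ b)  (univ c)   i hb hc = ⊥-elim (b λ p p∈ h → k p p∈ (B⊆A p h))
        go (unf _ _)  (unf _ _)  (univ c)   i hb hc = i _ hb (hc _)
        go (ex _)     (unf _ _)  (unf _ _)  i hb hc n = n _ (i _ hb hc)
        go (univ k)   (unf _ b)  (unf _ _)  i hb hc = ⊥-elim (b λ p p∈ h → k p p∈ (B⊆A p h))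
        go (unf _ _)  (unf _ _)  (unf _ _)  i hb hc = i _ hb hc

  Eliminates : ∀ {as s} (f : Op as s) (ts : All Ground as) {A : PartSet tree} → Kind f A →
               (I I′ : Form []) → Set₁
  Eliminates f ts k I I′ = ∀ M → let open Semantics M in (ρ : Valuation) →
    Sat ρ [] I′ ⇔ Quantified f k (⟦op⟧ f (evals (env ρ []) (vs ts)))
                    (λ a → Sat (Models.upd Sg M ρ (app f ts) a) [] I)

  step-eliminates : ∀ {A I I′ as s} {f : Op as s} {ts} → Step A I (s , app f ts) I′ →
                    Σ (Kind f A) λ k → Eliminates f ts k I I′
  step-eliminates {I = I} {s = s} {f} {ts} (exists h) = ex h , λ M ρ → let open Models Sg M in
    ¬-cong-⇔ (Π-⇔ λ a → ¬-cong-⇔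
      (⇔-sym (Sat-replace {ρ} {s ∷ []} {a ∷ []} (app f ts) (var (bnd (here refl))) I)))
  step-eliminates {I = I} {s = s} {f} {ts} (forAll h) = univ h , λ M ρ → let open Models Sg M in
    Π-⇔ λ a → ⇔-sym (Sat-replace {ρ} {s ∷ []} {a ∷ []} (app f ts) (var (bnd (here refl))) I)
  step-eliminates {I = I} {f = f} {ts} (unfold h h′) = unf h h′ , λ M ρ → let open Models Sg M in
    ⇔-sym (Sat-replace {ρ} {[]} {[]} (app f ts) (app f (vs ts)) I)

  -- Hence a node that skips v_t can be merged with nodes that do not.
  ∉-eliminates : ∀ {I as s} {f : Op as s} {ts A} (k : Kind f A) → (s , app f ts) ∉ FreeVars I →
                 Eliminates f ts k I I
  ∉-eliminates {I} {f = f} {ts} (ex _) u∉ M ρ = let open Models Sg M in mk⇔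
    (λ h n → n (ρ (app f ts)) (from (Sat-upd-∉ ρ (app f ts) _ I u∉) h))
    (λ h → Sat-stable I λ n → h λ a k → n (to (Sat-upd-∉ ρ (app f ts) a I u∉) k))
  ∉-eliminates {I} {f = f} {ts} (univ _) u∉ M ρ = let open Models Sg M in mk⇔
    (λ h a → from (Sat-upd-∉ ρ (app f ts) a I u∉) h)
    (λ h → to (Sat-upd-∉ ρ (app f ts) _ I u∉) (h (ρ (app f ts))))
  ∉-eliminates {I} {f = f} {ts} (unf _ _) u∉ M ρ = let open Models Sg M in
    ⇔-sym (Sat-upd-∉ ρ (app f ts) _ I u∉)

  -- One round of the elimination. The order is shared, so the round for `u` takes place at all
  -- nodes at once, some of which may have nothing to do.
  data Move (A : PartSet tree) (Un : Var → Set) (u : Var) (I : Form []) : Form [] → Set where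
    stay : u ∉ FreeVars I → Move A Un u I I
    act  : ∀ {I′} → Un u → Step A I u I′ → Move A Un u I I′

  uncons : ∀ {A Un u us I J} → Elim A Un (u ∷ us) I J → ∃[ I′ ] Move A Un u I I′ × Elim A Un us I′ J
  uncons (skip u∉ e)     = _ , stay u∉ , e
  uncons (step _ d _ s e) = _ , act d s , e

  move-eliminates : ∀ {A Un I I′ as s} {f : Op as s} {ts} → Move A Un (s , app f ts) I I′ →
                    Σ (Kind f A) λ k → Eliminates f ts k I I′
  move-eliminates {A} {I = I} {f = f} (stay u∉) = kind f A , ∉-eliminates {I} (kind f A) u∉
  move-eliminates         (act _ s)  = step-eliminates s

  Inner : Form [] → Form [] → Form [] → Set₁
  Inner I J K = ∀ M → 𝒯 M → let open Semantics M in (ρ : Valuation) →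
                Sat ρ [] J → Sat ρ [] K → Sat ρ [] I

  Inhabited : Var → Set
  Inhabited (_ , app f _) = ∃[ p ] p ∈partitions f

  module _ {A B C : PartSet tree} (sp : ∀ p → Split (A p) (B p) (C p))
           {Un : Var → Set} (inhabited : ∀ u → Un u → Inhabited u) where
    merge-moves : ∀ {u I I′ J J′ K K′} → Inhabited u →
                  Move A Un u I I′ → Move B Un u J J′ → Move C Un u K K′ → Inner I J K → Inner I′ J′ K′
    merge-moves {_ , app f ts} inh mA mB mC i M 𝒯M ρ hB hC =
      let kA , eA = move-eliminates mA
          kB , eB = move-eliminates mB
          kC , eC = move-eliminates mC
      in from (eA M ρ) (merge f inh sp kA kB kC (λ a → i M 𝒯M (Models.upd Sg M ρ (app f ts) a))
                          (to (eB M ρ) hB) (to (eC M ρ) hC))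

    inner-move : ∀ {u I I′ J J′ K K′} →
                 Move A Un u I I′ → Move B Un u J J′ → Move C Un u K K′ → Inner I J K → Inner I′ J′ K′
    inner-move (stay _) (stay _) (stay _) i = i
    inner-move {u} m@(act d _) n o i = merge-moves (inhabited u d) m n o i
    inner-move {u} m n@(act d _) o i = merge-moves (inhabited u d) m n o i
    inner-move {u} m n o@(act d _) i = merge-moves (inhabited u d) m n o i

    inner-elim : ∀ us {I I′ J J′ K K′} → Elim A Un us I I′ → Elim B Un us J J′ → Elim C Un us K K′ →
                 Inner I J K → Inner I′ J′ K′
    inner-elim []       (done _) (done _) (done _) i = i
    inner-elim (u ∷ us) eA eB eC i =
      let _ , mA , eA′ = uncons eA
          _ , mB , eB′ = uncons eB
          _ , mC , eC′ = uncons eC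
      in inner-elim us eA′ eB′ eC′ (inner-move mA mB mC i)

  root-elim : ∀ {A Un us I J} → Elim A Un us I J →
              (∀ M → 𝒯 M → let open Semantics M in (ρ : Valuation) → ¬ Sat ρ [] I) →
              (∀ M → 𝒯 M → let open Semantics M in (ρ : Valuation) → ¬ Sat ρ [] J)
  root-elim (done _)          r = r
  root-elim (skip _ e)        r = root-elim e r
  root-elim {us = (_ , app f ts) ∷ _} {I} (step _ _ _ s e) r = root-elim e λ M 𝒯M ρ h →
    let k , el = step-eliminates s in refute M 𝒯M ρ k (to (el M ρ) h)
    where
    refute : ∀ M → 𝒯 M → let open Semantics M in (ρ : Valuation) → ∀ {A} (k : Kind f A) →
             ¬ Quantified f k (⟦op⟧ f (evals (env ρ []) (vs ts)))
                 (λ a → Sat (Models.upd Sg M ρ (app f ts) a) [] I)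
    refute M 𝒯M ρ (ex _)    h = h λ a → r M 𝒯M _
    refute M 𝒯M ρ (univ _)   h = r M 𝒯M _ (h (ρ (app f ts)))
    refute M 𝒯M ρ (unf _ _) h = r M 𝒯M _ h

  module _ (p : P) (D : Clause) where
    Leafwise : Form [] → Set₁
    Leafwise I = ∀ M → 𝒯 M → let open Semantics M in (ρ : Valuation) → Premise κ M p D ρ → Sat ρ [] I

    module _ {as s} {f : Op as s} {ts : All Ground as} (unsupp : ¬ Supported D (s , app f ts)) where
      private
        u : Var
        u = s , app f ts

      -- The equation of `u` is not among those assumed at `p`. The literals of `D` contain no
      -- superterm of `u`, since otherwise `u` would be supported by `D`, so they keep their truth
      -- value; the input formulas are closed.
      premise-redef : ¬ (p ∈partitions f) → ∀ M (ρ : Semantics.Valuation M) a → Premise κ M p D ρ →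
                      Premise κ M p D (Models.redef Sg M ρ (app f ts) a)
      premise-redef p∉f M ρ a (premise def inp ngd) = premise
        (λ g us g⊆ → redef-def ρ (app f ts) a g us
          (λ { refl → p∉f (from (∈partitions⇔ f) g⊆) }) (def g us g⊆))
        (to (Sat-agree {ρ} {redef ρ (app f ts) a} (partForm (F p))
              λ w∈ → ⊥-elim (partForm-closed (F p) w∈)) inp)
        λ ℓ ℓ∈ e → to (Sat-agree {ρ} {redef ρ (app f ts) a} (flatten (flip ℓ)) λ {(_ , w)} w∈ →
          ≡.sym (redef-other ρ (app f ts) a w λ u∈ →
            unsupp (supported-trans D (supported ℓ∈
              (≡.subst (λ b → _ ∈ atomSubterms b) (atom-flip ℓ) (flatten-vars (flip ℓ) w∈))) u∈)))
          (ngd ℓ ℓ∈ e)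
        where
        open Semantics M
        open Models Sg M

      -- The quantifier speaks of `upd`, but it is `redef` that preserves the premise. They can
      -- differ only at proper superterms of `u`, none of which is a variable of `I`.
      outermost-agree : ∀ {I} → Outermost I u → ∀ M (ρ : Semantics.Valuation M) a →
                        Models.Agree Sg M (FreeVars I) (Models.redef Sg M ρ (app f ts) a)
                                                       (Models.upd Sg M ρ (app f ts) a)
      outermost-agree o M ρ a {r , w} w∈ with u ≟var (r , w)
      ... | yes refl = ≡.trans (redef-self ρ (app f ts) a) (≡.sym (upd-self ρ (app f ts) a))
        where open Models Sg M
      ... | no n = ≡.trans (redef-other ρ (app f ts) a w no-subterm) (≡.sym (upd-other ρ (app f ts) a w n))
        where
        open Models Sg M
        no-subterm : u ∉ subterms w
        no-subterm u∈ with subterms⇒rhs w u∈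
        ... | inj₁ e             = n e
        ... | inj₂ (e , e∈ , u∈e) = o w∈ e∈ u∈e

      leaf-step : ∀ {I I′} → Outermost I u → Step (st (leafNode p)) I u I′ → Leafwise I → Leafwise I′
      leaf-step {I} o s h M 𝒯M ρ pre = let k , el = step-eliminates s in from (el M ρ) (quantify k)
        where
        open Semantics M
        open Models Sg M
        keep : ∀ a → a ≡ ρ (app f ts) → Sat (upd ρ (app f ts) a) [] I
        keep a refl = to (Sat-agree {ρ} {upd ρ (app f ts) a} I λ {(r , w)} _ → same r w) (h M 𝒯M ρ pre)
          where
          same : ∀ r (w : Ground r) → ρ w ≡ upd ρ (app f ts) a w
          same r w with u ≟var (r , w)
          ... | yes refl = ≡.sym (upd-self ρ (app f ts) a)
          ... | no n     = ≡.sym (upd-other ρ (app f ts) a w n)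
        quantify : (k : Kind f (st (leafNode p))) →
                   Quantified f k (⟦op⟧ f (evals (env ρ []) (vs ts))) (λ a → Sat (upd ρ (app f ts) a) [] I)
        quantify (ex _) n = n (ρ (app f ts)) (keep _ refl)
        -- `p` lies in its own leaf set, so its formula does not contain `f`, and the premise
        -- survives an arbitrary value `a`.
        quantify (univ p∉) a = to (Sat-agree {redef ρ (app f ts) a} {upd ρ (app f ts) a} I
            (outermost-agree {I} o M ρ a))
          (h M 𝒯M _ (premise-redef (λ p∈ → p∉ p p∈ (from T-≡ (st-leaf p))) M ρ a pre))
        -- The leaf set consists of `p` alone, so a partition of `f` inside it can only be `p`;
        -- hence the flattening equation is available.
        quantify (unf _ p∈) with p ∈partitions? f
        ... | yes p∈f = keep _ (≡.sym (Premise.def pre f ts (to (∈partitions⇔ f) p∈f)))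
        ... | no p∉f  = ⊥-elim (p∈ λ q q∈ a → p∉f (≡.subst (_∈partitions f) (st-leaf⁻ p q (to T-≡ a)) q∈))

    leaf-elim : ∀ {Un us I J} → (∀ {u} → Un u → ¬ Supported D u) →
                Elim (st (leafNode p)) Un us I J → Leafwise I → Leafwise J
    leaf-elim unsupp (done _)   h = h
    leaf-elim unsupp (skip _ e) h = leaf-elim unsupp e h
    leaf-elim {us = (_ , app f ts) ∷ _} unsupp (step _ d o s e) h =
      leaf-elim unsupp e (leaf-step (unsupp d) o s h)

  replace-symb : ∀ {Γ s} (t : Ground s) (r : FTm Γ s) {R : Sym → Set} → symbTm r ⊆ R →
                 ∀ {s′} (x : FVar [] s′) → symbTm (replace t r x) ⊆ R
  replace-symb {s = s} t r h {s′} (free w) with s ≟srt s′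
  ... | no _     = λ ()
  ... | yes refl with does (t ≟tm w)
  ...   | true  = h
  ...   | false = λ ()

  replace-vars : ∀ {Γ s} (t : Ground s) (r : FTm Γ s) I {R : Var → Set} → freeTm r ⊆ R →
                 (∀ {w} → w ∈ FreeVars I → w ≢ (s , t) → R w) → FreeVars (I [v t ↦ r ]) ⊆ R
  replace-vars {Γ} {s} t r I {R} h k = FreeVars-subst (replace t r) (λ ()) I λ {(s′ , w)} → go s′ w
    where
    go : ∀ s′ (w : Ground s′) → (s′ , w) ∈ FreeVars I → freeTm (replace t r (free w)) ⊆ R
    go s′ w w∈ with s ≟srt s′
    ... | no s≢    = λ { (here refl) → k w∈ λ { refl → s≢ refl } }
    ... | yes refl with t ≟tm w
    ...   | yes refl = h
    ...   | no t≢    = λ { (here refl) → k w∈ λ { refl → t≢ refl } }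

  symbTms-vs : ∀ {Γ as} (ts : All Ground as) {f} → f ∉ symbTms (vs {Γ} ts)
  symbTms-vs (t ∷ ts) f∈ = symbTms-vs ts f∈

  Shared : PartSet tree → Sym → Set
  Shared A f = (∃[ p ] T (A p) × f ∈ symbF p) × (∃[ p ] T (∁ A p) × f ∈ symbF p)

  -- Unfolding is the only rule that adds a symbol. Its side conditions are negated universal
  -- statements, from which the search over the leaves extracts a partition of `f` inside and one
  -- outside of `A`.
  step-symb : ∀ {A I u I′} → Step A I u I′ → symb I ⊆ Shared A → symb I′ ⊆ Shared A
  step-symb {A} {I} (exists {f = f} {ts} _) h =
    symb-subst (replace (app f ts) _) (replace-symb (app f ts) _ {Shared A} (λ ())) I h
  step-symb {A} {I} (forAll {f = f} {ts} _) h =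
    symb-subst (replace (app f ts) _) (replace-symb (app f ts) _ {Shared A} (λ ())) I h
  step-symb {A} {I} (unfold {f = f} {ts} n n′) h =
    symb-subst (replace (app f ts) (app f (vs ts)))
      (replace-symb (app f ts) (app f (vs ts)) {Shared A} (⊆-++ shared (⊥-elim ∘ symbTms-vs ts))) I h
    where
    shared : symbOp f ⊆ Shared A
    shared g∈ with inside? f A | outside? f A
    ... | inj₂ k | _      = ⊥-elim (n′ k)
    ... | inj₁ _ | inj₂ k = ⊥-elim (n k)
    ... | inj₁ (p , p∈ , a) | inj₁ (q , q∈ , b) =
      (p , a , to (∈partitions⇔ f) p∈ g∈) , (q , b , to (∈partitions⇔ f) q∈ g∈)

  step-vars : ∀ {A I u I′ R} → Step A I u I′ → (∀ {w} → w ∈ FreeVars I → w ≢ u → R w) →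
              rhsVars u ⊆ R → FreeVars I′ ⊆ R
  step-vars {I = I} (exists {f = f} {ts} _)   h k = replace-vars (app f ts) _ I (λ ()) h
  step-vars {I = I} (forAll {f = f} {ts} _)   h k = replace-vars (app f ts) _ I (λ ()) h
  step-vars {I = I} (unfold {f = f} {ts} _ _) h k = replace-vars (app f ts) (app f (vs ts)) I k h

  elim-symb : ∀ {A Un us I J} → Elim A Un us I J → symb I ⊆ Shared A → symb J ⊆ Shared A
  elim-symb (done _)         h = h
  elim-symb (skip _ e)       h = elim-symb e h
  elim-symb (step _ _ _ s e) h = elim-symb e (step-symb s h)

  -- `R` is closed under arguments because unfolding puts the variables of the arguments in place of
  -- the eliminated one.
  elim-vars : ∀ {A Un us I J} {R : Var → Set} → (∀ {u} → R u → rhsVars u ⊆ R) →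
              Elim A Un us I J → FreeVars I ⊆ R → FreeVars J ⊆ λ u → R u × ¬ Un u
  elim-vars c (done n)          h u∈ = h u∈ , n u∈
  elim-vars c (skip _ e)        h = elim-vars c e h
  elim-vars c (step u∈ _ _ s e) h = elim-vars c e (step-vars s (λ w∈ _ → h w∈) (c (h u∈)))

-- Soundness of the labelling of a whole proof.

module Interpolants (Sg : Signature) (𝒯 : Logic.Theory Sg) (Q : Interpolation.Problem Sg 𝒯)
            (κ : Interpolation.WithProblem.Colouring Sg 𝒯 Q) where
  open Logic Sg
  open Syntax Sg
  open Interpolation Sg 𝒯
  open Problem Q
  open WithProblem Q
  open Invariants Sg 𝒯 Q
  open Colouring κ
  open Algorithm κ
  open Local Sg 𝒯 Q κ
  open Transitivity Sg 𝒯 Q κ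
  open FarkasLemma Sg 𝒯 Q κ
  open Resolution Sg 𝒯 Q κ

  root∈clauses : ∀ {C} (π : Proof C) → C ∈ clauses π
  root∈clauses (input p x)           = here refl
  root∈clauses (instan Δ φ σ)        = here refl
  root∈clauses (trans t₁ t₂ ts)      = here refl
  root∈clauses (cong f ts us)        = here refl
  root∈clauses (tri t u)             = here refl
  root∈clauses (farkas ws x)         = here refl
  root∈clauses (other _ x)           = here refl
  root∈clauses (res _ _ _ _ _ _ _ _) = here refl

  module _ {ℓ C₁ C₂ D₁ D₂ D e₁ e₂ e} {π₁ : Proof D₁} {π₂ : Proof D₂}
           (o : OverInput (res ℓ C₁ C₂ {D₁} {D₂} {D} e₁ e₂ e π₁ π₂)) where
    open OverInput o

    overInput₁ : OverInput π₁
    overInput₁ = record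
      { symbolsOccur   = λ D∈ → symbolsOccur (there (∈-++⁺ˡ D∈))
      ; proxiesCreated = λ D∈ → proxiesCreated (there (∈-++⁺ˡ D∈)) }

    overInput₂ : OverInput π₂
    overInput₂ = record
      { symbolsOccur   = λ D∈ → symbolsOccur (there (∈-++⁺ʳ (clauses π₁) D∈))
      ; proxiesCreated = λ D∈ → proxiesCreated (there (∈-++⁺ʳ (clauses π₁) D∈)) }

  subterm-symb  : ∀ {s as r} {f : Op as r} {us} (t : Ground s) → (r , app f us) ∈ subterms t →
                  symbOp f ⊆ (_∈ symbTm t)
  subterms-symb : ∀ {bs as r} {f : Op as r} {us} (ts : All Ground bs) → (r , app f us) ∈ subtermss ts →
                  symbOp f ⊆ (_∈ symbTms ts)
  subterm-symb (app f ts) (here refl) g∈ = ∈-++⁺ˡ g∈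
  subterm-symb (app f ts) (there u∈)  g∈ = ∈-++⁺ʳ (symbOp f) (subterms-symb ts u∈ g∈)
  subterms-symb (t ∷ ts) u∈ g∈ with ∈-++⁻ (subterms t) u∈
  ... | inj₁ u∈t  = ∈-++⁺ˡ (subterm-symb t u∈t g∈)
  ... | inj₂ u∈ts = ∈-++⁺ʳ (symbTm t) (subterms-symb ts u∈ts g∈)

  supported-symb : ∀ C {as s} {f : Op as s} {ts} → Supported C (s , app f ts) →
                   symbOp f ⊆ (_∈ symb (groundClause C))
  supported-symb (ℓ ∷ C) {f = f} {ts} u∈ g∈ with ∈-++⁻ (atomSubterms (atom ℓ)) u∈
  ... | inj₂ u∈C = ∈-++⁺ʳ (symb (litForm {[]} {[]} bnd ℓ)) (supported-symb C u∈C g∈)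
  ... | inj₁ u∈ℓ = ∈-++⁺ˡ (lit ℓ u∈ℓ)
    where
    ground : ∀ {s} → s ∈ [] → FTm [] s
    ground i = var (bnd i)
    atm : ∀ a → (_ , app f ts) ∈ atomSubterms a → _ ∈ symb (atomForm {[]} {[]} bnd a)
    atm (eq t u) u∈ with ∈-++⁻ (subterms t) u∈
    ... | inj₁ u∈t = ∈-++⁺ˡ (symbTm-bind⁺ ground t (subterm-symb t u∈t g∈))
    ... | inj₂ u∈u = ∈-++⁺ʳ (symbTm (bind ground t)) (symbTm-bind⁺ ground u (subterm-symb u u∈u g∈))
    atm (le l c) u∈ =
      let (_ , t) , t∈ , u∈t = find (∈-concatMap⁻ (λ (_ , t) → subterms t) {xs = l} u∈)
      in symbLin-bind⁺ ground l (∈-concatMap⁺ (λ (_ , t) → symbTm t) (lose t∈ (subterm-symb t u∈t g∈)))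
    lit : ∀ ℓ → (_ , app f ts) ∈ atomSubterms (atom ℓ) → _ ∈ symb (litForm {[]} {[]} bnd ℓ)
    lit (pos a) = atm a
    lit (neg a) = atm a

  supported-inhabited : ∀ {C} {π : Proof C} → OverInput π → ∀ {u} → Supported C u → Inhabited u
  supported-inhabited {C} {π} o {_ , app (un f) ts} u∈ =
    OverInput.symbolsOccur o (root∈clauses π) (supported-symb C u∈ (here refl))
  -- Interpreted functions belong to every partition; the colour of an arbitrary atom supplies one.
  supported-inhabited o {_ , app (th f) ts} u∈ = colour (le [] 0ℚ) , tt
  supported-inhabited o {_ , app (bi f) ts} u∈ = colour (le [] 0ℚ) , tt

  open DecMembership _≟var_ using (_∈?_)

  supported-rhs : ∀ C {u} → Supported C u → rhsVars u ⊆ Supported C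
  supported-rhs C {_ , app f ts} u∈ w∈ = supported-trans C u∈ (there (args⊆subtermss ts w∈))

  resolvent-invariant :
    ∀ {ℓ C₁ C₂ D₁ D₂ D us I₁ I₂ I} → D₁ ≈ (ℓ ∷ C₁) → D₂ ≈ (flip ℓ ∷ C₂) → D ≈ (C₁ ++ C₂) →
    (∀ u → Unsupported D₁ D₂ D u → Inhabited u) →
    Invariant κ D₁ I₁ → Invariant κ D₂ I₂ →
    (∀ x → Elim (st x) (Unsupported D₁ D₂ D) us (combined ℓ I₁ I₂ x) (I x)) →
    Invariant κ D I
  resolvent-invariant {ℓ} {D₁ = D₁} {D₂} {D} {us} {I₁} {I₂} {I} e₁ e₂ e inh inv₁ inv₂ E = record
    { atRoot  = root-elim (E root) (Invariant′.atRoot inv)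
    ; atLeaf  = λ p → leaf-elim p D proj₂ (E (leafNode p)) (Invariant′.atLeaf inv p)
    ; atInner = λ {x} {y} {z} c → inner-elim (st-split c) inh us (E x) (E y) (E z) (Invariant′.atInner inv c)
    ; symbols = λ x → elim-symb (E x) (Invariant′.symbols inv x)
    ; vars    = λ x {u} u∈ → still-supported u (elim-vars closed (E x) (Invariant′.vars inv x) u∈)
    }
    where
    inv : Invariant′ κ D (λ u → Supported D₁ u ⊎ Supported D₂ u) (combined ℓ I₁ I₂)
    inv = combined-invariant e₁ e₂ e inv₁ inv₂

    closed : ∀ {u} → Supported D₁ u ⊎ Supported D₂ u → rhsVars u ⊆ λ w → Supported D₁ w ⊎ Supported D₂ w
    closed (inj₁ u∈) w∈ = inj₁ (supported-rhs D₁ u∈ w∈)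
    closed (inj₂ u∈) w∈ = inj₂ (supported-rhs D₂ u∈ w∈)

    still-supported : ∀ u → (Supported D₁ u ⊎ Supported D₂ u) × ¬ Unsupported D₁ D₂ D u → Supported D u
    still-supported u (ok , n) = decidable-stable (u ∈? _) λ unsupp → n (ok , unsupp)

  sound : ∀ {C} {π : Proof C} {I} → OverInput π → Labels π I → Invariant κ C I
  sound o (input {m = m} I≡) = input-invariant m I≡
  sound o (instan {Δ} {φ} {σ} I≡) =
    let p , q∈ = OverInput.proxiesCreated o (here refl) (here refl)
    in instan-invariant {Δ} {φ} {σ} q∈ I≡
  sound o (trans {t₁ = t₁} {t₂} {ts} I≡) = trans-invariant t₁ t₂ ts I≡
  sound o (cong {f = f} {ts} {us} p p∈ I≡) = cong-invariant {f = f} {ts} {us} p∈ I≡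
  sound o (tri {t} {u} I≡) = tri-invariant {t} {u} I≡
  sound o (farkas {ws} {fk} I≡) = farkas-invariant fk I≡
  sound o (other J) = other-invariant J
  sound o (res {ℓ} {C₁} {C₂} {e₁ = e₁} {e₂} {e} us L₁ L₂ E) =
    resolvent-invariant e₁ e₂ e
      (λ { u (inj₁ u∈ , _) → supported-inhabited (overInput₁ o) u∈
         ; u (inj₂ u∈ , _) → supported-inhabited (overInput₂ o) u∈ })
      (sound (overInput₁ o) L₁) (sound (overInput₂ o) L₂) E

  -- The given `ρ` need not satisfy any flattening equation. As the empty clause supports no
  -- variable, the labels are closed, like the input formulas, and `ρ` can be exchanged for
  -- `canonical`.
  treeInterpolant : ∀ {I} → Invariant κ [] I → IsTreeInterpolant I
  treeInterpolant {I} inv = record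
    { atRoot  = Invariant′.atRoot inv , λ _ _ _ ()
    ; atLeaf  = λ p M 𝒯M ρ h → let open Models Sg M in
        to (Sat-agree {canonical} {ρ} (I (leafNode p)) λ u∈ → ⊥-elim (closed u∈))
          (Invariant′.atLeaf inv p M 𝒯M canonical (premise canonical-def
            (to (Sat-agree {ρ} {canonical} (partForm (F p)) λ u∈ → ⊥-elim (partForm-closed (F p) u∈)) h)
            (λ _ ())))
    ; atInner = λ c M 𝒯M ρ (hy , hz) → Invariant′.atInner inv c M 𝒯M ρ hy hz
    ; symbols = Invariant′.symbols inv
    ; vars    = λ x u∈ → closed u∈
    }
    where
    closed : ∀ {x u} → u ∉ FreeVars (I x)
    closed u∈ with () ← Invariant′.vars inv _ u∈

  -- Existence of a labelling: elimination by decreasing term size.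

  size  : ∀ {s} → Ground s → ℕ
  sizes : ∀ {as} → All Ground as → ℕ
  size (app f ts) = suc (sizes ts)
  sizes []       = 0
  sizes (t ∷ ts) = size t ℕ.+ sizes ts

  sizeᵛ : Var → ℕ
  sizeᵛ (_ , t) = size t

  arg-size : ∀ {as} (ts : All Ground as) {w} → w ∈ freeTms {[]} (vs ts) → sizeᵛ w ℕ.≤ sizes ts
  arg-size (t ∷ ts) (here refl) = ℕ.m≤m+n (size t) (sizes ts)
  arg-size (t ∷ ts) (there w∈)  = ℕ.≤-trans (arg-size ts w∈) (ℕ.m≤n+m (sizes ts) (size t))

  rhs-size : ∀ e {u} → u ∈ rhsVars e → sizeᵛ u ℕ.< sizeᵛ e
  rhs-size (_ , app f ts) u∈ = ℕ.s≤s (arg-size ts u∈)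

  subterm-size  : ∀ {s} (t : Ground s) {w} → w ∈ subterms t → sizeᵛ w ℕ.≤ size t
  subterms-size : ∀ {as} (ts : All Ground as) {w} → w ∈ subtermss ts → sizeᵛ w ℕ.≤ sizes ts
  subterm-size (app f ts) (here refl) = ℕ.≤-refl
  subterm-size (app f ts) (there w∈)  = ℕ.m≤n⇒m≤1+n (subterms-size ts w∈)
  subterms-size (t ∷ ts) w∈ with ∈-++⁻ (subterms t) w∈
  ... | inj₁ w∈t  = ℕ.≤-trans (subterm-size t w∈t) (ℕ.m≤m+n (size t) (sizes ts))
  ... | inj₂ w∈ts = ℕ.≤-trans (subterms-size ts w∈ts) (ℕ.m≤n+m (sizes ts) (size t))

  module Order (D₁ D₂ D : Clause) where
    Un Ok : Var → Set
    Un = Unsupported D₁ D₂ D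
    Ok u = Supported D₁ u ⊎ Supported D₂ u

    -- us is in order of decreasing size and contains all the smaller variables
    -- that may be introduced while its elements are being eliminated.
    Descending : List Var → Set
    Descending []       = ⊤
    Descending (u ∷ us) = (∀ w → w ∈ us → sizeᵛ w ℕ.≤ sizeᵛ u) ×
                          (∀ w → Un w → sizeᵛ w ℕ.< sizeᵛ u → w ∈ us) × Un u × Descending us

    some-step : ∀ A I u → ∃ (Step A I u)
    some-step A I (_ , app f ts) with kind f A
    ... | ex h     = _ , exists h
    ... | univ h   = _ , forAll h
    ... | unf h h′ = _ , unfold h h′

    rhs-ok : ∀ {u} → Ok u → rhsVars u ⊆ Ok
    rhs-ok (inj₁ u∈) w∈ = inj₁ (supported-rhs D₁ u∈ w∈)
    rhs-ok (inj₂ u∈) w∈ = inj₂ (supported-rhs D₂ u∈ w∈)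

    -- The head `u` is outermost: a variable of `I` with `u` as a proper subterm is larger than `u`.
    -- It is not supported by `D`, as `u` is not, so it would have to be in the list, where nothing
    -- exceeds `u`. Unfolding adds only smaller variables, and the unsupported ones among them are
    -- still ahead. A repeated entry is skipped at its second occurrence.
    eliminate : ∀ {A} us I → Descending us → (∀ w → w ∈ FreeVars I → Un w → w ∈ us) →
                FreeVars I ⊆ Ok → ∃ (Elim A Un us I)
    eliminate [] I _ unsupp ok = I , done λ u∈ un-u → case-[] (unsupp _ u∈ un-u)
      where
      case-[] : ∀ {u : Var} → ¬ (u ∈ [])
      case-[] ()
    eliminate {A} (u ∷ us) I (smaller , complete , un-u , desc) unsupp ok with u ∈? FreeVars I
    ... | no u∉ = let J , E = eliminate us I desc remaining ok in J , skip u∉ E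
      where
      remaining : ∀ w → w ∈ FreeVars I → Un w → w ∈ us
      remaining w w∈ un-w with unsupp w w∈ un-w
      ... | here refl = ⊥-elim (u∉ w∈)
      ... | there h   = h
    ... | yes u∈ =
      let I′ , s = some-step A I u
          J , E = eliminate us I′ desc
            (λ w → step-vars s (λ w∈ w≢u un-w → other-free w∈ w≢u (unsupp _ w∈ un-w))
                               (λ w∈ un-w → complete _ un-w (rhs-size u w∈)))
            (step-vars s (λ w∈ _ → ok w∈) (rhs-ok (proj₁ un-u)))
      in J , step u∈ un-u outermost s E
      where
      other-free : ∀ {w} → w ∈ FreeVars I → w ≢ u → w ∈ u ∷ us → w ∈ us
      other-free _ w≢u (here refl) = ⊥-elim (w≢u refl)
      other-free _ w≢u (there w∈)  = w∈
      outermost : Outermost I u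
      outermost {w} w∈ {e} e∈ u∈e with w ∈? concatMap (atomSubterms ∘ atom) D
      ... | yes supp = proj₂ un-u (supported-rhs D (supported-trans D supp e∈) u∈e)
      ... | no nsupp with unsupp w w∈ (ok w∈ , nsupp)
      ...   | here refl = ℕ.<-irrefl refl (ℕ.<-≤-trans (rhs-size e u∈e) (subterm-size (proj₂ w) e∈))
      ...   | there w∈us = ℕ.<-irrefl refl (ℕ.<-≤-trans (rhs-size e u∈e)
                (ℕ.≤-trans (subterm-size (proj₂ w) e∈) (smaller w w∈us)))

    unsupported : List Var
    unsupported = filter (λ u → ¬? (u ∈? concatMap (atomSubterms ∘ atom) D))
                    (concatMap (atomSubterms ∘ atom) D₁ ++ concatMap (atomSubterms ∘ atom) D₂)

    unsupported⁺ : ∀ {u} → Un u → u ∈ unsupported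
    unsupported⁺ (ok , n) = ∈-filter⁺ _ (∈-ok ok) n
      where
      ∈-ok : ∀ {u} → Ok u → u ∈ concatMap (atomSubterms ∘ atom) D₁ ++ concatMap (atomSubterms ∘ atom) D₂
      ∈-ok (inj₁ u∈) = ∈-++⁺ˡ u∈
      ∈-ok (inj₂ u∈) = ∈-++⁺ʳ _ u∈

    unsupported⁻ : ∀ {u} → u ∈ unsupported → Un u
    unsupported⁻ u∈ =
      let u∈′ , n = ∈-filter⁻ _
            {xs = concatMap (atomSubterms ∘ atom) D₁ ++ concatMap (atomSubterms ∘ atom) D₂} u∈
      in ∈-++⁻ (concatMap (atomSubterms ∘ atom) D₁) u∈′ , n

    -- A bucket sort by size. Within a level the order is arbitrary, since no term is a proper
    -- subterm of one of the same size.
    level order : ℕ → List Var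
    level n = filter (λ u → sizeᵛ u ℕ.≟ n) unsupported
    order zero    = level zero
    order (suc n) = level (suc n) ++ order n

    order⁺ : ∀ n {u} → Un u → sizeᵛ u ℕ.≤ n → u ∈ order n
    order⁺ zero    un-u s≤ = ∈-filter⁺ _ (unsupported⁺ un-u) (ℕ.n≤0⇒n≡0 s≤)
    order⁺ (suc n) {u} un-u s≤ with sizeᵛ u ℕ.≟ suc n
    ... | yes s≡ = ∈-++⁺ˡ (∈-filter⁺ _ (unsupported⁺ un-u) s≡)
    ... | no s≢  = ∈-++⁺ʳ (level (suc n)) (order⁺ n un-u (ℕ.≤-pred (ℕ.≤∧≢⇒< s≤ s≢)))

    level⁻ : ∀ n {u} → u ∈ level n → Un u × sizeᵛ u ≡ n
    level⁻ n u∈ = let u∈′ , s≡ = ∈-filter⁻ _ {xs = unsupported} u∈ in unsupported⁻ u∈′ , s≡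

    order-size : ∀ n {u} → u ∈ order n → sizeᵛ u ℕ.≤ n
    order-size zero    u∈ = ℕ.≤-reflexive (proj₂ (level⁻ zero u∈))
    order-size (suc n) u∈ with ∈-++⁻ (level (suc n)) u∈
    ... | inj₁ u∈l = ℕ.≤-reflexive (proj₂ (level⁻ (suc n) u∈l))
    ... | inj₂ u∈o = ℕ.m≤n⇒m≤1+n (order-size n u∈o)

    Descending-++ : ∀ n ks us → (∀ k → k ∈ ks → Un k × sizeᵛ k ≡ n) →
                    (∀ w → w ∈ us → sizeᵛ w ℕ.≤ n) → (∀ w → Un w → sizeᵛ w ℕ.< n → w ∈ us) →
                    Descending us → Descending (ks ++ us)
    Descending-++ n []       us lv small complete d = d
    Descending-++ n (k ∷ ks) us lv small complete d with lv k (here refl)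
    ... | un-k , refl =
      (λ w w∈ → le-k w (∈-++⁻ ks w∈)) ,
      (λ w un-w w< → ∈-++⁺ʳ ks (complete w un-w w<)) , un-k ,
      Descending-++ n ks us (λ k k∈ → lv k (there k∈)) small complete d
      where
      le-k : ∀ w → w ∈ ks ⊎ w ∈ us → sizeᵛ w ℕ.≤ n
      le-k w (inj₁ w∈) = ℕ.≤-reflexive (proj₂ (lv w (there w∈)))
      le-k w (inj₂ w∈) = small w w∈

    order-descending : ∀ n → Descending (order n)
    order-descending zero    = ≡.subst Descending (++-identityʳ (level zero))
      (Descending-++ zero (level zero) [] (λ k → level⁻ zero) (λ _ ()) (λ _ _ ()) tt)
    order-descending (suc n) = Descending-++ (suc n) (level (suc n)) (order n) (λ k → level⁻ (suc n))
      (λ w w∈ → ℕ.m≤n⇒m≤1+n (order-size n w∈)) (λ w un-w w< → order⁺ n un-w (ℕ.≤-pred w<)) (order-descending n)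

    elimination-order : List Var
    elimination-order = order (max 0 (map sizeᵛ unsupported))

    elimination : ∀ {A I} → FreeVars I ⊆ Ok → ∃ (Elim A Un elimination-order I)
    elimination {I = I} = eliminate elimination-order I (order-descending (max 0 (map sizeᵛ unsupported)))
      λ w _ un-w → order⁺ _ un-w
        (lookup (xs≤max 0 (map sizeᵛ unsupported)) (∈-map⁺ sizeᵛ (unsupported⁺ un-w)))

  -- At a resolution step the soundness of the labels obtained so far enters: it bounds their free
  -- variables by the supported ones, so that one list fixed in advance covers every node.
  labels : ∀ {C} (π : Proof C) → OverInput π →
           (∀ {C} → C ∈ others π → ∃[ J ] IsPartialInterpolant C J) → ∃[ I ] Labels π I
  labels (input p m)      o supplied = _ , input λ x → refl
  labels (instan Δ φ σ)   o supplied = _ , instan λ x → refl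
  labels (trans t₁ t₂ ts) o supplied = _ , trans λ x → refl
  labels (cong f ts us)   o supplied =
    -- The choice of `p_f`: the symbol `f` occurs in the congruence lemma, hence in some partition.
    let p , p∈ = OverInput.symbolsOccur o (here refl) (here refl) in _ , cong p p∈ λ x → refl
  labels (tri t u)        o supplied = _ , tri λ x → inj₁ refl
  labels (farkas ws fk)   o supplied = _ , farkas λ x → refl
  labels (other C valid)  o supplied = let J , h = supplied (here refl) in J , other h
  labels (res ℓ C₁ C₂ {D₁} {D₂} {D} e₁ e₂ e π₁ π₂) o supplied =
    let I₁ , L₁ = labels π₁ (overInput₁ o) (λ C∈ → supplied (∈-++⁺ˡ C∈))
        I₂ , L₂ = labels π₂ (overInput₂ o) (λ C∈ → supplied (∈-++⁺ʳ (others π₁) C∈))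
        inv = combined-invariant e₁ e₂ e (sound (overInput₁ o) L₁) (sound (overInput₂ o) L₂)
        E = λ x → elimination {st x} {combined ℓ I₁ I₂ x} (Invariant′.vars inv x)
    in (λ x → proj₁ (E x)) , res elimination-order L₁ L₂ (λ x → proj₂ (E x))
    where open Order D₁ D₂ D

theorem3 : (Sg : Signature) (𝒯 : Logic.Theory Sg) → let open Interpolation Sg 𝒯 in
    (Q : Problem) → let open WithProblem Q in
    (π : Proof []) → OverInput π →
    (κ : Colouring) → let open Algorithm κ in
    ((∀ {C} → C ∈ others π → ∃[ J ] IsPartialInterpolant C J) → ∃[ I ] Labels π I) ×
    (∀ I → Labels π I → IsTreeInterpolant I)
theorem3 Sg 𝒯 Q π o κ = labels π o , λ I L → treeInterpolant (sound o L)
  where open Interpolants Sg 𝒯 Q κ
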